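{- Let $G$ be a graph of order $n\ge 5$ with complement $\overline G$ (in (2) and (5), assume also that each of $G$ and $\overline G$ has an edge). For power domination: (1) $5\le \operatorname{th}_{\gamma_P}(G)+\operatorname{th}_{\gamma_P}(\overline G)\le n+2$ and $6\le \operatorname{th}_{\gamma_P}(G)\cdot\operatorname{th}_{\gamma_P}(\overline G)\le 2n$. (2) $3\le \operatorname{th}_{\gamma_P}^{\ast}(G)+\operatorname{th}_{\gamma_P}^{\ast}(\overline G)\le n$ and $2\le \operatorname{th}_{\gamma_P}^{\ast}(G)\cdot\operatorname{th}_{\gamma_P}^{\ast}(\overline G)\le n$. (3) $6\le \operatorname{th}_{\gamma_P}^{\times}(G)+\operatorname{th}_{\gamma_P}^{\times}(\overline G)\le n+3$ and $8\le \operatorname{th}_{\gamma_P}^{\times}(G)\cdot\operatorname{th}_{\gamma_P}^{\times}(\overline G)\le 4n$. For Cops and Robbers: (4) $5\le \operatorname{th}_c(G)+\operatorname{th}_c(\overline G)\le n+2$ and $6\le \operatorname{th}_c(G)\cdot\operatorname{th}_c(\overline G)\le 2n$. (5) $3\le \operatorname{th}_c^{\ast}(G)+\operatorname{th}_c^{\ast}(\overline G)\le n$ and $2\le \operatorname{th}_c^{\ast}(G)\cdot\operatorname{th}_c^{\ast}(\overline G)\le n$. (6) $6\le \operatorname{th}_c^{\times}(G)+\operatorname{th}_c^{\times}(\overline G)\le n+4$ and $8\le \operatorname{th}_c^{\times}(G)\cdot\operatorname{th}_c^{\times}(\overline G)\le 4n$. All these bounds are sharp (attained by infinitely many graphs),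 except the bound $\operatorname{th}_{\gamma_P}^{\times}(G)\cdot\operatorname{th}_{\gamma_P}^{\times}(\overline G)\le 4n$, in which equality holds only for $G\cong K_3\,\Box\,K_3$. Moreover, for each $Y\in\{\gamma_P,c\}$, if neither $G$ nor $\overline G$ has an isolated vertex, then $$\operatorname{th}_Y(G)+\operatorname{th}_Y(\overline G)\le \left\lfloor\frac n2\right\rfloor+4\quad\text{and}\quad \operatorname{th}_Y(G)\cdot\operatorname{th}_Y(\overline G)\le n+\left\lfloor\frac n2\right\rfloor+3.$$
   Context: Graphs are finite, simple, undirected, with nonempty vertex set; the order of $G$ is $|V(G)|$; $\overline G$ is the complement of $G$; $\Box$ denotes the Cartesian product of graphs. Power domination: for $B\subseteq V(G)$ put $B^{[0]}=B$ and $B^{[1]}=N[B]$ (the vertices of $B$ and all their neighbors); for $i\ge1$, $B^{[i+1]}$ is $B^{[i]}$ together with every vertex $w\notin B^{[i]}$ that is the unique neighbor outside $B^{[i]}$ of some vertex $v\in B^{[i]}$. $\operatorname{pt}_{\gamma_P}(G;B)$ is the least $t$ with $B^{[t]}=V(G)$ ($\infty$ if none exists), and $\operatorname{pt}_{\gamma_P}(G,k)=\min_{|B|=k}\operatorname{pt}_{\gamma_P}(G;B)$. Cops and Robbers: $k$ cops are placed on a multiset of $k$ vertices, then one robber is placed on a vertex. Players alternate turns, cops first; a round is one cops' turn followed by one robber's turn; in a turn each cop (respectively the robber) stays or moves to an adjacent vertex; all information is public. The cops win when a cop occupies the robber's vertex (capture). The cop number $c(G)$ is the least number of cops guaranteeing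 capture in finitely many rounds. $\operatorname{capt}_k(G)$ is the minimum number of rounds in which $k\ge c(G)$ cops can capture the robber under optimal play by both sides ($0$ if every vertex is occupied by a cop initially), and $\operatorname{capt}_k(G)=\infty$ for $k<c(G)$. Write $\operatorname{pt}_c(G,k)=\operatorname{capt}_k(G)$. For $Y\in\{\gamma_P,c\}$ and $G$ of order $n$: $\operatorname{th}_Y(G)=\min_{1\le k\le n}(k+\operatorname{pt}_Y(G,k))$; $\operatorname{th}_Y^{\times}(G)=\min_{1\le k\le n}k(1+\operatorname{pt}_Y(G,k))$; and, if $G$ has an edge, $\operatorname{th}_Y^{\ast}(G)=\min_{1\le k\le n-1}k\cdot\operatorname{pt}_Y(G,k)$. -}

module Defs where

open import Level using (0ℓ)
open import Data.Fin.Base using (Fin; remQuot)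
open import Data.Fin.Properties using (_≟_)
open import Data.Fin.Subset using (Subset; _∈_; ∣_∣)
open import Data.Nat.Base using (ℕ; zero; suc; _+_; _*_; _≤_; _<_)
open import Data.Product.Base using (Σ; ∃; ∃₂; _×_; _,_; proj₁; proj₂)
open import Data.Sum.Base as Sum using (_⊎_)
open import Data.Unit.Base using (⊤)
open import Function.Bundles using (_↔_; _⇔_; Inverse)
open import Relation.Binary.Core using (Rel)
open import Relation.Binary.Construct.Add.Supremum.NonStrict (_≤_) using (_≤⁺_)
open import Relation.Binary.Definitions using (Decidable; Symmetric; Irreflexive)
open import Relation.Binary.PropositionalEquality using (_≡_; _≢_; sym; cong)
open import Relation.Nullary using (¬_)
open import Relation.Nullary.Construct.Add.Supremum using (_⁺; [_]; ⊤⁺)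
open import Relation.Nullary.Decidable using (¬?; _×-dec_; _⊎-dec_)
open import Relation.Unary using (Pred)

record Graph (n : ℕ) : Set₁ where
  infix 4 _~_ _~?_
  field
    _~_      : Rel (Fin n) 0ℓ
    _~?_     : Decidable _~_
    ~-sym    : Symmetric _~_
    ~-irrefl : Irreflexive _≡_ _~_

open Graph public using (~-sym; ~-irrefl)

module _ {n : ℕ} where

  infix 4 _⊢_~_
  _⊢_~_ : Graph n → Rel (Fin n) 0ℓ
  G ⊢ u ~ v = Graph._~_ G u v

  ∁ : Graph n → Graph n
  ∁ G = record
    { _~_      = λ u v → u ≢ v × ¬ G ⊢ u ~ v
    ; _~?_     = λ u v → ¬? (u ≟ v) ×-dec ¬? (Graph._~?_ G u v)
    ; ~-sym    = λ (u≢v , u≁v) → (λ v≡u → u≢v (sym v≡u)) , λ v~u → u≁v (~-sym G v~u)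
    ; ~-irrefl = λ u≡v (u≢v , _) → u≢v u≡v
    }

  HasEdge : Graph n → Set
  HasEdge G = ∃₂ λ u v → G ⊢ u ~ v

  HasIsolatedVertex : Graph n → Set
  HasIsolatedVertex G = ∃ λ v → ∀ u → ¬ G ⊢ v ~ u

K : ∀ n → Graph n
K n = record
  { _~_      = _≢_
  ; _~?_     = λ u v → ¬? (u ≟ v)
  ; ~-sym    = λ u≢v v≡u → u≢v (sym v≡u)
  ; ~-irrefl = λ u≡v u≢v → u≢v u≡v
  }

-- The vertex set Fin m × Fin n is encoded as Fin (m * n) through remQuot.

infixl 7 _□_
_□_ : ∀ {m n} → Graph m → Graph n → Graph (m * n)
_□_ {m} {n} G H = record
  { _~_      = λ x y → (π₁ x ≡ π₁ y × H ⊢ π₂ x ~ π₂ y) ⊎ (G ⊢ π₁ x ~ π₁ y × π₂ x ≡ π₂ y)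
  ; _~?_     = λ x y → ((π₁ x ≟ π₁ y) ×-dec Graph._~?_ H (π₂ x) (π₂ y))
                       ⊎-dec (Graph._~?_ G (π₁ x) (π₁ y) ×-dec (π₂ x ≟ π₂ y))
  ; ~-sym    = Sum.map (λ (p , e) → sym p , ~-sym H e) (λ (e , p) → ~-sym G e , sym p)
  ; ~-irrefl = λ x≡y → Sum.[ (λ (_ , e) → ~-irrefl H (cong π₂ x≡y) e)
                           , (λ (e , _) → ~-irrefl G (cong π₁ x≡y) e) ]
  }
  where
  π₁ : Fin (m * n) → Fin m
  π₁ x = proj₁ (remQuot {m} n x)
  π₂ : Fin (m * n) → Fin n
  π₂ x = proj₂ (remQuot {m} n x)

infix 4 _≅_
_≅_ : ∀ {m n} → Graph m → Graph n → Set
_≅_ {m} {n} G H =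
  Σ (Fin m ↔ Fin n) λ f → ∀ u v → G ⊢ u ~ v ⇔ H ⊢ Inverse.to f u ~ Inverse.to f v

-- ⊤⁺ plays the role of ∞.  Lifted functions fix ∞; below they are applied with
-- a factor k ≥ 1 only, so k · ∞ = ∞ is the intended value.

ℕ∞ : Set
ℕ∞ = ℕ ⁺

liftℕ∞ : (ℕ → ℕ) → ℕ∞ → ℕ∞
liftℕ∞ f [ t ] = [ f t ]
liftℕ∞ f ⊤⁺    = ⊤⁺

IsMinimum : {A : Set} → Rel A 0ℓ → Pred A 0ℓ → Pred A 0ℓ
IsMinimum _≼_ P x = P x × (∀ y → P y → x ≼ y)

module _ {n : ℕ} (G : Graph n) where

  ClosedNeighbourhood : Pred (Fin n) 0ℓ → Pred (Fin n) 0ℓ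
  ClosedNeighbourhood S w = S w ⊎ ∃ λ v → S v × G ⊢ v ~ w

  Force : Pred (Fin n) 0ℓ → Pred (Fin n) 0ℓ
  Force S w = S w ⊎ (¬ S w × ∃ λ v →
    S v × G ⊢ v ~ w × (∀ u → G ⊢ v ~ u → ¬ S u → u ≡ w))

  -- Observed B i is the set B^[i].

  Observed : Subset n → ℕ → Pred (Fin n) 0ℓ
  Observed B 0             = _∈ B
  Observed B 1             = ClosedNeighbourhood (_∈ B)
  Observed B (suc (suc i)) = Force (Observed B (suc i))

  ObservesAll : Subset n → ℕ → Set
  ObservesAll B t = ∀ v → Observed B t v

  data PtPowerOf (B : Subset n) : ℕ∞ → Set where
    finite   : ∀ {t} → IsMinimum _≤_ (ObservesAll B) t → PtPowerOf B [ t ]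
    infinite : (∀ t → ¬ ObservesAll B t) → PtPowerOf B ⊤⁺

  PtPower : ℕ → ℕ∞ → Set
  PtPower k = IsMinimum _≤⁺_ λ p → ∃ λ B → ∣ B ∣ ≡ k × PtPowerOf B p

  StayOrMove : Rel (Fin n) 0ℓ
  StayOrMove u v = u ≡ v ⊎ G ⊢ u ~ v

  -- A position with the cops to move consists of the (labelled, possibly
  -- coinciding) cops' vertices and the robber's vertex.

  Captured : ∀ {k} → (Fin k → Fin n) → Fin n → Set
  Captured C r = ∃ λ i → C i ≡ r

  -- A robber's move onto a cop is a capture in the current round, because WinIn
  -- tests for capture before the next round starts.

  WinIn : ∀ {k} → ℕ → (Fin k → Fin n) → Fin n → Set
  WinIn zero    C r = Captured C r
  WinIn (suc t) C r = Captured C r ⊎ ∃ λ C′ → (∀ i → StayOrMove (C i) (C′ i)) ×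
    (Captured C′ r ⊎ (∀ r′ → StayOrMove r r′ → WinIn t C′ r′))

  CopsWinIn : ℕ → ℕ → Set
  CopsWinIn k t = ∃ λ (C : Fin k → Fin n) → ∀ r → WinIn t C r

  -- As G is finite, capture in finitely many rounds comes with a bound on the
  -- number of rounds.

  IsCopNumber : ℕ → Set
  IsCopNumber = IsMinimum _≤_ λ k → ∃ λ t → CopsWinIn k t

  -- The premise of finite already forces k to be at least the cop number.

  data Capt (k : ℕ) : ℕ∞ → Set where
    finite   : ∀ {t} → IsMinimum _≤_ (CopsWinIn k) t → Capt k [ t ]
    infinite : ∀ {c} → IsCopNumber c → k < c → Capt k ⊤⁺

data Variant : Set where
  γP c : Variant

Pt : Variant → ∀ {n} → Graph n → ℕ → ℕ∞ → Set
Pt γP = PtPower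
Pt c  = Capt

Th Th* Th× : Variant → ∀ {n} → Graph n → ℕ → Set
Th Y {n} G m = IsMinimum _≤⁺_
  (λ q → ∃₂ λ k p → 1 ≤ k × k ≤ n × Pt Y G k p × q ≡ liftℕ∞ (λ t → k + t) p) [ m ]
Th* Y {n} G m = IsMinimum _≤⁺_
  (λ q → ∃₂ λ k p → 1 ≤ k × k < n × Pt Y G k p × q ≡ liftℕ∞ (λ t → k * t) p) [ m ]
Th× Y {n} G m = IsMinimum _≤⁺_
  (λ q → ∃₂ λ k p → 1 ≤ k × k ≤ n × Pt Y G k p × q ≡ liftℕ∞ (λ t → k * (1 + t)) p) [ m ]

Parameter : Set₁
Parameter = ∀ {n} → Graph n → ℕ → Set

-- The values of Θ at G and at its complement exist and are related by R.

WithComplement : Parameter → ∀ {n} → Graph n → Rel ℕ 0ℓ → Set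
WithComplement Θ G R = ∃₂ λ a b → Θ G a × Θ (∁ G) b × R a b

BothHaveEdges : ∀ {n} → Graph n → Set
BothHaveEdges G = HasEdge G × HasEdge (∁ G)

NoCondition : ∀ {n} → Graph n → Set
NoCondition _ = ⊤

-- Up to isomorphism there are finitely many graphs of each order, so infinitely
-- many graphs attain a bound exactly when graphs of arbitrarily large order do.

InfinitelyOften : (Cond : ∀ {n} → Graph n → Set) → Parameter → (ℕ → Rel ℕ 0ℓ) → Set₁
InfinitelyOften Cond Θ R = ∀ N → ∃ λ n → N ≤ n × 5 ≤ n ×
  Σ (Graph n) λ G → Cond G × WithComplement Θ G (R n)

{-# OPTIONS --safe #-}
module Submission where

-- A dominating set of k vertices gives the pair (k , 1) for both parameters, so
-- all upper bounds follow from the Jaeger–Payan inequality γ(G) γ(∁ G) ≤ n, with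
-- two refinements for power domination.
--
-- For th× (G) + th× (∁ G) ≤ n + 3 the only critical case is γ(G) = 2, γ(∁ G) = n / 2.
-- Then ∁ G either has a leaf v, and {v} observes G in two steps, or is a disjoint
-- union of 4-cycles, and one vertex of each cycle observes it in two steps.
--
-- If th× (G) th× (∁ G) = 4 n, then γ(G) γ(∁ G) = n with both factors g, h at least 3.
-- Any h - 1 vertices have a common neighbour and any g - 1 a common non-neighbour;
-- hence any j vertices have more than (h - 1 - j)(g - 1) common neighbours, and
-- counting paths of length two leaves only {g , h} = {3 , r} with r ≤ 5.  A finer
-- count excludes r = 5, the structure of the neighbourhoods excludes r = 4, and
-- for r = 3 the graph is strongly regular with parameters (9, 4, 1, 2), that is
-- K₃ □ K₃.

open import Data.Bool.Base using (true)
open import Data.Empty using (⊥)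
open import Data.Fin.Base using (Fin; zero; suc; toℕ; fromℕ<; punchIn; punchOut; combine; remQuot; inject≤; splitAt; _↑ˡ_; _↑ʳ_; quotient; remainder; opposite)
open import Data.Fin.Patterns using (0F; 1F; 2F; 3F; 4F)
open import Data.Fin.Permutation using (permutation; ↔⇒≡)
open import Data.Fin.Properties using (_≟_; any?; all?; injective⇒≤; suc-injective; toℕ-injective; toℕ-fromℕ<; toℕ-inject≤; toℕ<n; ¬∀⟶∃¬; punchInᵢ≢i; punchIn-punchOut; punchIn-injective; splitAt-↑ˡ; splitAt-↑ʳ; combine-remQuot; remQuot-combine)
open import Data.Fin.Subset using (Subset; _∈_; ∣_∣; inside; outside; ⊤; ⁅_⁆)
open import Data.Fin.Subset.Properties using (_∈?_; anySubset?; ∣⊤∣≡n; ∈⊤; ∣⁅x⁆∣≡1; x∈⁅x⁆)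
open import Data.Nat.Base using (ℕ; zero; suc; _+_; _*_; _∸_; _≤_; _<_; z≤n; s≤s; s≤s⁻¹; ⌊_/2⌋)
import Data.Nat.Properties as ℕ
open import Data.Nat.Tactic.RingSolver using (solve-∀)
open import Data.Product.Base using (∃; ∃₂; _×_; _,_; proj₁; proj₂)
open import Data.Sum.Base as Sum using (_⊎_; inj₁; inj₂; [_,_]′)
open import Data.Unit.Base using (tt) renaming (⊤ to Unit)
open import Data.Vec.Base as Vec using (Vec; []; _∷_; lookup; tabulate)
import Data.Vec.Functional as F
open import Data.Vec.Membership.Propositional using () renaming (_∈_ to _∈ᵥ_; _∉_ to _∉ᵥ_)
open import Data.Vec.Properties using (lookup∘tabulate; []=⇒lookup; lookup⇒[]=)
open import Data.Vec.Relation.Unary.All as All using (All; []; _∷_)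
open import Data.Vec.Relation.Unary.All.Properties using (lookup⁺)
open import Data.Vec.Relation.Unary.AllPairs using ([]; _∷_)
open import Data.Vec.Relation.Unary.Any as Anyᵥ using (here; there) renaming (any? to anyᵥ?)
open import Data.Vec.Relation.Unary.Any.Properties using (lookup-index)
open import Data.Vec.Relation.Unary.Unique.Propositional using (Unique)
open import Data.Vec.Relation.Unary.Unique.Propositional.Properties using (lookup-injective)
open import Function.Base using (_∘_; id; const; case_of_)
open import Function.Bundles using (Injection; Inverse; Equivalence; mk⇔; mk↔ₛ′; _⇔_)
open import Function.Definitions using (Injective)
open import Function.Properties.Inverse using (↔⇒↣)
open import Level using (0ℓ)
open import Relation.Binary.Construct.Add.Supremum.NonStrict (_≤_) using (_≤⁺_; [_]; _≤⊤⁺)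
open import Relation.Binary.Definitions using (tri<; tri≈; tri>)
open import Relation.Binary.PropositionalEquality
open import Relation.Nullary using (¬_; Dec; yes; no; does; contradiction)
open import Relation.Nullary.Construct.Add.Supremum using ([_]; ⊤⁺)
open import Relation.Nullary.Decidable using (¬?; _×-dec_; _⊎-dec_; _→-dec_; map′; decidable-stable; from-yes)
open import Relation.Unary using (Pred; Decidable)
open import Algebra.Properties.Semiring.Sum ℕ.+-*-semiring using (sum; sum-syntax; sum-cong-≗; ∑-distrib-+; ∑-comm; ∑-permute; *-distribˡ-sum)
open import Defs

-- Indicators, sums and counting

𝟙 : ∀ {P : Set} → Dec P → ℕ
𝟙 (yes _) = 1
𝟙 (no  _) = 0

𝟙-yes : ∀ {P : Set} (P? : Dec P) → P → 𝟙 P? ≡ 1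
𝟙-yes (yes _) _ = refl
𝟙-yes (no ¬p) p = contradiction p ¬p

𝟙-no : ∀ {P : Set} (P? : Dec P) → ¬ P → 𝟙 P? ≡ 0
𝟙-no (yes p) ¬p = contradiction p ¬p
𝟙-no (no  _) _  = refl

𝟙-mono : ∀ {P Q : Set} (P? : Dec P) (Q? : Dec Q) → (P → Q) → 𝟙 P? ≤ 𝟙 Q?
𝟙-mono (yes p) Q? f = ℕ.≤-reflexive (sym (𝟙-yes Q? (f p)))
𝟙-mono (no  _) Q? f = z≤n

sum-mono : ∀ {n} {f g : Fin n → ℕ} → (∀ i → f i ≤ g i) → sum f ≤ sum g
sum-mono {zero}  f≤g = z≤n
sum-mono {suc n} f≤g = ℕ.+-mono-≤ (f≤g zero) (sum-mono (f≤g ∘ suc))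

sum-const : ∀ n m → ∑[ i < n ] m ≡ n * m
sum-const zero    m = refl
sum-const (suc n) m = cong (m +_) (sum-const n m)

δ : ∀ {n} → Fin n → Fin n → ℕ
δ u v = 𝟙 (u ≟ v)

δ-≢ : ∀ {n} {u v : Fin n} → u ≢ v → δ u v ≡ 0
δ-≢ {u = u} {v} = 𝟙-no (u ≟ v)

δ-suc : ∀ {n} (u v : Fin n) → δ (suc u) (suc v) ≡ δ u v
δ-suc u v with u ≟ v
... | yes _ = refl
... | no  _ = refl

sum-δ* : ∀ {n} (u : Fin n) (f : Fin n → ℕ) → ∑[ v < n ] (δ u v * f v) ≡ f u
sum-δ* {suc n} zero f = trans (cong₂ _+_ (ℕ.*-identityˡ (f zero)) (trans (sum-const n 0) (ℕ.*-zeroʳ n))) (ℕ.+-identityʳ _)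
sum-δ* {suc n} (suc u) f = trans (sum-cong-≗ λ v → cong (_* f (suc v)) (δ-suc u v)) (sum-δ* u (f ∘ suc))

sum-*δ : ∀ {n} (u : Fin n) m → ∑[ v < n ] (m * δ u v) ≡ m
sum-*δ u m = trans (sum-cong-≗ λ v → ℕ.*-comm m (δ u v)) (sum-δ* u (const m))

sum-δ : ∀ {n} (u : Fin n) → ∑[ v < n ] δ u v ≡ 1
sum-δ u = trans (sum-cong-≗ λ v → sym (ℕ.*-identityˡ (δ u v))) (sum-*δ u 1)

sum-≥ : ∀ {k m} (f : Fin k → ℕ) → (∀ i → m ≤ f i) → k * m ≤ sum f
sum-≥ {k} {m} f m≤f = subst (_≤ sum f) (sum-const k m) (sum-mono m≤f)

sum-+δ : ∀ {n} (g : Fin n → ℕ) i m → ∑[ j < n ] (g j + m * δ i j) ≡ sum g + m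
sum-+δ g i m = trans (∑-distrib-+ g (λ j → m * δ i j)) (cong (sum g +_) (sum-*δ i m))

-- Lets one exceptional index sharpen a pointwise bound by `m`; the double counts for the small
-- orders rest on it.
sum-excess : ∀ {n} {f g : Fin n → ℕ} → (∀ i → g i ≤ f i) → ∀ i m → g i + m ≤ f i → sum g + m ≤ sum f
sum-excess {n} {f} {g} g≤f i m excess = subst (_≤ sum f) (sum-+δ g i m) (sum-mono pointwise)
  where
  pointwise : ∀ j → g j + m * δ i j ≤ f j
  pointwise j with i ≟ j
  ... | yes refl = subst (λ x → g i + x ≤ f i) (sym (ℕ.*-identityʳ m)) excess
  ... | no  _    = subst (_≤ f j) (sym (trans (cong (g j +_) (ℕ.*-zeroʳ m)) (ℕ.+-identityʳ (g j)))) (g≤f j)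

-- A strict inequality at one index would already separate the sums. This is how extremal counts
-- become exact values.
sum-tight : ∀ {n} {f g : Fin n → ℕ} → (∀ i → g i ≤ f i) → sum f ≤ sum g → ∀ i → f i ≡ g i
sum-tight {f = f} {g} g≤f Σf≤Σg i with g i ℕ.<? f i
... | no  ≮ = ℕ.≤-antisym (ℕ.≮⇒≥ ≮) (g≤f i)
... | yes < = contradiction (ℕ.≤-trans (sum-excess g≤f i 1 (subst (_≤ f i) (ℕ.+-comm 1 (g i)) <)) Σf≤Σg)
                            (ℕ.<⇒≱ (ℕ.m<m+n (sum g) (s≤s z≤n)))

module _ {n : ℕ} {P : Pred (Fin n) 0ℓ} (P? : Decidable P) where

  count : ℕ
  count = ∑[ v < n ] 𝟙 (P? v)

count-mono : ∀ {n} {P Q : Pred (Fin n) 0ℓ} (P? : Decidable P) (Q? : Decidable Q) →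
             (∀ v → P v → Q v) → count P? ≤ count Q?
count-mono P? Q? P⊆Q = sum-mono λ v → 𝟙-mono (P? v) (Q? v) (P⊆Q v)

fresh : ∀ {n k} {v : Fin n} (xs : Vec (Fin n) k) → v ∉ᵥ xs → All (v ≢_) xs
fresh []       _    = []
fresh (x ∷ xs) v∉xs = (v∉xs ∘ here) ∷ fresh xs (v∉xs ∘ there)

record Enumeration {n : ℕ} (P : Pred (Fin n) 0ℓ) (k : ℕ) : Set where
  field
    at       : Fin k → Fin n
    at-inj   : Injective _≡_ _≡_ at
    at-∈     : ∀ i → P (at i)
    index    : ∀ {v} → P v → Fin k
    at-index : ∀ {v} (p : P v) → at (index p) ≡ v

enumerate : ∀ {n} {P : Pred (Fin n) 0ℓ} (P? : Decidable P) → Enumeration P (count P?)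
enumerate {zero}  P? = record
  { at = λ () ; at-inj = λ {} ; at-∈ = λ () ; index = λ {} ; at-index = λ {} }
enumerate {suc n} {P} P? with P? zero
... | no ¬p₀ = record
  { at = suc ∘ at ; at-inj = at-inj ∘ suc-injective ; at-∈ = at-∈
  ; index = index′ ; at-index = at-index′ }
  where
  open Enumeration (enumerate (P? ∘ suc))
  index′ : ∀ {v} → P v → Fin (count (P? ∘ suc))
  index′ {zero}  p = contradiction p ¬p₀
  index′ {suc v} p = index p
  at-index′ : ∀ {v} (p : P v) → suc (at (index′ p)) ≡ v
  at-index′ {zero}  p = contradiction p ¬p₀
  at-index′ {suc v} p = cong suc (at-index p)
... | yes p₀ = record
  { at = at′ ; at-inj = λ {i} {j} → at′-inj i j ; at-∈ = at′-∈
  ; index = index′ ; at-index = at-index′ }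
  where
  open Enumeration (enumerate (P? ∘ suc))
  at′ : Fin (suc (count (P? ∘ suc))) → Fin (suc n)
  at′ zero    = zero
  at′ (suc i) = suc (at i)
  at′-inj : ∀ i j → at′ i ≡ at′ j → i ≡ j
  at′-inj zero    zero    _ = refl
  at′-inj (suc i) (suc j) e = cong suc (at-inj (suc-injective e))
  at′-∈ : ∀ i → P (at′ i)
  at′-∈ zero    = p₀
  at′-∈ (suc i) = at-∈ i
  index′ : ∀ {v} → P v → Fin (suc (count (P? ∘ suc)))
  index′ {zero}  p = zero
  index′ {suc v} p = suc (index p)
  at-index′ : ∀ {v} (p : P v) → at′ (index′ p) ≡ v
  at-index′ {zero}  p = refl
  at-index′ {suc v} p = cong suc (at-index p)

module _ {n : ℕ} {P : Pred (Fin n) 0ℓ} (P? : Decidable P) where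

  open Enumeration (enumerate P?)

  injection⇒≤count : ∀ {k} (e : Fin k → Fin n) → Injective _≡_ _≡_ e → (∀ i → P (e i)) → k ≤ count P?
  injection⇒≤count e e-inj e∈P = injective⇒≤ {f = index ∘ e∈P} λ {i} {j} eq →
    e-inj (trans (sym (at-index (e∈P i))) (trans (cong at eq) (at-index (e∈P j))))

  cover⇒count≤ : ∀ {k} (e : Fin k → Fin n) → (∀ v → P v → ∃ λ i → e i ≡ v) → count P? ≤ k
  cover⇒count≤ {k} e cover = injective⇒≤ {f = pre} λ {i} {j} eq →
    at-inj (trans (sym (proj₂ (cover _ (at-∈ i)))) (trans (cong e eq) (proj₂ (cover _ (at-∈ j)))))
    where
    pre : Fin (count P?) → Fin k
    pre i = proj₁ (cover _ (at-∈ i))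

  unique⇒≤count : ∀ {k} (xs : Vec (Fin n) k) → Unique xs → All P xs → k ≤ count P?
  unique⇒≤count xs u xs∈P = injection⇒≤count (lookup xs) (lookup-injective u _ _) (λ i → lookup⁺ xs∈P i)

  opaque
    count≤⇒∈ : ∀ {k} (xs : Vec (Fin n) k) → Unique xs → All P xs → count P? ≤ k →
               ∀ v → P v → v ∈ᵥ xs
    count≤⇒∈ {k} xs u xs∈P count≤k v pv with anyᵥ? (v ≟_) xs
    ... | yes v∈xs = v∈xs
    ... | no  v∉xs = contradiction (ℕ.≤-trans (unique⇒≤count (v ∷ xs) (fresh xs v∉xs ∷ u) (pv ∷ xs∈P)) count≤k) ℕ.1+n≰n

  opaque
    <count⇒∃∉ : ∀ {k} (xs : Vec (Fin n) k) → k < count P? → ∃ λ v → P v × v ∉ᵥ xs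
    <count⇒∃∉ xs k<count with any? (λ v → P? v ×-dec ¬? (anyᵥ? (v ≟_) xs))
    ... | yes found = found
    ... | no  none  = contradiction (cover⇒count≤ (lookup xs) covered) (ℕ.<⇒≱ k<count)
      where
      covered : ∀ v → P v → ∃ λ i → lookup xs i ≡ v
      covered v pv with anyᵥ? (v ≟_) xs
      ... | yes v∈xs = Anyᵥ.index v∈xs , sym (lookup-index v∈xs)
      ... | no  v∉xs = contradiction (v , pv , v∉xs) none

  count≤n : count P? ≤ n
  count≤n = injective⇒≤ at-inj

  opaque
    cover : Fin n → ∀ {k} → count P? ≤ k → ∃ λ (D : Fin k → Fin n) → ∀ v → P v → ∃ λ i → D i ≡ v
    cover v₀ {k} count≤k = D , covers
      where
      D : Fin k → Fin n
      D i with toℕ i ℕ.<? count P?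
      ... | yes i< = at (fromℕ< i<)
      -- Padding: indices beyond the count repeat `v₀`, so that the family has exactly `k` entries.
      ... | no  _  = v₀
      covers : ∀ v → P v → ∃ λ i → D i ≡ v
      covers v p = inject≤ (index p) count≤k , D-index
        where
        D-index : D (inject≤ (index p) count≤k) ≡ v
        D-index with toℕ (inject≤ (index p) count≤k) ℕ.<? count P?
        ... | yes i< = trans (cong at (toℕ-injective (trans (toℕ-fromℕ< i<) (toℕ-inject≤ (index p) count≤k)))) (at-index p)
        ... | no  i≮ = contradiction (subst (_< count P?) (sym (toℕ-inject≤ (index p) count≤k)) (toℕ<n (index p))) i≮

≥1-witness : ∀ {n} {P : Pred (Fin n) 0ℓ} (P? : Decidable P) → 1 ≤ count P? → ∃ P
≥1-witness P? 1≤ with <count⇒∃∉ P? [] 1≤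
... | v , p , _ = v , p

opaque
  two-witnesses : ∀ {n} {P : Pred (Fin n) 0ℓ} (P? : Decidable P) → 2 ≤ count P? → ∃₂ λ u v → u ≢ v × P u × P v
  two-witnesses P? 2≤ with <count⇒∃∉ P? [] (ℕ.<⇒≤ 2≤)
  ... | u , pu , _ with <count⇒∃∉ P? (u ∷ []) 2≤
  ...   | v , pv , v∉ = u , v , (λ e → v∉ (here (sym e))) , pu , pv

two⇒≤count : ∀ {n} {P : Pred (Fin n) 0ℓ} (P? : Decidable P) {u v} → u ≢ v → P u → P v → 2 ≤ count P?
two⇒≤count P? {u} {v} u≢v pu pv = unique⇒≤count P? (u ∷ v ∷ []) ((u≢v ∷ []) ∷ [] ∷ []) (pu ∷ pv ∷ [])

count≤1⇒≡ : ∀ {n} {P : Pred (Fin n) 0ℓ} (P? : Decidable P) → count P? ≤ 1 → ∀ {u v} → P u → P v → u ≡ v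
count≤1⇒≡ P? ≤1 {u} {v} pu pv = decidable-stable (u ≟ v) λ u≢v → ℕ.<⇒≱ (two⇒≤count P? u≢v pu pv) ≤1

-- The search builds functions as `x F.∷ f`. Without function extensionality such a function is only
-- pointwise equal to a given one, hence the hypothesis that `P` respects `≗`.
anyFunction? : ∀ {n} k {P : (Fin k → Fin n) → Set} → (∀ {f g} → f ≗ g → P f → P g) →
               (∀ f → Dec (P f)) → Dec (∃ P)
anyFunction? zero {P} resp P? =
  map′ (F.[] ,_) (λ (f , p) → resp (λ ()) p) (P? F.[])
anyFunction? (suc k) {P} resp P? =
  map′ (λ (x , f , p) → (x F.∷ f) , p)
       (λ (f , p) → f zero , f ∘ suc , resp (λ { zero → refl ; (suc i) → refl }) p)
       (any? λ x → anyFunction? k {λ f → P (x F.∷ f)}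
         (λ f≗g → resp λ { zero → refl ; (suc i) → f≗g i }) (λ f → P? (x F.∷ f)))

least : ∀ {P : ℕ → Set} → (∀ k → Dec (P k)) → ∀ m → P m → ∃ (IsMinimum _≤_ P)
least {P} P? m pm with P? 0
... | yes p₀ = 0 , p₀ , λ _ _ → z≤n
least {P} P? zero    pm | no ¬p₀ = contradiction pm ¬p₀
least {P} P? (suc m) pm | no ¬p₀ with least (P? ∘ suc) m pm
... | k , pk , minimal = suc k , pk , λ { zero p₀ → contradiction p₀ ¬p₀ ; (suc j) pj → s≤s (minimal j pj) }

-- Complementary graphs and domination

-- A relation instead of the equation `H ≡ ∁ G`: adjacency in `∁ (∁ G)` is only doubly negated
-- adjacency in `G`, whereas this relation is symmetric, since adjacency is decidable.
record Complementary {n : ℕ} (G H : Graph n) : Set where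
  field
    disjoint : ∀ {u v} → G ⊢ u ~ v → ¬ H ⊢ u ~ v
    covering : ∀ {u v} → u ≢ v → ¬ G ⊢ u ~ v → H ⊢ u ~ v

open Complementary

∁-complementary : ∀ {n} (G : Graph n) → Complementary G (∁ G)
∁-complementary G = record { disjoint = λ e (_ , ¬e) → ¬e e ; covering = _,_ }

complementary-sym : ∀ {n} {G H : Graph n} → Complementary G H → Complementary H G
complementary-sym {G = G} co = record
  { disjoint = λ h g → disjoint co g h
  ; covering = λ {u} {v} u≢v ¬h → decidable-stable (Graph._~?_ G u v) λ ¬g → ¬h (covering co u≢v ¬g)
  }

~⇒≢ : ∀ {n} (G : Graph n) {u v} → G ⊢ u ~ v → u ≢ v
~⇒≢ G e u≡v = ~-irrefl G u≡v e

module _ {n : ℕ} (G : Graph n) where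

  stayOrMove? : ∀ u v → Dec (StayOrMove G u v)
  stayOrMove? u v = (u ≟ v) ⊎-dec Graph._~?_ G u v

  Dominates : ∀ {k} → (Fin k → Fin n) → Set
  Dominates D = ∀ v → ∃ λ i → StayOrMove G (D i) v

  Dom : ℕ → Set
  Dom k = ∃ λ (D : Fin k → Fin n) → Dominates D

  dom? : ∀ k → Dec (Dom k)
  dom? k = anyFunction? k
    (λ f≗g dom v → let i , s = dom v in i , subst (λ u → StayOrMove G u v) (f≗g i) s)
    (λ D → all? λ v → any? λ i → stayOrMove? (D i) v)

  dom-all : Dom n
  dom-all = id , λ v → v , inj₁ refl

  dom-weaken : ∀ {j k} → Fin n → j ≤ k → Dom j → Dom k
  dom-weaken {j} {k} v₀ j≤k (D , dom) = subst Dom (ℕ.m+[n∸m]≡n j≤k)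
    ( [ D , const v₀ ]′ ∘ splitAt j
    , λ v → let i , s = dom v in
        (i ↑ˡ (k ∸ j)) , subst (λ x → StayOrMove G ([ D , const v₀ ]′ x) v) (sym (splitAt-↑ˡ j i (k ∸ j))) s )

  opaque
    dominationNumber : ∃ (IsMinimum _≤_ Dom)
    dominationNumber = least dom? n dom-all

opaque
  -- A vertex left undominated in `H` by `J` differs from each `J i` and is not `H`-adjacent to it.
  -- In this form lower bounds on a domination number enter the structural arguments.
  common-neighbour : ∀ {n} {G H : Graph n} → Complementary G H → ∀ {k} → ¬ Dom H k →
                     (J : Fin k → Fin n) → ∃ λ v → ∀ i → G ⊢ J i ~ v
  common-neighbour {n} {G} {H} co ¬dom J
    with ¬∀⟶∃¬ n _ (λ v → any? λ i → stayOrMove? H (J i) v) (λ dom → ¬dom (J , dom))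
  ... | v , ¬near = v , λ i → decidable-stable (Graph._~?_ G (J i) v) λ ¬e →
    ¬near (i , (case J i ≟ v of λ { (yes e) → inj₁ e ; (no ≢v) → inj₂ (covering co ≢v ¬e) }))

-- The Jaeger–Payan inequality

fibre-sum : ∀ {n k} (f : Fin n → Fin k) → ∑[ i < k ] count (λ v → f v ≟ i) ≡ n
fibre-sum {n} {k} f = begin
  ∑[ i < k ] ∑[ v < n ] 𝟙 (f v ≟ i)  ≡⟨ ∑-comm (λ i v → 𝟙 (f v ≟ i)) ⟩
  ∑[ v < n ] ∑[ i < k ] δ (f v) i    ≡⟨ sum-cong-≗ (λ v → sum-δ (f v)) ⟩
  ∑[ v < n ] 1                       ≡⟨ sum-const n 1 ⟩
  n * 1                              ≡⟨ ℕ.*-identityʳ n ⟩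
  n                                  ∎
  where open ≡-Reasoning

module _ {n g : ℕ} (G : Graph n) where

  DominatedParts : (Fin n → Fin g) → Set
  DominatedParts f = ∀ i → ∃ λ x → ∀ y → f y ≡ i → StayOrMove G x y

  -- Equivalently, every part dominates the complement: `y` is either `x` itself or a neighbour of
  -- `x` there.
  Stable : (Fin n → Fin g) → Set
  Stable f = ∀ i x → ∃ λ y → f y ≡ i × ¬ G ⊢ x ~ y

  DominatesOwnPart : (Fin n → Fin g) → Pred (Fin n) 0ℓ
  DominatesOwnPart f x = ∀ y → f y ≡ f x → StayOrMove G x y

  dominatesOwnPart? : ∀ f → Decidable (DominatesOwnPart f)
  dominatesOwnPart? f x = all? λ y → (f y ≟ f x) →-dec stayOrMove? G x y

module _ {n g : ℕ} (G : Graph n) (¬dom : ¬ Dom G g) where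

  -- A vertex x adjacent to all of part i is moved into part i.  It cannot
  -- dominate its old part, since the two parts could then be merged; hence the
  -- number of vertices dominating their own part increases.

  private
    module Move (f : Fin n → Fin (suc g)) (valid : DominatedParts G f)
                (i : Fin (suc g)) (x : Fin n) (x~i : ∀ y → f y ≡ i → G ⊢ x ~ y) where

      fx≢i : f x ≢ i
      fx≢i e = ~-irrefl G refl (x~i x e)

      moved : Fin n → Fin (suc g)
      moved v with v ≟ x
      ... | yes _ = i
      ... | no  _ = f v

      moved-x : moved x ≡ i
      moved-x with x ≟ x
      ... | yes _  = refl
      ... | no x≢x = contradiction refl x≢x

      moved-≢ : ∀ {v} → v ≢ x → moved v ≡ f v
      moved-≢ {v} v≢x with v ≟ x
      ... | yes e = contradiction e v≢x
      ... | no  _ = refl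

      x-bad : ¬ DominatesOwnPart G f x
      x-bad good = ¬dom (D , dominates)
        where
        -- Part `i` is skipped through `punchIn i`. The part of `x` gets `x` as its dominating
        -- vertex, which also serves part `i`, all of whose members are adjacent to `x`.
        D : Fin g → Fin n
        D j with punchIn i j ≟ f x
        ... | yes _ = x
        ... | no  _ = proj₁ (valid (punchIn i j))
        D-part : ∀ j v → f v ≡ punchIn i j → StayOrMove G (D j) v
        D-part j v fv≡ with punchIn i j ≟ f x
        ... | yes e = good v (trans fv≡ e)
        ... | no  _ = proj₂ (valid (punchIn i j)) v fv≡
        D-x : ∀ j v → f v ≡ i → punchIn i j ≡ f x → StayOrMove G (D j) v
        D-x j v fv≡i e with punchIn i j ≟ f x
        ... | yes _ = inj₂ (x~i v fv≡i)
        ... | no ¬e = contradiction e ¬e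
        dominates : Dominates G D
        dominates v with f v ≟ i
        ... | yes fv≡i = punchOut (≢-sym fx≢i) , D-x _ v fv≡i (punchIn-punchOut (≢-sym fx≢i))
        ... | no  fv≢i = punchOut (≢-sym fv≢i) , D-part _ v (sym (punchIn-punchOut (≢-sym fv≢i)))

      moved-valid : DominatedParts G moved
      moved-valid j with j ≟ i
      ... | yes refl = x , λ y e → case y ≟ x of λ
        { (yes y≡x) → inj₁ (sym y≡x)
        ; (no  y≢x) → inj₂ (x~i y (trans (sym (moved-≢ y≢x)) e)) }
      ... | no j≢i = proj₁ (valid j) , λ y e → case y ≟ x of λ
        { (yes refl) → contradiction (trans (sym e) moved-x) j≢i
        ; (no  y≢x)  → proj₂ (valid j) y (trans (sym (moved-≢ y≢x)) e) }

      keeps : ∀ v → DominatesOwnPart G f v → DominatesOwnPart G moved v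
      keeps v good y e with v ≟ x
      ... | yes refl = contradiction good x-bad
      ... | no  v≢x  with y ≟ x
      -- The newcomer `x` shares the part of `v` only if that is part `i`, to which `x` is
      -- completely joined.
      ...   | yes refl = inj₂ (~-sym G (x~i v (sym e)))
      ...   | no  y≢x  = good y e

      x-good : DominatesOwnPart G moved x
      x-good y e = case y ≟ x of λ
        { (yes y≡x) → inj₁ (sym y≡x)
        ; (no  y≢x) → inj₂ (x~i y (trans (sym (moved-≢ y≢x)) (trans e moved-x))) }

      increases : count (dominatesOwnPart? G f) < count (dominatesOwnPart? G moved)
      increases = begin
        suc (count (dominatesOwnPart? G f))
          ≡⟨ cong (_+ count (dominatesOwnPart? G f)) (sym (sum-δ x)) ⟩
        sum (δ x) + count (dominatesOwnPart? G f)
          ≡⟨ sym (∑-distrib-+ (δ x) _) ⟩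
        ∑[ v < n ] (δ x v + 𝟙 (dominatesOwnPart? G f v))
          ≤⟨ sum-mono pointwise ⟩
        count (dominatesOwnPart? G moved) ∎
        where
        open ℕ.≤-Reasoning
        pointwise : ∀ v → δ x v + 𝟙 (dominatesOwnPart? G f v) ≤ 𝟙 (dominatesOwnPart? G moved v)
        pointwise v with x ≟ v
        ... | yes refl = ℕ.≤-reflexive (trans (cong suc (𝟙-no (dominatesOwnPart? G f x) x-bad)) (sym (𝟙-yes (dominatesOwnPart? G moved x) x-good)))
        ... | no  _    = 𝟙-mono (dominatesOwnPart? G f v) (dominatesOwnPart? G moved v) (keeps v)

    -- `r` bounds the number of moves still possible: each move increases the number of vertices
    -- dominating their own part, which never exceeds `n`.
    stabilise : ∀ r (f : Fin n → Fin (suc g)) → DominatedParts G f →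
                n ≤ count (dominatesOwnPart? G f) + r → ∃ λ f′ → DominatedParts G f′ × Stable G f′
    stabilise r f valid bound
      with any? (λ i → any? λ x → all? λ y → (f y ≟ i) →-dec Graph._~?_ G x y)
    ... | no unmovable = f , valid , stable
      where
      stable : Stable G f
      stable i x with any? (λ y → (f y ≟ i) ×-dec ¬? (Graph._~?_ G x y))
      ... | yes found = found
      ... | no  none  = contradiction
        (i , x , λ y fy≡i → decidable-stable (Graph._~?_ G x y) λ ¬e → none (y , fy≡i , ¬e)) unmovable
    stabilise zero    f valid bound | yes (i , x , x~i) = contradiction
      (ℕ.≤-trans increases (ℕ.≤-trans (count≤n (dominatesOwnPart? G moved)) (subst (n ≤_) (ℕ.+-identityʳ _) bound)))
      (ℕ.<-irrefl refl)
      where open Move f valid i x x~i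
    stabilise (suc r) f valid bound | yes (i , x , x~i) = stabilise r moved moved-valid
      (ℕ.≤-trans (subst (n ≤_) (ℕ.+-suc _ r) bound) (ℕ.+-monoˡ-≤ r increases))
      where open Move f valid i x x~i

  stable-partition : Dom G (suc g) → ∃ λ (f : Fin n → Fin (suc g)) → DominatedParts G f × Stable G f
  stable-partition (D , dom) = stabilise n (proj₁ ∘ dom)
    (λ i → D i , λ y e → subst (λ j → StayOrMove G (D j) y) e (proj₂ (dom y))) (ℕ.m≤n+m n _)

stable⇒dom : ∀ {n g} {G H : Graph n} → Complementary G H → {f : Fin n → Fin g} → Stable G f →
             ∀ i → Dom H (count (λ v → f v ≟ i))
stable⇒dom {G = G} {H} co {f} stable i = at , λ v →
  let y , fy≡i , v≁y = stable i v in
  index fy≡i , subst (λ u → StayOrMove H u v) (sym (at-index fy≡i)) (near v≁y)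
  where
  open Enumeration (enumerate (λ v → f v ≟ i))
  near : ∀ {v y} → ¬ G ⊢ v ~ y → StayOrMove H y v
  near {v} {y} v≁y with y ≟ v
  ... | yes y≡v = inj₁ y≡v
  ... | no  y≢v = inj₂ (covering co y≢v (v≁y ∘ ~-sym G))

-- Each part of a stable partition into γ(G) parts dominates `H`, hence has at least `h` elements,
-- and the sizes add up to `n`. Minimality of γ(G) is what prevents two parts from merging during
-- stabilisation.
jaeger-payan : ∀ {n g h} {G H : Graph n} → Complementary G H →
               IsMinimum _≤_ (Dom G) g → IsMinimum _≤_ (Dom H) h → g * h ≤ n
jaeger-payan {g = zero} _ _ _ = z≤n
jaeger-payan {n} {suc g} {h} {G} co (domG , minG) (_ , minH)
  with stable-partition G (λ dom → ℕ.1+n≰n (minG g dom)) domG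
... | f , _ , stable = subst (suc g * h ≤_) (fibre-sum f)
  (sum-≥ (λ i → count (λ v → f v ≟ i)) λ i → minH _ (stable⇒dom co stable i))

-- Subsets and decidable predicates

∣_∣≡count : ∀ {n} (B : Subset n) → ∣ B ∣ ≡ count (_∈? B)
∣ []          ∣≡count = refl
∣ inside  ∷ B ∣≡count = cong suc (trans ∣ B ∣≡count (ℕ.≤-antisym
  (count-mono (_∈? B) (λ v → suc v ∈? (inside ∷ B)) (λ _ → Vec.there))
  (count-mono (λ v → suc v ∈? (inside ∷ B)) (_∈? B) (λ { _ (Vec.there p) → p }))))
∣ outside ∷ B ∣≡count = trans ∣ B ∣≡count (ℕ.≤-antisym
  (count-mono (_∈? B) (λ v → suc v ∈? (outside ∷ B)) (λ _ → Vec.there))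
  (count-mono (λ v → suc v ∈? (outside ∷ B)) (_∈? B) (λ { _ (Vec.there p) → p })))

module _ {n : ℕ} {P : Pred (Fin n) 0ℓ} (P? : Decidable P) where

  subsetOf : Subset n
  subsetOf = tabulate (does ∘ P?)

  ∈-subsetOf⁺ : ∀ {v} → P v → v ∈ subsetOf
  ∈-subsetOf⁺ {v} p = lookup⇒[]= v subsetOf (trans (lookup∘tabulate _ v) does-true)
    where
    does-true : does (P? v) ≡ true
    does-true with P? v
    ... | yes _ = refl
    ... | no ¬p = contradiction p ¬p

  ∈-subsetOf⁻ : ∀ {v} → v ∈ subsetOf → P v
  ∈-subsetOf⁻ {v} v∈ with P? v in eq
  ... | yes p = p
  ... | no  _ = case trans (sym ([]=⇒lookup v∈)) (trans (lookup∘tabulate _ v) (cong does eq)) of λ ()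

  ∣subsetOf∣ : ∣ subsetOf ∣ ≡ count P?
  ∣subsetOf∣ = trans ∣ subsetOf ∣≡count (ℕ.≤-antisym
    (count-mono (_∈? subsetOf) P? (λ _ → ∈-subsetOf⁻)) (count-mono P? (_∈? subsetOf) (λ _ → ∈-subsetOf⁺)))

-- Throttling values

-- Common to both variants, and free of the minimality in `t` that `Pt` demands. Throttling values
-- are minima over these pairs as well, because the weights increase strictly with `t`.
Achieves : Variant → ∀ {n} → Graph n → ℕ → ℕ → Set
Achieves γP G k t = ∃ λ B → ∣ B ∣ ≡ k × ObservesAll G B t
Achieves c  G k t = CopsWinIn G k t

module _ {n : ℕ} (G : Graph n) where

  observed? : ∀ B t → Decidable (Observed G B t)
  observed? B 0 v = v ∈? B
  observed? B 1 v = (v ∈? B) ⊎-dec any? λ u → (u ∈? B) ×-dec Graph._~?_ G u v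
  observed? B (suc (suc t)) v =
    observed? B (suc t) v ⊎-dec (¬? (observed? B (suc t) v) ×-dec any? λ u →
      observed? B (suc t) u ×-dec Graph._~?_ G u v ×-dec all? λ w →
        Graph._~?_ G u w →-dec (¬? (observed? B (suc t) w) →-dec (w ≟ v)))

  winIn? : ∀ {k} t (C : Fin k → Fin n) r → Dec (WinIn G t C r)
  winIn-resp : ∀ {k} t {C C′ : Fin k → Fin n} → C ≗ C′ → ∀ {r} → WinIn G t C r → WinIn G t C′ r

  captured-resp : ∀ {k} {C C′ : Fin k → Fin n} → C ≗ C′ → ∀ {r} → Captured G C r → Captured G C′ r
  captured-resp C≗C′ (i , e) = i , trans (sym (C≗C′ i)) e

  winIn-resp zero    C≗C′ cap = captured-resp C≗C′ cap
  winIn-resp (suc t) C≗C′ (inj₁ cap) = inj₁ (captured-resp C≗C′ cap)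
  winIn-resp (suc t) C≗C′ (inj₂ (D , move , win)) =
    inj₂ (D , (λ i → subst (λ u → StayOrMove G u (D i)) (C≗C′ i) (move i)) , win)

  captured? : ∀ {k} (C : Fin k → Fin n) r → Dec (Captured G C r)
  captured? C r = any? λ i → C i ≟ r

  winIn? zero    C r = captured? C r
  winIn? (suc t) C r = captured? C r ⊎-dec anyFunction? _
    (λ { f≗g (move , win) → (λ i → subst (StayOrMove G (C i)) (f≗g i) (move i))
       , Sum.map (captured-resp f≗g) (λ w r′ s → winIn-resp t f≗g (w r′ s)) win })
    (λ D → (all? λ i → stayOrMove? G (C i) (D i)) ×-dec
      (captured? D r ⊎-dec all? λ r′ → stayOrMove? G r r′ →-dec winIn? t D r′))

achieves? : ∀ Y {n} (G : Graph n) k t → Dec (Achieves Y G k t)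
achieves? γP G k t = anySubset? λ B → (∣ B ∣ ℕ.≟ k) ×-dec all? (observed? G B t)
achieves? c  G k t = anyFunction? k (λ f≗g win r → winIn-resp G t f≗g (win r)) (λ C → all? (winIn? G t C))

achieves⇒pt : ∀ Y {n} (G : Graph n) {k t} → Achieves Y G k t →
              (∀ s → Achieves Y G k s → t ≤ s) → Pt Y G k [ t ]
achieves⇒pt γP G (B , ∣B∣ , obs) minimal =
  (B , ∣B∣ , finite (obs , λ s obs′ → minimal s (B , ∣B∣ , obs′))) ,
  λ { _ (B′ , ∣B′∣ , finite {s} (obs′ , _)) → [ minimal s (B′ , ∣B′∣ , obs′) ]
    ; _ (B′ , ∣B′∣ , infinite _) → _ ≤⊤⁺ }
achieves⇒pt c  G win minimal = finite (win , minimal)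

pt⇒achieves : ∀ Y {n} (G : Graph n) {k t} → Pt Y G k [ t ] → Achieves Y G k t
pt⇒achieves γP G ((B , ∣B∣ , finite (obs , _)) , _) = B , ∣B∣ , obs
pt⇒achieves c  G (finite (win , _)) = win

-- `strict` makes the time of an optimal pair least for its `k`; `dominate` bounds the time by the
-- weight and thereby makes the search for the minimum finite.
record Weight : Set₁ where
  field
    weight   : ℕ → ℕ → ℕ
    Allowed  : ℕ → ℕ → Set
    allowed? : ∀ n k → Dec (Allowed n k)
    bounded  : ∀ {n k} → Allowed n k → k ≤ n
    strict   : ∀ {k s t} → 1 ≤ k → s < t → weight k s < weight k t
    dominate : ∀ {k t} → 1 ≤ k → t ≤ weight k t

open Weight

Throttling : Weight → Variant → Parameter
Throttling W Y {n} G m = IsMinimum _≤⁺_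
  (λ q → ∃₂ λ k p → 1 ≤ k × Allowed W n k × Pt Y G k p × q ≡ liftℕ∞ (weight W k) p) [ m ]

-- `Throttling` with these weights unfolds to `Th`, `Th*` and `Th×`, so one existence proof serves
-- all three.
additive initial multiplicative : Weight
additive = record
  { weight = _+_ ; Allowed = λ n k → k ≤ n ; allowed? = λ n k → k ℕ.≤? n ; bounded = id
  ; strict = λ {k} _ → ℕ.+-monoʳ-< k ; dominate = λ {k} _ → ℕ.m≤n+m _ k }
initial = record
  { weight = _*_ ; Allowed = λ n k → k < n ; allowed? = λ n k → suc k ℕ.≤? n ; bounded = ℕ.<⇒≤
  ; strict = λ { {suc k} _ → ℕ.*-monoʳ-< (suc k) } ; dominate = λ { {suc k} _ → ℕ.m≤n*m _ (suc k) } }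
multiplicative = record
  { weight = λ k t → k * (1 + t) ; Allowed = λ n k → k ≤ n ; allowed? = λ n k → k ℕ.≤? n ; bounded = id
  ; strict = λ { {suc k} _ s<t → ℕ.*-monoʳ-< (suc k) (s≤s s<t) }
  ; dominate = λ { {suc k} {t} _ → ℕ.≤-trans (ℕ.n≤1+n t) (ℕ.m≤n*m (suc t) (suc k)) } }

module _ (W : Weight) (Y : Variant) {n : ℕ} (G : Graph n) where

  Lower : ℕ → Set
  Lower m = ∀ k t → 1 ≤ k → Allowed W n k → Achieves Y G k t → m ≤ weight W k t

  throttling-value : ∀ k t → 1 ≤ k → Allowed W n k → Achieves Y G k t →
                     Lower (weight W k t) → Throttling W Y G (weight W k t)
  throttling-value k t 1≤k k-ok ach lower =
    (k , [ t ] , 1≤k , k-ok , achieves⇒pt Y G ach minimal , refl) , below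
    where
    minimal : ∀ s → Achieves Y G k s → t ≤ s
    minimal s ach′ = ℕ.≮⇒≥ λ s<t → ℕ.<⇒≱ (strict W 1≤k s<t) (lower k s 1≤k k-ok ach′)
    below : ∀ q → (∃₂ λ k p → 1 ≤ k × Allowed W n k × Pt Y G k p × q ≡ liftℕ∞ (weight W k) p) →
            [ weight W _ t ] ≤⁺ q
    below _ (j , [ s ] , 1≤j , j-ok , pt , refl) = [ lower j s 1≤j j-ok (pt⇒achieves Y G pt) ]
    below _ (j , ⊤⁺    , _   , _    , _  , refl) = _ ≤⊤⁺

  opaque
    throttling : ∀ k t → 1 ≤ k → Allowed W n k → Achieves Y G k t →
                 ∃ λ m → Throttling W Y G m × Lower m ×
                   ∃₂ λ k t → 1 ≤ k × Allowed W n k × Achieves Y G k t × m ≡ weight W k t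
    throttling k t 1≤k k-ok ach = from (least attained? (weight W k t) (attain 1≤k k-ok ach refl))
      where
      -- Both indices range over finite types to keep the predicate decidable. Restricting the time
      -- to at most `m` loses nothing, by `dominate`.
      Attained : ℕ → Set
      Attained m = ∃ λ (i : Fin (suc n)) → ∃ λ (j : Fin (suc m)) →
        1 ≤ toℕ i × Allowed W n (toℕ i) × Achieves Y G (toℕ i) (toℕ j) × m ≡ weight W (toℕ i) (toℕ j)
      attained? : ∀ m → Dec (Attained m)
      attained? m = any? λ i → any? λ j →
        (1 ℕ.≤? toℕ i) ×-dec allowed? W n (toℕ i) ×-dec achieves? Y G (toℕ i) (toℕ j) ×-dec (m ℕ.≟ weight W (toℕ i) (toℕ j))
      attain : ∀ {m k t} → 1 ≤ k → Allowed W n k → Achieves Y G k t → m ≡ weight W k t → Attained m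
      attain {m} {k} {t} 1≤k k-ok ach refl = fromℕ< k< , fromℕ< t< , attain′ (toℕ-fromℕ< k<) (toℕ-fromℕ< t<)
        where
        k< : k < suc n
        k< = s≤s (bounded W k-ok)
        t< : t < suc (weight W k t)
        t< = s≤s (dominate W {k} {t} 1≤k)
        attain′ : ∀ {i j} → i ≡ k → j ≡ t →
          1 ≤ i × Allowed W n i × Achieves Y G i j × weight W k t ≡ weight W i j
        attain′ refl refl = 1≤k , k-ok , ach , refl
      from : ∃ (IsMinimum _≤_ Attained) → ∃ λ m → Throttling W Y G m × Lower m ×
                   ∃₂ λ k t → 1 ≤ k × Allowed W n k × Achieves Y G k t × m ≡ weight W k t
      from (_ , (i , j , 1≤i , i-ok , ach , m≡) , minimal) = _ , throttling-value _ _ 1≤i i-ok ach lower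
        , lower , _ , _ , 1≤i , i-ok , ach , refl
        where
        lower : Lower (weight W (toℕ i) (toℕ j))
        lower k′ t′ 1≤k′ k′-ok ach′ = subst (_≤ weight W k′ t′) m≡ (minimal _ (attain 1≤k′ k′-ok ach′ refl))

-- Pairs attained at time 0 or 1, and lower bounds on the number of cops or observers

achieves-all : ∀ Y {n} (G : Graph n) → Achieves Y G n 0
achieves-all γP {n} G = ⊤ , ∣⊤∣≡n n , λ _ → ∈⊤
achieves-all c      G = id , λ r → r , refl

-- For power domination the dominating family may repeat vertices, so its range, of size `j`, is
-- taken as the initial set. Cops may share a vertex, and there `j` is `k`.
dom⇒achieves : ∀ Y {n} (G : Graph n) {k} → Fin n → Dom G k → ∃ λ j → 1 ≤ j × j ≤ k × Achieves Y G j 1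
dom⇒achieves γP {n} G {k} v₀ (D , dom) =
  ∣ B ∣ , 1≤∣B∣ , ∣B∣≤k , B , refl , λ v → observe v (dom v)
  where
  hit? : Decidable (λ v → ∃ λ i → D i ≡ v)
  hit? v = any? λ i → D i ≟ v
  B = subsetOf hit?
  1≤∣B∣ : 1 ≤ ∣ B ∣
  1≤∣B∣ = subst (1 ≤_) (sym (∣subsetOf∣ hit?))
    (injection⇒≤count hit? {1} (λ _ → D (proj₁ (dom v₀))) (λ { {zero} {zero} _ → refl }) (λ _ → _ , refl))
  ∣B∣≤k : ∣ B ∣ ≤ k
  ∣B∣≤k = subst (_≤ k) (sym (∣subsetOf∣ hit?)) (cover⇒count≤ hit? D λ _ h → h)
  observe : ∀ v → (∃ λ i → StayOrMove G (D i) v) → Observed G B 1 v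
  observe v (i , inj₁ e) = inj₁ (∈-subsetOf⁺ hit? (i , e))
  observe v (i , inj₂ e) = inj₂ (D i , ∈-subsetOf⁺ hit? (i , refl) , e)
dom⇒achieves c G {suc k} v₀ (D , dom) = suc k , s≤s z≤n , ℕ.≤-refl , D , λ r → win r (dom r)
  where
  win : ∀ r → (∃ λ i → StayOrMove G (D i) r) → WinIn G 1 D r
  win r (i , inj₁ e) = inj₁ (i , e)
  win r (i , inj₂ e) = inj₂ (D′ , move , inj₁ (i , D′i))
    where
    D′ : Fin _ → Fin _
    D′ j with j ≟ i
    ... | yes _ = r
    ... | no  _ = D j
    move : ∀ j → StayOrMove G (D j) (D′ j)
    move j with j ≟ i
    ... | yes refl = inj₂ e
    ... | no  _    = inj₁ refl
    D′i : D′ i ≡ r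
    D′i with i ≟ i
    ... | yes _  = refl
    ... | no i≢i = contradiction refl i≢i
dom⇒achieves c G {zero} v₀ (D , dom) with proj₁ (dom v₀)
... | ()

module _ {n : ℕ} (B : Subset n) where

  members : Enumeration (_∈ B) ∣ B ∣
  members = subst (Enumeration (_∈ B)) (sym ∣ B ∣≡count) (enumerate (_∈? B))

achieves₀ : ∀ Y {n} (G : Graph n) {k} → Achieves Y G k 0 → n ≤ k
achieves₀ γP G (B , refl , obs) = injective⇒≤ {f = λ v → index (obs v)} λ {u} {v} e →
  trans (sym (at-index (obs u))) (trans (cong at e) (at-index (obs v)))
  where open Enumeration (members B)
achieves₀ c  G (C , win) = injective⇒≤ {f = λ v → proj₁ (win v)} λ {u} {v} e →
  trans (sym (proj₂ (win u))) (trans (cong C e) (proj₂ (win v)))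

achieves₁ : ∀ Y {n} (G : Graph n) {k} → Achieves Y G k 1 → Dom G k
achieves₁ γP G (B , refl , obs) = at , λ v → near v (obs v)
  where
  open Enumeration (members B)
  near : ∀ v → Observed G B 1 v → ∃ λ i → StayOrMove G (at i) v
  near v (inj₁ v∈B) = index v∈B , inj₁ (at-index v∈B)
  near v (inj₂ (u , u∈B , e)) = index u∈B , inj₂ (subst (λ x → G ⊢ x ~ v) (sym (at-index u∈B)) e)
achieves₁ c G (C , win) = C , λ r → near r (win r)
  where
  near : ∀ r → WinIn G 1 C r → ∃ λ i → StayOrMove G (C i) r
  near r (inj₁ (i , e)) = i , inj₁ e
  near r (inj₂ (D , move , inj₁ (i , refl))) = i , move i
  -- The robber may stay on `r`, so some cop must stand there after the first cops' turn.
  near r (inj₂ (D , move , inj₂ win′)) with win′ r (inj₁ refl)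
  ... | i , refl = i , move i

-- Neither observation nor a cop passes from one fibre of f to another.

achieves-fibres : ∀ Y {n m} (G : Graph n) (f : Fin n → Fin m) (s : Fin m → Fin n) → (∀ i → f (s i) ≡ i) →
                  (∀ {u v} → G ⊢ u ~ v → f u ≡ f v) → ∀ {k t} → Achieves Y G k t → m ≤ k
achieves-fibres γP {n} {m} G f s fs≡ f~ {t = t} (B , refl , obs) = injective⇒≤ {f = pick} λ {i} {j} e →
  trans (sym (pick-fibre i)) (trans (cong (f ∘ at) e) (pick-fibre j))
  where
  open Enumeration (members B)
  source : ∀ t v → Observed G B t v → ∃ λ b → b ∈ B × f b ≡ f v
  source 0 v v∈B = v , v∈B , refl
  source 1 v (inj₁ v∈B) = v , v∈B , refl
  source 1 v (inj₂ (u , u∈B , e)) = u , u∈B , f~ e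
  source (suc (suc t)) v (inj₁ o) = source (suc t) v o
  source (suc (suc t)) v (inj₂ (_ , u , o , e , _)) =
    let b , b∈B , fb≡ = source (suc t) u o in b , b∈B , trans fb≡ (f~ e)
  src : ∀ i → ∃ λ b → b ∈ B × f b ≡ f (s i)
  src i = source t (s i) (obs (s i))
  pick : Fin m → Fin ∣ B ∣
  pick i = index (proj₁ (proj₂ (src i)))
  pick-fibre : ∀ i → f (at (pick i)) ≡ i
  pick-fibre i = trans (cong f (at-index (proj₁ (proj₂ (src i))))) (trans (proj₂ (proj₂ (src i))) (fs≡ i))
achieves-fibres c {n} {m} G f s fs≡ f~ {t = t} (C , win) =
  injective⇒≤ {f = λ i → proj₁ (cop i)} λ {i} {j} e →
    trans (sym (trans (proj₂ (cop i)) (fs≡ i))) (trans (cong (f ∘ C) e) (trans (proj₂ (cop j)) (fs≡ j)))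
  where
  f-move : ∀ {u v} → StayOrMove G u v → f u ≡ f v
  f-move (inj₁ refl) = refl
  f-move (inj₂ e)    = f~ e
  catcher : ∀ t {C : Fin _ → Fin n} {r} → WinIn G t C r → ∃ λ i → f (C i) ≡ f r
  catcher zero    (i , e) = i , cong f e
  catcher (suc t) (inj₁ (i , e)) = i , cong f e
  catcher (suc t) (inj₂ (D , move , inj₁ (i , e))) = i , trans (f-move (move i)) (cong f e)
  catcher (suc t) (inj₂ (D , move , inj₂ win′)) =
    let i , e = catcher t (win′ _ (inj₁ refl)) in i , trans (f-move (move i)) e
  cop : ∀ i → ∃ λ j → f (C j) ≡ f (s i)
  cop i = catcher t (win (s i))

-- The map that separates `v` from all other vertices is constant along edges and has two fibres.
achieves-isolated : ∀ Y {n} (G : Graph n) v u → v ≢ u → (∀ w → ¬ G ⊢ v ~ w) →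
                    ∀ {k t} → Achieves Y G k t → 2 ≤ k
achieves-isolated Y {n} G v u v≢u isolated = achieves-fibres Y G f s fs f~
  where
  f : Fin n → Fin 2
  f w with w ≟ v
  ... | yes _ = zero
  ... | no  _ = suc zero
  s : Fin 2 → Fin n
  s zero    = v
  s (suc _) = u
  fs : ∀ i → f (s i) ≡ i
  fs zero with v ≟ v
  ... | yes _  = refl
  ... | no v≢v = contradiction refl v≢v
  fs (suc zero) with u ≟ v
  ... | yes u≡v = contradiction (sym u≡v) v≢u
  ... | no  _   = refl
  f~ : ∀ {x y} → G ⊢ x ~ y → f x ≡ f y
  f~ {x} {y} e with x ≟ v | y ≟ v
  ... | yes _    | yes _    = refl
  ... | yes refl | no  _    = contradiction e (isolated y)
  ... | no  _    | yes refl = contradiction (~-sym G e) (isolated x)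
  ... | no  _    | no  _    = refl

-- Bounds in terms of the domination numbers

isolated-in-complement : ∀ {n} {G H : Graph n} → Complementary G H → Dom H 1 →
                         ∃ λ v → ∀ w → ¬ G ⊢ v ~ w
isolated-in-complement {G = G} {H} co (D , dom) = D zero , λ w e → case dom w of λ
  { (zero , inj₁ refl) → ~-irrefl G refl e
  ; (zero , inj₂ h)    → disjoint co e h }

∃-≢ : ∀ {n} → 2 ≤ n → (v : Fin n) → ∃ λ u → v ≢ u
∃-≢ (s≤s (s≤s _)) zero    = suc zero , λ ()
∃-≢ (s≤s (s≤s _)) (suc v) = zero , λ ()

module _ (Y : Variant) {n : ℕ} (G : Graph n) (5≤n : 5 ≤ n) where

  -- All lower bounds are read off from these four shapes. At time 0 every vertex is occupied, and
  -- `5 ≤ n` makes that too expensive to compete.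
  data Attained (k t : ℕ) : Set where
    all-vertices : 5 ≤ k → n ≤ k → Attained k t
    many         : 2 ≤ k → 1 ≤ t → Attained k t
    dominating   : k ≡ 1 → t ≡ 1 → Dom G 1 → Attained k t
    slow         : k ≡ 1 → 2 ≤ t → Attained k t

  attained : ∀ {k t} → 1 ≤ k → Achieves Y G k t → Attained k t
  attained {t = zero} 1≤k ach = all-vertices (ℕ.≤-trans 5≤n (achieves₀ Y G ach)) (achieves₀ Y G ach)
  attained {1} {1} 1≤k ach = dominating refl refl (achieves₁ Y G ach)
  attained {1} {suc (suc t)} 1≤k ach = slow refl (s≤s (s≤s z≤n))
  attained {suc (suc k)} {suc t} 1≤k ach = many (s≤s (s≤s z≤n)) (s≤s z≤n)

module _ (Y : Variant) {n : ℕ} {G H : Graph n} (co : Complementary G H) (5≤n : 5 ≤ n) where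

  -- The vertex dominating `H` is isolated in `G`, and `n` is large enough for a second vertex to
  -- exist.
  complement-slow : Dom H 1 → ∀ {k t} → Achieves Y G k t → 2 ≤ k
  complement-slow dom with isolated-in-complement co dom
  ... | v , isolated with ∃-≢ (ℕ.≤-trans (s≤s (s≤s z≤n)) 5≤n) v
  ... | u , v≢u = achieves-isolated Y G v u v≢u isolated

  additive-lower : ∀ {k t} → 1 ≤ k → Achieves Y G k t → 3 ≤ k + t ⊎ (k + t ≡ 2 × Dom G 1)
  additive-lower {k} {t} 1≤k ach with attained Y G 5≤n 1≤k ach
  ... | all-vertices 5≤k _    = inj₁ (ℕ.≤-trans (ℕ.m≤n+m 3 2) (ℕ.≤-trans 5≤k (ℕ.m≤m+n k t)))
  ... | many 2≤k 1≤t          = inj₁ (ℕ.+-mono-≤ 2≤k 1≤t)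
  ... | dominating refl refl d = inj₂ (refl , d)
  ... | slow refl 2≤t         = inj₁ (s≤s 2≤t)

  initial-lower : ∀ {k t} → 1 ≤ k → k < n → Achieves Y G k t → 2 ≤ k * t ⊎ (k * t ≡ 1 × Dom G 1)
  initial-lower {k} {t} 1≤k k<n ach with attained Y G 5≤n 1≤k ach
  ... | all-vertices _ n≤k    = contradiction k<n (ℕ.≤⇒≯ n≤k)
  ... | many 2≤k 1≤t          = inj₁ (ℕ.*-mono-≤ 2≤k 1≤t)
  ... | dominating refl refl d = inj₂ (refl , d)
  ... | slow refl 2≤t         = inj₁ (ℕ.≤-trans 2≤t (ℕ.m≤m+n t 0))

  multiplicative-lower : ∀ {k t} → 1 ≤ k → Achieves Y G k t → 3 ≤ k * (1 + t) ⊎ (k * (1 + t) ≡ 2 × Dom G 1)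
  multiplicative-lower {k} {t} 1≤k ach with attained Y G 5≤n 1≤k ach
  ... | all-vertices 5≤k _    = inj₁ (ℕ.≤-trans (ℕ.m≤n+m 3 2) (ℕ.≤-trans 5≤k (ℕ.m≤m*n k (suc t))))
  ... | many 2≤k 1≤t          = inj₁ (ℕ.≤-trans (ℕ.n≤1+n 3) (ℕ.*-mono-≤ 2≤k (s≤s 1≤t)))
  ... | dominating refl refl d = inj₂ (refl , d)
  ... | slow refl 2≤t         = inj₁ (s≤s (ℕ.≤-trans 2≤t (ℕ.m≤m+n t 0)))

  additive-lower′ : Dom H 1 → ∀ {k t} → 1 ≤ k → Achieves Y G k t → 3 ≤ k + t
  additive-lower′ dom {k} {t} 1≤k ach with attained Y G 5≤n 1≤k ach
  ... | all-vertices 5≤k _    = ℕ.≤-trans (ℕ.m≤n+m 3 2) (ℕ.≤-trans 5≤k (ℕ.m≤m+n k t))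
  ... | many 2≤k 1≤t          = ℕ.+-mono-≤ 2≤k 1≤t
  ... | dominating refl _ _   = contradiction (complement-slow dom ach) λ { (s≤s ()) }
  ... | slow refl _           = contradiction (complement-slow dom ach) λ { (s≤s ()) }

  initial-lower′ : Dom H 1 → ∀ {k t} → 1 ≤ k → k < n → Achieves Y G k t → 2 ≤ k * t
  initial-lower′ dom {k} {t} 1≤k k<n ach with initial-lower 1≤k k<n ach
  ... | inj₁ le = le
  ... | inj₂ (e , _) = contradiction (subst (2 ≤_) (ℕ.m*n≡1⇒m≡1 k t e) (complement-slow dom ach)) λ { (s≤s ()) }

  multiplicative-lower′ : Dom H 1 → ∀ {k t} → 1 ≤ k → Achieves Y G k t → 4 ≤ k * (1 + t)
  multiplicative-lower′ dom {k} {t} 1≤k ach with attained Y G 5≤n 1≤k ach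
  ... | all-vertices 5≤k _    = ℕ.≤-trans (ℕ.m≤n+m 4 1) (ℕ.≤-trans 5≤k (ℕ.m≤m*n k (suc t)))
  ... | many 2≤k 1≤t          = ℕ.*-mono-≤ 2≤k (s≤s 1≤t)
  ... | dominating refl _ _   = contradiction (complement-slow dom ach) λ { (s≤s ()) }
  ... | slow refl _           = contradiction (complement-slow dom ach) λ { (s≤s ()) }

module _ {a b : ℕ} where

  -- `P` and `Q` stand for domination by one vertex. The value 2 occurs only then, and it pushes the
  -- value of the complement up to 3.
  bounds-5-6 : {P Q : Set} → 3 ≤ a ⊎ (a ≡ 2 × P) → 3 ≤ b ⊎ (b ≡ 2 × Q) → (P → 3 ≤ b) → (Q → 3 ≤ a) →
               5 ≤ a + b × 6 ≤ a * b
  bounds-5-6 (inj₁ p) (inj₁ q) _ _ = ℕ.≤-trans (ℕ.m≤m+n 5 1) (ℕ.+-mono-≤ p q) , ℕ.≤-trans (ℕ.m≤m+n 6 3) (ℕ.*-mono-≤ p q)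
  bounds-5-6 (inj₂ (refl , p)) _ pb _ = ℕ.+-monoʳ-≤ 2 (pb p) , ℕ.*-monoʳ-≤ 2 (pb p)
  bounds-5-6 (inj₁ p) (inj₂ (refl , q)) _ _ = ℕ.+-monoˡ-≤ 2 p , ℕ.*-monoˡ-≤ 2 p

  bounds-3-2 : {P Q : Set} → 2 ≤ a ⊎ (a ≡ 1 × P) → 2 ≤ b ⊎ (b ≡ 1 × Q) → (P → 2 ≤ b) → (Q → 2 ≤ a) →
               3 ≤ a + b × 2 ≤ a * b
  bounds-3-2 (inj₁ p) (inj₁ q) _ _ = ℕ.≤-trans (ℕ.m≤m+n 3 1) (ℕ.+-mono-≤ p q) , ℕ.≤-trans (ℕ.m≤m+n 2 2) (ℕ.*-mono-≤ p q)
  bounds-3-2 (inj₂ (refl , p)) _ pb _ = ℕ.+-monoʳ-≤ 1 (pb p) , ℕ.*-monoʳ-≤ 1 (pb p)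
  bounds-3-2 (inj₁ p) (inj₂ (refl , q)) _ _ = ℕ.+-monoˡ-≤ 1 p , ℕ.*-monoˡ-≤ 1 p

  -- Either one value is 2 and the other at least 4, or both are at least 3. The first alternative
  -- decides the product, 8 against 9; the sums agree.
  bounds-6-8 : {P Q : Set} → 3 ≤ a ⊎ (a ≡ 2 × P) → 3 ≤ b ⊎ (b ≡ 2 × Q) → (P → 4 ≤ b) → (Q → 4 ≤ a) →
               6 ≤ a + b × 8 ≤ a * b
  bounds-6-8 (inj₁ p) (inj₁ q) _ _ = ℕ.+-mono-≤ p q , ℕ.≤-trans (ℕ.m≤m+n 8 1) (ℕ.*-mono-≤ p q)
  bounds-6-8 (inj₂ (refl , p)) _ pb _ = ℕ.+-monoʳ-≤ 2 (pb p) , ℕ.*-monoʳ-≤ 2 (pb p)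
  bounds-6-8 (inj₁ p) (inj₂ (refl , q)) _ qa = ℕ.+-monoˡ-≤ 2 (qa q) , ℕ.*-monoˡ-≤ 2 (qa q)

-- Since (g - 2)(h - 2) ≥ 0.
2[g+h]≤n+4 : ∀ {g h n} → 2 ≤ g → 2 ≤ h → g * h ≤ n → 2 * (g + h) ≤ n + 4
2[g+h]≤n+4 {suc (suc i)} {suc (suc j)} {n} (s≤s (s≤s _)) (s≤s (s≤s _)) gh≤n = begin
  2 * (2 + i + (2 + j))               ≤⟨ ℕ.m≤m+n _ (i * j) ⟩
  2 * (2 + i + (2 + j)) + i * j       ≡⟨ identity i j ⟩
  (2 + i) * (2 + j) + 4               ≤⟨ ℕ.+-monoˡ-≤ 4 gh≤n ⟩
  n + 4                               ∎
  where
  open ℕ.≤-Reasoning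
  identity : ∀ i j → 2 * (2 + i + (2 + j)) + i * j ≡ (2 + i) * (2 + j) + 4
  identity = solve-∀

module _ {g h n : ℕ} (5≤n : 5 ≤ n) (gh≤n : g * h ≤ n) (1≤g : 1 ≤ g) (1≤h : 1 ≤ h) where

  data Split : Set where
    left  : g ≡ 1 → Split
    right : h ≡ 1 → Split
    both  : 2 ≤ g → 2 ≤ h → Split

  split : Split
  split with g ℕ.≟ 1 | h ℕ.≟ 1
  ... | yes e | _     = left e
  ... | no  _ | yes e = right e
  ... | no g≢1 | no h≢1 = both (ℕ.≤∧≢⇒< 1≤g (g≢1 ∘ sym)) (ℕ.≤∧≢⇒< 1≤h (h≢1 ∘ sym))

  half : 2 ≤ g → 2 ≤ h → g + h ≤ ⌊ n /2⌋ + 2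
  half 2≤g 2≤h = subst (_≤ ⌊ n /2⌋ + 2) (⌊2*_/2⌋ (g + h))
    (subst (⌊ 2 * (g + h) /2⌋ ≤_) (⌊+4/2⌋ n) (ℕ.⌊n/2⌋-mono (2[g+h]≤n+4 2≤g 2≤h gh≤n)))
    where
    ⌊2*_/2⌋ : ∀ m → ⌊ 2 * m /2⌋ ≡ m
    ⌊2* m /2⌋ = trans (cong ⌊_/2⌋ (cong (m +_) (ℕ.+-identityʳ m))) (sym (ℕ.n≡⌊n+n/2⌋ m))
    ⌊+4/2⌋ : ∀ m → ⌊ m + 4 /2⌋ ≡ ⌊ m /2⌋ + 2
    ⌊+4/2⌋ m = trans (cong ⌊_/2⌋ (ℕ.+-comm m 4)) (ℕ.+-comm 2 ⌊ m /2⌋)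

  additive-upper-half : ∀ {a b} → a ≤ g + 1 → b ≤ h + 1 → 2 ≤ g → 2 ≤ h →
                        a + b ≤ ⌊ n /2⌋ + 4 × a * b ≤ n + ⌊ n /2⌋ + 3
  additive-upper-half {a} {b} a≤ b≤ 2≤g 2≤h = sum≤ , prod≤
    where
    open ℕ.≤-Reasoning
    sum≤ = begin
      a + b               ≤⟨ ℕ.+-mono-≤ a≤ b≤ ⟩
      (g + 1) + (h + 1)   ≡⟨ identity g h ⟩
      (g + h) + 2         ≤⟨ ℕ.+-monoˡ-≤ 2 (half 2≤g 2≤h) ⟩
      ⌊ n /2⌋ + 2 + 2     ≡⟨ ℕ.+-assoc ⌊ n /2⌋ 2 2 ⟩
      ⌊ n /2⌋ + 4         ∎
      where
      identity : ∀ g h → (g + 1) + (h + 1) ≡ (g + h) + 2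
      identity = solve-∀
    prod≤ = begin
      a * b                          ≤⟨ ℕ.*-mono-≤ a≤ b≤ ⟩
      (g + 1) * (h + 1)              ≡⟨ identity g h ⟩
      g * h + ((g + h) + 1)          ≤⟨ ℕ.+-mono-≤ gh≤n (ℕ.+-monoˡ-≤ 1 (half 2≤g 2≤h)) ⟩
      n + (⌊ n /2⌋ + 2 + 1)          ≡⟨ assoc n ⌊ n /2⌋ ⟩
      n + ⌊ n /2⌋ + 3                ∎
      where
      identity : ∀ g h → (g + 1) * (h + 1) ≡ g * h + ((g + h) + 1)
      identity = solve-∀
      assoc : ∀ n m → n + (m + 2 + 1) ≡ n + m + 3
      assoc = solve-∀

  2⌊n/2⌋≤n : ⌊ n /2⌋ + ⌊ n /2⌋ ≤ n
  2⌊n/2⌋≤n = begin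
    ⌊ n /2⌋ + ⌊ n /2⌋      ≤⟨ ℕ.+-monoʳ-≤ ⌊ n /2⌋ (ℕ.⌊n/2⌋≤⌈n/2⌉ n) ⟩
    ⌊ n /2⌋ + _            ≡⟨ ℕ.⌊n/2⌋+⌈n/2⌉≡n n ⟩
    n                      ∎
    where open ℕ.≤-Reasoning

  additive-upper : ∀ {a b} → a ≤ g + 1 → b ≤ h + 1 → a ≤ n → b ≤ n → a + b ≤ n + 2 × a * b ≤ 2 * n
  additive-upper {a} {b} a≤ b≤ a≤n b≤n with split
  ... | left refl = subst (a + b ≤_) (ℕ.+-comm 2 n) (ℕ.+-mono-≤ a≤ b≤n) , ℕ.*-mono-≤ a≤ b≤n
  ... | right refl = ℕ.+-mono-≤ a≤n b≤ , subst (a * b ≤_) (ℕ.*-comm n 2) (ℕ.*-mono-≤ a≤n b≤)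
  ... | both 2≤g 2≤h = sum≤ , prod≤
    where
    open ℕ.≤-Reasoning
    2≤⌊n/2⌋ : 2 ≤ ⌊ n /2⌋
    2≤⌊n/2⌋ = ℕ.⌊n/2⌋-mono 5≤n
    sum≤ = begin
      a + b                   ≤⟨ proj₁ (additive-upper-half a≤ b≤ 2≤g 2≤h) ⟩
      ⌊ n /2⌋ + 4             ≡⟨ ℕ.+-assoc ⌊ n /2⌋ 2 2 ⟨
      ⌊ n /2⌋ + 2 + 2         ≤⟨ ℕ.+-monoˡ-≤ 2 (ℕ.≤-trans (ℕ.+-monoʳ-≤ ⌊ n /2⌋ 2≤⌊n/2⌋) 2⌊n/2⌋≤n) ⟩
      n + 2                   ∎
    prod≤ : a * b ≤ 2 * n
    prod≤ with n ℕ.≤? 5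
    prod≤ | no n≰5 = begin
      a * b                      ≤⟨ proj₂ (additive-upper-half a≤ b≤ 2≤g 2≤h) ⟩
      n + ⌊ n /2⌋ + 3            ≤⟨ ℕ.+-monoʳ-≤ (n + ⌊ n /2⌋) (ℕ.⌊n/2⌋-mono (ℕ.≰⇒> n≰5)) ⟩
      n + ⌊ n /2⌋ + ⌊ n /2⌋      ≡⟨ ℕ.+-assoc n _ _ ⟩
      n + (⌊ n /2⌋ + ⌊ n /2⌋)    ≤⟨ ℕ.+-monoʳ-≤ n 2⌊n/2⌋≤n ⟩
      n + n                      ≡⟨ cong (n +_) (ℕ.+-identityʳ n) ⟨
      2 * n                      ∎
    -- The chain above needs `3 ≤ ⌊ n /2⌋`, which fails at 5. There `g * h ≤ 5` leaves only
    -- `g = h = 2`, so that the product is at most 9.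
    prod≤ | yes n≤5 with ℕ.≤-antisym n≤5 5≤n
    ... | refl with g ℕ.≤? 2 | h ℕ.≤? 2
    ...   | yes g≤2 | yes h≤2 = ℕ.≤-trans (ℕ.*-mono-≤ (ℕ.≤-trans a≤ (ℕ.+-monoˡ-≤ 1 g≤2)) (ℕ.≤-trans b≤ (ℕ.+-monoˡ-≤ 1 h≤2))) (ℕ.n≤1+n 9)
    ...   | no g≰2 | _ = contradiction (ℕ.≤-trans (ℕ.*-mono-≤ (ℕ.≰⇒> g≰2) 2≤h) gh≤n) λ { (s≤s (s≤s (s≤s (s≤s (s≤s ()))))) }
    ...   | _ | no h≰2 = contradiction (ℕ.≤-trans (ℕ.*-mono-≤ 2≤g (ℕ.≰⇒> h≰2)) gh≤n) λ { (s≤s (s≤s (s≤s (s≤s (s≤s ()))))) }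

  initial-upper : ∀ {a b} → a ≤ g → b ≤ h → g < n → h < n → a + b ≤ n × a * b ≤ n
  initial-upper {a} {b} a≤ b≤ g<n h<n = sum≤ , ℕ.≤-trans (ℕ.*-mono-≤ a≤ b≤) gh≤n
    where
    sum≤ : a + b ≤ n
    sum≤ with split
    ... | left refl  = ℕ.≤-trans (ℕ.+-mono-≤ a≤ b≤) h<n
    ... | right refl = ℕ.≤-trans (ℕ.+-mono-≤ a≤ b≤) (subst (_≤ n) (ℕ.+-comm 1 g) g<n)
    ... | both 2≤g 2≤h = begin
      a + b              ≤⟨ ℕ.+-mono-≤ a≤ b≤ ⟩
      g + h              ≤⟨ half 2≤g 2≤h ⟩
      ⌊ n /2⌋ + 2        ≤⟨ ℕ.+-monoʳ-≤ ⌊ n /2⌋ (ℕ.⌊n/2⌋-mono 5≤n) ⟩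
      ⌊ n /2⌋ + ⌊ n /2⌋  ≤⟨ 2⌊n/2⌋≤n ⟩
      n                  ∎
      where open ℕ.≤-Reasoning

  multiplicative-upper : ∀ {a b} → a ≤ g * 2 → b ≤ h * 2 → a ≤ n → b ≤ n → a + b ≤ n + 4 × a * b ≤ 4 * n
  multiplicative-upper {a} {b} a≤ b≤ a≤n b≤n = sum≤ , prod≤
    where
    open ℕ.≤-Reasoning
    sum≤ : a + b ≤ n + 4
    sum≤ with split
    ... | left refl  = subst (a + b ≤_) (ℕ.+-comm 4 n) (ℕ.+-mono-≤ (ℕ.≤-trans a≤ (ℕ.m≤m+n 2 2)) b≤n)
    ... | right refl = ℕ.+-mono-≤ a≤n (ℕ.≤-trans b≤ (ℕ.m≤m+n 2 2))
    ... | both 2≤g 2≤h = begin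
      a + b            ≤⟨ ℕ.+-mono-≤ a≤ b≤ ⟩
      g * 2 + h * 2    ≡⟨ identity g h ⟩
      2 * (g + h)      ≤⟨ 2[g+h]≤n+4 2≤g 2≤h gh≤n ⟩
      n + 4            ∎
      where
      identity : ∀ g h → g * 2 + h * 2 ≡ 2 * (g + h)
      identity = solve-∀
    prod≤ = begin
      a * b              ≤⟨ ℕ.*-mono-≤ a≤ b≤ ⟩
      g * 2 * (h * 2)    ≡⟨ identity g h ⟩
      4 * (g * h)        ≤⟨ ℕ.*-monoʳ-≤ 4 gh≤n ⟩
      4 * n              ∎
      where
      identity : ∀ g h → g * 2 * (h * 2) ≡ 4 * (g * h)
      identity = solve-∀

-- One end `v` of the edge is left out and dominated by the other end. This keeps γ below the order,
-- as the restriction `k < n` in `Th*` requires.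
hasEdge⇒dom : ∀ {n} (G : Graph (suc n)) → HasEdge G → Dom G n
hasEdge⇒dom G (u , v , e) = punchIn v , λ w → case v ≟ w of λ
  { (yes refl) → punchOut (≢-sym (~⇒≢ G e)) , inj₂ (subst (λ x → G ⊢ x ~ v) (sym (punchIn-punchOut (≢-sym (~⇒≢ G e)))) e)
  ; (no v≢w)   → punchOut v≢w , inj₁ (punchIn-punchOut v≢w) }

¬dom₀ : ∀ {n} (G : Graph n) → Fin n → ¬ Dom G 0
¬dom₀ G v (D , dom) with proj₁ (dom v)
... | ()

dominationNumber≥1 : ∀ {n} (G : Graph n) {g} → Fin n → IsMinimum _≤_ (Dom G) g → 1 ≤ g
dominationNumber≥1 G {zero}  v (dom , _) = contradiction dom (¬dom₀ G v)
dominationNumber≥1 G {suc g} v _         = s≤s z≤n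

module _ (Y : Variant) {n : ℕ} (G : Graph n) (v₀ : Fin n) {g : ℕ} (γ : IsMinimum _≤_ (Dom G) g) where

  private
    g≤n : g ≤ n
    g≤n = proj₂ γ n (dom-all G)

  -- Besides the value it keeps an optimal pair, from which lower bounds are derived, and minimality
  -- against all pairs, from which sharper upper bounds follow once cheaper pairs are known.
  record Value (W : Weight) (bound : ℕ → Set) : Set where
    constructor value
    field
      {m k t}  : ℕ
      is       : Throttling W Y G m
      lower    : Lower W Y G m
      1≤k      : 1 ≤ k
      k-ok     : Allowed W n k
      achieved : Achieves Y G k t
      m≡       : m ≡ weight W k t
      upper    : bound m

  additive-value : Value additive (λ m → m ≤ g + 1 × m ≤ n)
  additive-value with dom⇒achieves Y G v₀ (proj₁ γ)
  ... | j , 1≤j , j≤g , ach with throttling additive Y G j 1 1≤j (ℕ.≤-trans j≤g g≤n) ach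
  ... | m , is , lower , k , t , 1≤k , k-ok , achieved , m≡ = value is lower 1≤k k-ok achieved m≡
    ( ℕ.≤-trans (lower j 1 1≤j (ℕ.≤-trans j≤g g≤n) ach) (ℕ.+-monoˡ-≤ 1 j≤g)
    , subst (m ≤_) (ℕ.+-identityʳ n) (lower n 0 (ℕ.≤-trans 1≤j (ℕ.≤-trans j≤g g≤n)) ℕ.≤-refl (achieves-all Y G)))

  initial-value : g < n → Value initial (λ m → m ≤ g)
  initial-value g<n with dom⇒achieves Y G v₀ (proj₁ γ)
  ... | j , 1≤j , j≤g , ach with throttling initial Y G j 1 1≤j (ℕ.≤-<-trans j≤g g<n) ach
  ... | m , is , lower , k , t , 1≤k , k-ok , achieved , m≡ = value is lower 1≤k k-ok achieved m≡
    (ℕ.≤-trans (subst (m ≤_) (ℕ.*-identityʳ j) (lower j 1 1≤j (ℕ.≤-<-trans j≤g g<n) ach)) j≤g)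

  multiplicative-value : Value multiplicative (λ m → m ≤ g * 2 × m ≤ n)
  multiplicative-value with dom⇒achieves Y G v₀ (proj₁ γ)
  ... | j , 1≤j , j≤g , ach with throttling multiplicative Y G j 1 1≤j (ℕ.≤-trans j≤g g≤n) ach
  ... | m , is , lower , k , t , 1≤k , k-ok , achieved , m≡ = value is lower 1≤k k-ok achieved m≡
    ( ℕ.≤-trans (lower j 1 1≤j (ℕ.≤-trans j≤g g≤n) ach) (ℕ.*-monoˡ-≤ 2 j≤g)
    , subst (m ≤_) (ℕ.*-identityʳ n) (lower n 0 (ℕ.≤-trans 1≤j (ℕ.≤-trans j≤g g≤n)) ℕ.≤-refl (achieves-all Y G)))

-- Stated for an arbitrary complementary pair, so that G and its complement may
-- be interchanged.
Both : Parameter → ∀ {n} → Graph n → Graph n → (ℕ → ℕ → Set) → Set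
Both Θ G H R = ∃₂ λ a b → Θ G a × Θ H b × R a b

module _ (Y : Variant) {n : ℕ} {G H : Graph n} (co : Complementary G H) (5≤n : 5 ≤ n) (v₀ : Fin n)
         {g h : ℕ} (γG : IsMinimum _≤_ (Dom G) g) (γH : IsMinimum _≤_ (Dom H) h) where

  private
    oc : Complementary H G
    oc = complementary-sym co
    gh≤n : g * h ≤ n
    gh≤n = jaeger-payan co γG γH
    1≤g : 1 ≤ g
    1≤g = dominationNumber≥1 G v₀ γG
    1≤h : 1 ≤ h
    1≤h = dominationNumber≥1 H v₀ γH
    <n : ∀ {n} (F : Graph n) {k} → Fin n → IsMinimum _≤_ (Dom F) k → HasEdge F → k < n
    <n {suc n} F _ γ e = s≤s (proj₂ γ n (hasEdge⇒dom F e))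

  additive-bounds : Both (Th Y) G H (λ a b → (5 ≤ a + b × a + b ≤ n + 2) × (6 ≤ a * b × a * b ≤ 2 * n))
  additive-bounds with additive-value Y G v₀ γG | additive-value Y H v₀ γH
  ... | value {a} isA lowA kA _ achA refl (uA , nA) | value {b} isB lowB kB _ achB refl (uB , nB) =
    a , b , isA , isB , (proj₁ lo , proj₁ up) , (proj₂ lo , proj₂ up)
    where
    lo = bounds-5-6 (additive-lower Y co 5≤n kA achA) (additive-lower Y oc 5≤n kB achB)
      (λ d → additive-lower′ Y oc 5≤n d kB achB) (λ d → additive-lower′ Y co 5≤n d kA achA)
    up = additive-upper 5≤n gh≤n 1≤g 1≤h uA uB nA nB

  additive-bounds-half : ¬ HasIsolatedVertex G → ¬ HasIsolatedVertex H →
    Both (Th Y) G H (λ a b → a + b ≤ ⌊ n /2⌋ + 4 × a * b ≤ n + ⌊ n /2⌋ + 3)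
  additive-bounds-half noG noH with additive-value Y G v₀ γG | additive-value Y H v₀ γH
  ... | value {a} isA _ _ _ _ _ (uA , _) | value {b} isB _ _ _ _ _ (uB , _) =
    a , b , isA , isB , additive-upper-half 5≤n gh≤n 1≤g 1≤h uA uB
      (≥2 G 1≤g (proj₁ γG) λ d → noH (isolated-in-complement oc d))
      (≥2 H 1≤h (proj₁ γH) λ d → noG (isolated-in-complement co d))
    where
    ≥2 : ∀ (F : Graph n) {k} → 1 ≤ k → Dom F k → ¬ Dom F 1 → 2 ≤ k
    ≥2 F {1} _ d ¬d = contradiction d ¬d
    ≥2 F {suc (suc k)} _ _ _ = s≤s (s≤s z≤n)

  initial-bounds : HasEdge G → HasEdge H →
    Both (Th* Y) G H (λ a b → (3 ≤ a + b × a + b ≤ n) × (2 ≤ a * b × a * b ≤ n))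
  initial-bounds eG eH with initial-value Y G v₀ γG (<n G v₀ γG eG) | initial-value Y H v₀ γH (<n H v₀ γH eH)
  ... | value {a} isA lowA kA okA achA refl uA | value {b} isB lowB kB okB achB refl uB =
    a , b , isA , isB , (proj₁ lo , proj₁ up) , (proj₂ lo , proj₂ up)
    where
    lo = bounds-3-2 (initial-lower Y co 5≤n kA okA achA) (initial-lower Y oc 5≤n kB okB achB)
      (λ d → initial-lower′ Y oc 5≤n d kB okB achB) (λ d → initial-lower′ Y co 5≤n d kA okA achA)
    up = initial-upper 5≤n gh≤n 1≤g 1≤h uA uB (<n G v₀ γG eG) (<n H v₀ γH eH)

  multiplicative-bounds : Both (Th× Y) G H (λ a b → (6 ≤ a + b × a + b ≤ n + 4) × (8 ≤ a * b × a * b ≤ 4 * n))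
  multiplicative-bounds with multiplicative-value Y G v₀ γG | multiplicative-value Y H v₀ γH
  ... | value {a} isA lowA kA _ achA refl (uA , nA) | value {b} isB lowB kB _ achB refl (uB , nB) =
    a , b , isA , isB , (proj₁ lo , proj₁ up) , (proj₂ lo , proj₂ up)
    where
    lo = bounds-6-8 (multiplicative-lower Y co 5≤n kA achA) (multiplicative-lower Y oc 5≤n kB achB)
      (λ d → multiplicative-lower′ Y oc 5≤n d kB achB) (λ d → multiplicative-lower′ Y co 5≤n d kA achA)
    up = multiplicative-upper 5≤n gh≤n 1≤g 1≤h uA uB nA nB

-- Extremal graphs

-- The caller need not know whether `w` is already observed, and checks only the neighbours of `v`
-- other than `w`. Decidability of observation restores the exact form of `Force`.
two-steps : ∀ {n} (G : Graph n) (B : Subset n) →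
  (∀ w → Observed G B 1 w ⊎ ∃ λ v → Observed G B 1 v × G ⊢ v ~ w × (∀ u → G ⊢ v ~ u → u ≢ w → Observed G B 1 u)) →
  ObservesAll G B 2
two-steps G B seen w with observed? G B 1 w | seen w
... | yes o | _ = inj₁ o
... | no ¬o | inj₁ o = inj₁ o
... | no ¬o | inj₂ (v , ov , e , only) = inj₂ (¬o , v , ov , e , λ u e′ ¬ou →
  decidable-stable (u ≟ w) λ u≢w → ¬ou (only u e′ u≢w))

-- If v has the single H-neighbour u, then v observes all vertices but u in G.
leaf⇒achieves : ∀ {n} {G H : Graph n} → Complementary G H → ¬ Dom H 1 → ∀ {v u} → H ⊢ v ~ u →
                (∀ w → H ⊢ v ~ w → w ≡ u) → Achieves γP G 1 2
leaf⇒achieves {n} {G} {H} co ¬dom {v} {u} e only = ⁅ v ⁆ , ∣⁅x⁆∣≡1 v , two-steps G ⁅ v ⁆ seen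
  where
  step₁ : ∀ w → w ≢ u → Observed G ⁅ v ⁆ 1 w
  step₁ w w≢u with v ≟ w
  ... | yes refl = inj₁ (x∈⁅x⁆ v)
  ... | no  v≢w  = inj₂ (v , x∈⁅x⁆ v , covering (complementary-sym co) v≢w λ h → w≢u (only w h))
  seen : ∀ w → _
  seen w with w ≟ u
  ... | no  w≢u  = inj₁ (step₁ w w≢u)
  -- Any `G`-neighbour `x` of `u` forces it, since no other vertex is unobserved. Such an `x` exists
  -- because `u` alone does not dominate `H`.
  ... | yes refl with common-neighbour co ¬dom (const w)
  ...   | x , w~x = inj₂ (x , step₁ x (≢-sym (~⇒≢ G (w~x zero))) , ~-sym G (w~x zero) , λ y _ → step₁ y)

-- The disjoint union of cliques on the fibres of `f`; its complement is complete multipartite.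
cluster : ∀ {n m} → (Fin n → Fin m) → Graph n
cluster f = record
  { _~_      = λ u v → u ≢ v × f u ≡ f v
  ; _~?_     = λ u v → ¬? (u ≟ v) ×-dec (f u ≟ f v)
  ; ~-sym    = λ (u≢v , e) → ≢-sym u≢v , sym e
  ; ~-irrefl = λ u≡v (u≢v , _) → u≢v u≡v
  }

module Cluster (Y : Variant) {n m : ℕ} (f : Fin n → Fin m) (s : Fin m → Fin n) (fs : ∀ i → f (s i) ≡ i)
               (1≤m : 1 ≤ m) where

  fibres≤ : ∀ {k t} → Achieves Y (cluster f) k t → m ≤ k
  fibres≤ = achieves-fibres Y (cluster f) f s fs proj₂

  achieves-1 : Achieves Y (cluster f) m 1
  achieves-1 with dom⇒achieves Y (cluster f) (s (fromℕ< 1≤m)) (s , λ v → f v , near v)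
    where
    near : ∀ v → StayOrMove (cluster f) (s (f v)) v
    near v with s (f v) ≟ v
    ... | yes e = inj₁ e
    ... | no ≢v = inj₂ (≢v , fs (f v))
  ... | j , _ , j≤m , ach = subst (λ k → Achieves Y (cluster f) k 1) (ℕ.≤-antisym j≤m (fibres≤ ach)) ach

  th : m < n → Th Y (cluster f) (m + 1)
  th m<n = throttling-value additive Y (cluster f) m 1 1≤m (ℕ.<⇒≤ m<n) achieves-1 lower
    where
    lower : Lower additive Y (cluster f) (m + 1)
    lower k zero    _ _ ach = ℕ.≤-trans (subst (_≤ n) (ℕ.+-comm 1 m) m<n) (ℕ.≤-trans (achieves₀ Y (cluster f) ach) (ℕ.m≤m+n k 0))
    lower k (suc t) _ _ ach = ℕ.+-mono-≤ (fibres≤ ach) (s≤s z≤n)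

  th* : m < n → Th* Y (cluster f) m
  th* m<n = subst (Th* Y (cluster f)) (ℕ.*-identityʳ m)
    (throttling-value initial Y (cluster f) m 1 1≤m m<n achieves-1 lower)
    where
    lower : Lower initial Y (cluster f) (m * 1)
    lower k zero    _ k<n ach = contradiction k<n (ℕ.≤⇒≯ (achieves₀ Y (cluster f) ach))
    lower k (suc t) _ _   ach = ℕ.*-mono-≤ (fibres≤ ach) (s≤s z≤n)

  -- The only competitor of one vertex per clique is time 0, of weight at least `n`; hence the
  -- hypothesis.
  th× : m * 2 ≤ n → Th× Y (cluster f) (m * 2)
  th× 2m≤n = throttling-value multiplicative Y (cluster f) m 1 1≤m (ℕ.≤-trans (ℕ.m≤m*n m 2) 2m≤n) achieves-1 lower
    where
    lower : Lower multiplicative Y (cluster f) (m * 2)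
    lower k zero    _ _ ach = ℕ.≤-trans 2m≤n (ℕ.≤-trans (achieves₀ Y (cluster f) ach) (ℕ.m≤m*n k 1))
    lower k (suc t) _ _ ach = ℕ.*-mono-≤ (fibres≤ ach) (s≤s (s≤s z≤n))

-- `cluster id` is the edgeless graph: all `n` fibres are needed at any time, and then time 0
-- suffices.
th-empty : ∀ Y {n} → 1 ≤ n → Th Y (cluster {n} id) n
th-empty Y {n} 1≤n = subst (Th Y (cluster id)) (ℕ.+-identityʳ n)
  (throttling-value additive Y (cluster id) n 0 1≤n ℕ.≤-refl (achieves-all Y (cluster id))
    λ k t _ _ ach → ℕ.+-mono-≤ (Cluster.fibres≤ Y id id (λ _ → refl) 1≤n {k} {t} ach) z≤n)

module Dominated (Y : Variant) {n : ℕ} (G : Graph n) (5≤n : 5 ≤ n) (dom : Dom G 1) where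

  achieves-1 : Achieves Y G 1 1
  achieves-1 with dom⇒achieves Y G (proj₁ dom zero) dom
  ... | j , 1≤j , j≤1 , ach = subst (λ k → Achieves Y G k 1) (ℕ.≤-antisym j≤1 1≤j) ach

  th : Th Y G 2
  th = throttling-value additive Y G 1 1 ℕ.≤-refl (ℕ.≤-trans (s≤s z≤n) 5≤n) achieves-1 lower
    where
    lower : Lower additive Y G 2
    lower k t 1≤k _ ach with additive-lower Y (∁-complementary G) 5≤n 1≤k ach
    ... | inj₁ le      = ℕ.≤-trans (s≤s (s≤s z≤n)) le
    ... | inj₂ (e , _) = ℕ.≤-reflexive (sym e)

  th* : Th* Y G 1
  th* = throttling-value initial Y G 1 1 ℕ.≤-refl (ℕ.≤-trans (s≤s (s≤s z≤n)) 5≤n) achieves-1 lower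
    where
    lower : Lower initial Y G 1
    lower k t 1≤k k<n ach with initial-lower Y (∁-complementary G) 5≤n 1≤k k<n ach
    ... | inj₁ le      = ℕ.≤-trans (s≤s z≤n) le
    ... | inj₂ (e , _) = ℕ.≤-reflexive (sym e)

  th× : Th× Y G 2
  th× = throttling-value multiplicative Y G 1 1 ℕ.≤-refl (ℕ.≤-trans (s≤s z≤n) 5≤n) achieves-1 lower
    where
    lower : Lower multiplicative Y G 2
    lower k t 1≤k _ ach with multiplicative-lower Y (∁-complementary G) 5≤n 1≤k ach
    ... | inj₁ le      = ℕ.≤-trans (s≤s (s≤s z≤n)) le
    ... | inj₂ (e , _) = ℕ.≤-reflexive (sym e)

singleton-fibre⇒dom : ∀ {n m} (f : Fin n → Fin m) z → (∀ v → f z ≡ f v → z ≡ v) → Dom (∁ (cluster f)) 1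
singleton-fibre⇒dom f z only = const z , λ v → zero , near v
  where
  near : ∀ v → StayOrMove (∁ (cluster f)) z v
  near v with z ≟ v
  ... | yes e  = inj₁ e
  ... | no z≢v = inj₂ (z≢v , λ (_ , e) → z≢v (only v e))

-- `σ` provides a second vertex in every part of the complete multipartite graph: it rules out a
-- dominating vertex and is where the robber flees.
module Multipartite {n m : ℕ} (f : Fin n → Fin m) (σ : Fin n → Fin n) (σ≢ : ∀ v → σ v ≢ v)
                    (fσ : ∀ v → f (σ v) ≡ f v) (5≤n : 5 ≤ n) where

  private
    G : Graph n
    G = ∁ (cluster f)

  ¬dom : ¬ Dom G 1
  ¬dom (D , dom) with dom (σ (D zero))
  ... | zero , inj₁ e = σ≢ (D zero) (sym e)
  ... | zero , inj₂ (_ , ¬e) = ¬e (≢-sym (σ≢ (D zero)) , sym (fσ (D zero)))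

  -- The robber answers every move of the cop by going to its fibre.
  lone-cop-loses : ∀ t {C : Fin 1 → Fin n} {r} → f r ≡ f (C zero) → C zero ≢ r → ¬ WinIn G t C r
  lone-cop-loses zero    fr C≢r (zero , C≡r) = C≢r C≡r
  lone-cop-loses (suc t) fr C≢r (inj₁ (zero , C≡r)) = C≢r C≡r
  lone-cop-loses (suc t) fr C≢r (inj₂ (D , move , next)) with move zero
  lone-cop-loses (suc t) fr C≢r (inj₂ (D , move , inj₁ (zero , refl))) | inj₁ C≡D = C≢r C≡D
  lone-cop-loses (suc t) fr C≢r (inj₂ (D , move , inj₂ win)) | inj₁ C≡D =
    lone-cop-loses t (trans fr (cong f C≡D)) (λ D≡r → C≢r (trans C≡D D≡r)) (win _ (inj₁ refl))
  lone-cop-loses (suc t) fr C≢r (inj₂ (D , move , inj₁ (zero , refl))) | inj₂ (C≢D , ¬e) = ¬e (C≢D , sym fr)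
  lone-cop-loses (suc t) {C} {r} fr C≢r (inj₂ (D , move , inj₂ win)) | inj₂ (C≢D , ¬e) =
    lone-cop-loses t (fσ (D zero)) (≢-sym (σ≢ (D zero))) (win (σ (D zero)) (inj₂ (flee , λ (_ , e) → ¬e (C≢D , trans (sym fr) (trans e (fσ (D zero)))))))
    where
    flee : r ≢ σ (D zero)
    flee refl = ¬e (C≢D , trans (sym fr) (fσ (D zero)))

  ¬copsWin₁ : ∀ t → ¬ CopsWinIn G 1 t
  ¬copsWin₁ t (C , win) = lone-cop-loses t (fσ (C zero)) (≢-sym (σ≢ (C zero))) (win (σ (C zero)))

  module _ (z y : Fin n) (fz≢fy : f z ≢ f y) where

    private
      dom₂ : Dom G 2
      dom₂ = zy , λ v → near v (f z ≟ f v)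
        where
        zy : Fin 2 → Fin n
        zy zero    = z
        zy (suc _) = y
        near : ∀ v → Dec (f z ≡ f v) → ∃ λ i → StayOrMove G (zy i) v
        near v (yes e) = suc zero , inj₂ ((λ { refl → fz≢fy e }) , λ (_ , e′) → fz≢fy (trans e (sym e′)))
        near v (no ¬e) = zero , inj₂ ((λ { refl → ¬e refl }) , λ (_ , e) → ¬e e)

    achieves-2 : ∀ Y → Achieves Y G 2 1
    achieves-2 Y with dom⇒achieves Y G z dom₂
    ... | suc zero , _ , _ , ach = contradiction (achieves₁ Y G ach) ¬dom
    ... | suc (suc zero) , _ , _ , ach = ach
    ... | suc (suc (suc _)) , _ , s≤s (s≤s ()) , _

    th* : ∀ Y → Th* Y G 2
    th* Y = throttling-value initial Y G 2 1 (s≤s z≤n) (ℕ.≤-trans (ℕ.m≤m+n 3 2) 5≤n) (achieves-2 Y) lower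
      where
      lower : Lower initial Y G 2
      lower k t 1≤k k<n ach with initial-lower Y (∁-complementary G) 5≤n 1≤k k<n ach
      ... | inj₁ le      = le
      ... | inj₂ (_ , d) = contradiction d ¬dom

    th×-cops : Th× c G 4
    th×-cops = throttling-value multiplicative c G 2 1 (s≤s z≤n) (ℕ.≤-trans (ℕ.m≤m+n 2 3) 5≤n) (achieves-2 c) lower
      where
      lower : Lower multiplicative c G 4
      lower k t 1≤k _ ach with attained c G 5≤n 1≤k ach
      ... | all-vertices 5≤k _  = ℕ.≤-trans (ℕ.m≤n+m 4 1) (ℕ.≤-trans 5≤k (ℕ.m≤m*n k (suc t)))
      ... | many 2≤k 1≤t        = ℕ.*-mono-≤ 2≤k (s≤s 1≤t)
      ... | dominating _ _ d    = contradiction d ¬dom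
      ... | slow refl _         = contradiction ach (¬copsWin₁ t)

    -- A part of size two makes `z` a leaf of the cluster graph, so `z` alone observes everything in
    -- two steps, at weight 1 · (1 + 2). Cops have no such option, as one cop never wins here.
    th×-power : (∀ v → f z ≡ f v → z ≢ v → v ≡ σ z) → Th× γP G 3
    th×-power only = throttling-value multiplicative γP G 1 2 (s≤s z≤n) (ℕ.≤-trans (s≤s z≤n) 5≤n)
      (leaf⇒achieves (complementary-sym (∁-complementary (cluster f))) ¬dom-cluster
        {z} {σ z} (≢-sym (σ≢ z) , sym (fσ z)) λ w (z≢w , e) → only w e z≢w) lower
      where
      ¬dom-cluster : ¬ Dom (cluster f) 1
      ¬dom-cluster (D , dom) = fz≢fy (trans (fib z) (sym (fib y)))
        where
        fib : ∀ v → f v ≡ f (D zero)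
        fib v with dom v
        ... | zero , inj₁ e       = cong f (sym e)
        ... | zero , inj₂ (_ , e) = sym e
      lower : Lower multiplicative γP G 3
      lower k t 1≤k _ ach with multiplicative-lower γP (∁-complementary G) 5≤n 1≤k ach
      ... | inj₁ le      = le
      ... | inj₂ (_ , d) = contradiction d ¬dom

-- An isolated vertex beside a clique, with a star as complement. This family attains every lower
-- bound.
module TwoFibres (Y : Variant) (N : ℕ) where

  n : ℕ
  n = N + 5
  5≤n : 5 ≤ n
  5≤n = ℕ.m≤n+m 5 N
  f : ∀ {n} → Fin n → Fin 2
  f zero    = zero
  f (suc _) = suc zero
  s : ∀ {n} → 2 ≤ n → Fin 2 → Fin n
  s (s≤s (s≤s _)) zero    = zero
  s (s≤s (s≤s _)) (suc _) = suc zero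
  fs : ∀ {n} (2≤n : 2 ≤ n) i → f (s 2≤n i) ≡ i
  fs (s≤s (s≤s _)) zero       = refl
  fs (s≤s (s≤s _)) (suc zero) = refl
  G : Graph n
  G = cluster f
  dom : ∀ {n} → 1 ≤ n → Dom (∁ (cluster (f {n}))) 1
  dom (s≤s _) = singleton-fibre⇒dom f zero λ { zero _ → refl }
  open Cluster Y {n} f (s (ℕ.≤-trans (s≤s (s≤s z≤n)) 5≤n)) (fs (ℕ.≤-trans (s≤s (s≤s z≤n)) 5≤n)) (s≤s z≤n) public
  module Co = Dominated Y (∁ G) 5≤n (dom (ℕ.≤-trans (s≤s z≤n) 5≤n))
  2<n : 2 < n
  2<n = ℕ.≤-trans (ℕ.m≤m+n 3 2) 5≤n
  edges : BothHaveEdges G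
  edges = go 5≤n
    where
    go : ∀ {n} → 5 ≤ n → BothHaveEdges (cluster (f {n}))
    go (s≤s (s≤s (s≤s _))) = (suc zero , suc (suc zero) , (λ ()) , refl) , (zero , suc zero , (λ ()) , λ { (_ , ()) })

-- The edgeless graph and the complete graph, extremal for the upper bounds on `Th`.
module Singletons (Y : Variant) (N : ℕ) where

  n : ℕ
  n = N + 5
  5≤n : 5 ≤ n
  5≤n = ℕ.m≤n+m 5 N
  1≤n : 1 ≤ n
  1≤n = ℕ.≤-trans (s≤s z≤n) 5≤n
  G : Graph n
  G = cluster id
  dom : Dom (∁ G) 1
  dom = singleton-fibre⇒dom id (fromℕ< 1≤n) λ _ → id
  module Co = Dominated Y (∁ G) 5≤n dom

-- A single edge and isolated vertices otherwise: the domination number is n - 1, the largest that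
-- an edge allows.
module OnePair (Y : Variant) (N : ℕ) where

  n : ℕ
  n = 5 + N
  5≤n : 5 ≤ n
  5≤n = ℕ.m≤m+n 5 N
  f : Fin n → Fin (4 + N)
  f zero    = zero
  f (suc i) = i
  G : Graph n
  G = cluster f
  open Cluster Y f suc (λ _ → refl) (s≤s z≤n) public
  dom : Dom (∁ G) 1
  dom = singleton-fibre⇒dom f (suc (suc zero)) λ { zero () ; (suc i) e → cong suc e }
  module Co = Dominated Y (∁ G) 5≤n dom
  edges : BothHaveEdges G
  edges = (zero , suc zero , (λ ()) , refl) , (zero , suc (suc zero) , (λ ()) , λ { (_ , ()) })

-- A perfect matching, whose complement is the cocktail party graph. Here γ(G) γ(∁ G) = (n / 2) · 2
-- = n, so the Jaeger-Payan inequality is tight.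
module Pairs (N : ℕ) where

  m : ℕ
  m = 3 + N
  n : ℕ
  n = m * 2
  5≤n : 5 ≤ n
  5≤n = s≤s (s≤s (s≤s (s≤s (s≤s z≤n))))
  f : Fin n → Fin m
  f = quotient {m} 2
  σ : Fin n → Fin n
  σ v = combine (quotient {m} 2 v) (opposite (remainder {m} 2 v))
  f-combine : ∀ i (j : Fin 2) → f (combine i j) ≡ i
  f-combine i j = cong proj₁ (remQuot-combine i j)
  opposite≢ : ∀ (j : Fin 2) → opposite j ≢ j
  opposite≢ zero ()
  opposite≢ (suc zero) ()
  σ≢ : ∀ v → σ v ≢ v
  σ≢ v e = opposite≢ (remainder {m} 2 v) (trans (sym (cong proj₂ (remQuot-combine (f v) (opposite (remainder {m} 2 v))))) (cong (remainder {m} 2) e))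
  fσ : ∀ v → f (σ v) ≡ f v
  fσ v = f-combine (f v) _
  G : Graph n
  G = cluster f
  z y : Fin n
  z = zero
  y = suc (suc zero)
  fz≢fy : f z ≢ f y
  fz≢fy ()
  only : ∀ v → f z ≡ f v → z ≢ v → v ≡ σ z
  only v e z≢v = trans (sym (combine-remQuot {m} 2 v)) (cong₂ combine (sym e) (other (remainder {m} 2 v) λ r → z≢v (trans (cong₂ combine e (sym r)) (combine-remQuot {m} 2 v))))
    where
    other : ∀ j → j ≢ zero → j ≡ suc zero
    other zero 0≢0 = contradiction refl 0≢0
    other (suc zero) _ = refl
  m<n : m < n
  m<n = s≤s (s≤s (s≤s (s≤s (ℕ.≤-trans (ℕ.m≤m*n N 2) (ℕ.m≤n+m (N * 2) 2)))))
  N≤n : N ≤ n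
  N≤n = ℕ.≤-trans (ℕ.m≤m*n N 2) (ℕ.m≤n+m (N * 2) 6)
  edges : BothHaveEdges G
  edges = (zero , suc zero , (λ ()) , refl) , (z , y , (λ ()) , λ (_ , e) → fz≢fy e)
  module Co = Multipartite f σ σ≢ fσ 5≤n
  s : Fin m → Fin n
  s i = combine {m} {2} i zero
  fs : ∀ i → f (s i) ≡ i
  fs i = cong proj₁ (remQuot-combine {m} {2} i zero)
  module Base (Y : Variant) = Cluster Y f s fs (s≤s z≤n)

-- Sharpness, from the four families of clique unions

th-sharp : ∀ Y → InfinitelyOften NoCondition (Th Y) (λ n a b → a + b ≡ 5)
               × InfinitelyOften NoCondition (Th Y) (λ n a b → a + b ≡ n + 2)
               × InfinitelyOften NoCondition (Th Y) (λ n a b → a * b ≡ 6)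
               × InfinitelyOften NoCondition (Th Y) (λ n a b → a * b ≡ 2 * n)
th-sharp Y =
    (λ N → let open TwoFibres Y N in n , ℕ.m≤m+n N 5 , 5≤n , G , _ , 3 , 2 , th 2<n , Co.th , refl)
  , (λ N → let open Singletons Y N in n , ℕ.m≤m+n N 5 , 5≤n , G , _ , n , 2 , th-empty Y 1≤n , Co.th , refl)
  , (λ N → let open TwoFibres Y N in n , ℕ.m≤m+n N 5 , 5≤n , G , _ , 3 , 2 , th 2<n , Co.th , refl)
  , (λ N → let open Singletons Y N in n , ℕ.m≤m+n N 5 , 5≤n , G , _ , n , 2 , th-empty Y 1≤n , Co.th , ℕ.*-comm n 2)

th*-sharp : ∀ Y → InfinitelyOften BothHaveEdges (Th* Y) (λ n a b → a + b ≡ 3)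
                × InfinitelyOften BothHaveEdges (Th* Y) (λ n a b → a + b ≡ n)
                × InfinitelyOften BothHaveEdges (Th* Y) (λ n a b → a * b ≡ 2)
                × InfinitelyOften BothHaveEdges (Th* Y) (λ n a b → a * b ≡ n)
th*-sharp Y =
    (λ N → let open TwoFibres Y N in n , ℕ.m≤m+n N 5 , 5≤n , G , edges , 2 , 1 , th* 2<n , Co.th* , refl)
  , (λ N → let open OnePair Y N in n , ℕ.m≤n+m N 5 , 5≤n , G , edges , 4 + N , 1 , th* ℕ.≤-refl , Co.th* , ℕ.+-comm (4 + N) 1)
  , (λ N → let open TwoFibres Y N in n , ℕ.m≤m+n N 5 , 5≤n , G , edges , 2 , 1 , th* 2<n , Co.th* , refl)
  , (λ N → let open Pairs N in n , N≤n , 5≤n , G , edges , m , 2 , Base.th* Y m<n , Co.th* z y fz≢fy Y , refl)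

th×-sharp-lower : ∀ Y → InfinitelyOften NoCondition (Th× Y) (λ n a b → a + b ≡ 6)
                      × InfinitelyOften NoCondition (Th× Y) (λ n a b → a * b ≡ 8)
th×-sharp-lower Y =
    (λ N → let open TwoFibres Y N in n , ℕ.m≤m+n N 5 , 5≤n , G , _ , 4 , 2 , th× (ℕ.≤-trans (ℕ.n≤1+n 4) 5≤n) , Co.th× , refl)
  , (λ N → let open TwoFibres Y N in n , ℕ.m≤m+n N 5 , 5≤n , G , _ , 4 , 2 , th× (ℕ.≤-trans (ℕ.n≤1+n 4) 5≤n) , Co.th× , refl)

th×-power-sharp : InfinitelyOften NoCondition (Th× γP) (λ n a b → a + b ≡ n + 3)
th×-power-sharp N = let open Pairs N in
  n , N≤n , 5≤n , G , _ , n , 3 , Base.th× γP ℕ.≤-refl , Co.th×-power z y fz≢fy only , refl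

th×-cops-sharp : InfinitelyOften NoCondition (Th× c) (λ n a b → a + b ≡ n + 4)
               × InfinitelyOften NoCondition (Th× c) (λ n a b → a * b ≡ 4 * n)
th×-cops-sharp =
    (λ N → let open Pairs N in n , N≤n , 5≤n , G , _ , n , 4 , Base.th× c ℕ.≤-refl , Co.th×-cops z y fz≢fy , refl)
  , (λ N → let open Pairs N in n , N≤n , 5≤n , G , _ , n , 4 , Base.th× c ℕ.≤-refl , Co.th×-cops z y fz≢fy , ℕ.*-comm n 4)

-- Degrees and common neighbours

module _ {n : ℕ} (G : Graph n) where

  α : Fin n → Fin n → ℕ
  α u v = 𝟙 (Graph._~?_ G u v)

  deg : Fin n → ℕ
  deg u = count (Graph._~?_ G u)

  common? : ∀ u v → Decidable (λ w → G ⊢ u ~ w × G ⊢ v ~ w)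
  common? u v w = Graph._~?_ G u w ×-dec Graph._~?_ G v w

  cn : Fin n → Fin n → ℕ
  cn u v = count (common? u v)

  α-sym : ∀ u v → α u v ≡ α v u
  α-sym u v = ℕ.≤-antisym (𝟙-mono _ _ (~-sym G)) (𝟙-mono _ _ (~-sym G))

  cn≡ : ∀ u v → cn u v ≡ ∑[ w < n ] (α u w * α v w)
  cn≡ u v = sum-cong-≗ λ w → pointwise (Graph._~?_ G u w) (Graph._~?_ G v w)
    where
    pointwise : ∀ {P Q : Set} (P? : Dec P) (Q? : Dec Q) → 𝟙 (P? ×-dec Q?) ≡ 𝟙 P? * 𝟙 Q?
    pointwise (yes _) (yes _) = refl
    pointwise (yes _) (no _)  = refl
    pointwise (no _)  _       = refl

  cn-diag : ∀ u → cn u u ≡ deg u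
  cn-diag u = ℕ.≤-antisym (count-mono (common? u u) (Graph._~?_ G u) λ _ → proj₁)
                          (count-mono (Graph._~?_ G u) (common? u u) λ _ p → p , p)

  cn-sum : ∀ y → ∑[ u < n ] cn u y ≡ ∑[ w < n ] (α y w * deg w)
  cn-sum y = begin
    ∑[ u < n ] cn u y                             ≡⟨ sum-cong-≗ (λ u → cn≡ u y) ⟩
    ∑[ u < n ] ∑[ w < n ] (α u w * α y w)         ≡⟨ ∑-comm (λ u w → α u w * α y w) ⟩
    ∑[ w < n ] ∑[ u < n ] (α u w * α y w)         ≡⟨ sum-cong-≗ inner ⟩
    ∑[ w < n ] (α y w * deg w)                    ∎
    where
    open ≡-Reasoning
    inner : ∀ w → ∑[ u < n ] (α u w * α y w) ≡ α y w * deg w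
    inner w = trans (sum-cong-≗ λ u → trans (ℕ.*-comm (α u w) (α y w)) (cong (α y w *_) (α-sym u w)))
                    (sym (*-distribˡ-sum (α y w) (α w)))

  degree-sum≤ : ∀ y d → (∀ w → G ⊢ y ~ w → deg w ≤ d) → ∑[ w < n ] (α y w * deg w) ≤ deg y * d
  degree-sum≤ y d deg≤d = begin
    ∑[ w < n ] (α y w * deg w)  ≤⟨ sum-mono pointwise ⟩
    ∑[ w < n ] (α y w * d)      ≡⟨ sum-cong-≗ (λ w → ℕ.*-comm (α y w) d) ⟩
    ∑[ w < n ] (d * α y w)      ≡⟨ *-distribˡ-sum d (α y) ⟨
    d * deg y                   ≡⟨ ℕ.*-comm d (deg y) ⟩
    deg y * d                   ∎
    where
    open ℕ.≤-Reasoning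
    pointwise : ∀ w → α y w * deg w ≤ α y w * d
    pointwise w with Graph._~?_ G y w
    ... | yes e = ℕ.*-monoʳ-≤ 1 (deg≤d w e)
    ... | no  _ = z≤n

  degree-sum≡ : ∀ y d → (∀ w → deg w ≡ d) → ∑[ u < n ] cn u y ≡ d * d
  degree-sum≡ y d deg≡d = begin
    ∑[ u < n ] cn u y           ≡⟨ cn-sum y ⟩
    ∑[ w < n ] (α y w * deg w)  ≡⟨ sum-cong-≗ (λ w → trans (cong (α y w *_) (deg≡d w)) (ℕ.*-comm (α y w) d)) ⟩
    ∑[ w < n ] (d * α y w)      ≡⟨ *-distribˡ-sum d (α y) ⟨
    d * deg y                   ≡⟨ cong (d *_) (deg≡d y) ⟩
    d * d                       ∎
    where open ≡-Reasoning

  -- Double counting of the paths of length two that start at y.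
  cn-lower-sum : ∀ y m → (∀ u → u ≢ y → m ≤ cn u y) → n * m + deg y ≤ ∑[ w < n ] (α y w * deg w) + m
  cn-lower-sum y m m≤cn = begin
    n * m + deg y                                ≡⟨ cong₂ _+_ (sum-const n m) (sum-*δ y (deg y)) ⟨
    ∑[ u < n ] m + ∑[ u < n ] (deg y * δ y u)    ≡⟨ ∑-distrib-+ (const m) (λ u → deg y * δ y u) ⟨
    ∑[ u < n ] (m + deg y * δ y u)               ≤⟨ sum-mono pointwise ⟩
    ∑[ u < n ] (cn u y + m * δ y u)              ≡⟨ ∑-distrib-+ (λ u → cn u y) (λ u → m * δ y u) ⟩
    ∑[ u < n ] cn u y + ∑[ u < n ] (m * δ y u)   ≡⟨ cong₂ _+_ (cn-sum y) (sum-*δ y m) ⟩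
    ∑[ w < n ] (α y w * deg w) + m               ∎
    where
    open ℕ.≤-Reasoning
    pointwise : ∀ u → m + deg y * δ y u ≤ cn u y + m * δ y u
    pointwise u with y ≟ u
    ... | yes refl = ℕ.≤-reflexive (trans (ℕ.+-comm m _) (cong₂ _+_ (trans (ℕ.*-identityʳ (deg y)) (sym (cn-diag y))) (sym (ℕ.*-identityʳ m))))
    ... | no y≢u   = ℕ.+-mono-≤ (m≤cn u (≢-sym y≢u)) (ℕ.≤-reflexive (trans (ℕ.*-zeroʳ (deg y)) (sym (ℕ.*-zeroʳ m))))

-- Degrees and common neighbours in complementary graphs

module _ {n : ℕ} {G H : Graph n} (co : Complementary G H) where

  -- An entry of the matrix identity A + B + I = J for the adjacency matrices of `G` and `H`.
  unity : ∀ u v → α G u v + (α H u v + δ u v) ≡ 1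
  unity u v with u ≟ v
  ... | yes refl = cong₂ _+_ (𝟙-no (Graph._~?_ G u u) (~-irrefl G refl)) (cong (_+ 1) (𝟙-no (Graph._~?_ H u u) (~-irrefl H refl)))
  ... | no  u≢v  with Graph._~?_ G u v
  ...   | yes e = cong suc (trans (ℕ.+-identityʳ _) (𝟙-no (Graph._~?_ H u v) (disjoint co e)))
  ...   | no ¬e = trans (ℕ.+-identityʳ _) (𝟙-yes (Graph._~?_ H u v) (covering co u≢v ¬e))

  deg-complement : ∀ u → deg G u + (deg H u + 1) ≡ n
  deg-complement u = begin
    deg G u + (deg H u + 1)                       ≡⟨ cong (λ x → deg G u + (deg H u + x)) (sum-δ u) ⟨
    deg G u + (deg H u + ∑[ v < n ] δ u v)        ≡⟨ cong (deg G u +_) (∑-distrib-+ (α H u) (δ u)) ⟨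
    deg G u + ∑[ v < n ] (α H u v + δ u v)        ≡⟨ ∑-distrib-+ (α G u) (λ v → α H u v + δ u v) ⟨
    ∑[ v < n ] (α G u v + (α H u v + δ u v))      ≡⟨ sum-cong-≗ (unity u) ⟩
    ∑[ v < n ] 1                                  ≡⟨ sum-const n 1 ⟩
    n * 1                                         ≡⟨ ℕ.*-identityʳ n ⟩
    n                                             ∎
    where open ≡-Reasoning

  -- Inclusion–exclusion for the two neighbourhoods.
  cn-complement : ∀ u v → cn G u v + n ≡ deg G u + deg G v + (cn H u v + (α H u v + (α H u v + δ u v)))
  cn-complement u v = begin
    cn G u v + n
      ≡⟨ cong₂ _+_ (cn≡ G u v) (trans (sym (ℕ.*-identityʳ n)) (sym (sum-const n 1))) ⟩
    ∑[ w < n ] (α G u w * α G v w) + ∑[ w < n ] 1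
      ≡⟨ ∑-distrib-+ (λ w → α G u w * α G v w) (const 1) ⟨
    ∑[ w < n ] (α G u w * α G v w + 1)
      ≡⟨ sum-cong-≗ pointwise ⟩
    ∑[ w < n ] (α G u w + α G v w + (α H u w * α H v w + (δ v w * α H u w + (δ u w * α H v w + δ u w * δ v w))))
      ≡⟨ ∑-distrib-+ (λ w → α G u w + α G v w) _ ⟩
    ∑[ w < n ] (α G u w + α G v w) + ∑[ w < n ] (α H u w * α H v w + (δ v w * α H u w + (δ u w * α H v w + δ u w * δ v w)))
      ≡⟨ cong₂ _+_ (∑-distrib-+ (α G u) (α G v)) (trans (∑-distrib-+ (λ w → α H u w * α H v w) _)
           (cong₂ _+_ (sym (cn≡ H u v)) (trans (∑-distrib-+ (λ w → δ v w * α H u w) _)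
             (cong₂ _+_ (sum-δ* v (α H u)) (trans (∑-distrib-+ (λ w → δ u w * α H v w) _)
               (cong₂ _+_ (trans (sum-δ* u (α H v)) (α-sym H v u)) (trans (sum-δ* u (δ v)) (δ-sym v u)))))))) ⟩
    deg G u + deg G v + (cn H u v + (α H u v + (α H u v + δ u v))) ∎
    where
    open ≡-Reasoning
    δ-sym : ∀ u v → δ {n} u v ≡ δ v u
    δ-sym u v = ℕ.≤-antisym (𝟙-mono (u ≟ v) (v ≟ u) sym) (𝟙-mono (v ≟ u) (u ≟ v) sym)
    -- The expansion of (1 - x)(1 - y) = x′ y′, arranged without subtraction.
    boolean : ∀ x x′ y y′ → x + x′ ≡ 1 → y + y′ ≡ 1 → x * y + 1 ≡ x + y + x′ * y′
    boolean 0 1 0 1 _ _ = refl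
    boolean 0 1 1 0 _ _ = refl
    boolean 1 0 0 1 _ _ = refl
    boolean 1 0 1 0 _ _ = refl
    expand : ∀ a b d e → (a + d) * (b + e) ≡ a * b + (e * a + (d * b + d * e))
    expand = solve-∀
    pointwise : ∀ w → α G u w * α G v w + 1 ≡
      α G u w + α G v w + (α H u w * α H v w + (δ v w * α H u w + (δ u w * α H v w + δ u w * δ v w)))
    pointwise w = trans (boolean (α G u w) _ (α G v w) _ (unity u w) (unity v w))
      (cong (α G u w + α G v w +_) (expand (α H u w) (α H v w) (δ u w) (δ v w)))

  cn-adjacent : ∀ {u v} → G ⊢ u ~ v → cn G u v + n ≡ deg G u + deg G v + cn H u v
  cn-adjacent {u} {v} e = trans (cn-complement u v) (cong (deg G u + deg G v +_)
    (trans (cong (cn H u v +_) (cong₂ _+_ none (cong₂ _+_ none (δ-≢ (~⇒≢ G e))))) (ℕ.+-identityʳ _)))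
    where none = 𝟙-no (Graph._~?_ H u v) (disjoint co e)

  -- The 2 stands for `u` and `v` themselves, which lie in neither `G`-neighbourhood.
  cn-nonadjacent : ∀ {u v} → H ⊢ u ~ v → cn G u v + n ≡ deg G u + deg G v + (cn H u v + 2)
  cn-nonadjacent {u} {v} e = trans (cn-complement u v) (cong (deg G u + deg G v +_)
    (cong (cn H u v +_) (cong₂ _+_ one (cong₂ _+_ one (δ-≢ (~⇒≢ H e))))))
    where one = 𝟙-yes (Graph._~?_ H u v) e

  -- If the common neighbourhood of J were covered by r blocks of g vertices,
  -- then J and one common non-neighbour for each block would dominate H.
  block : Fin n → ∀ {j} r {g} → ¬ Dom H (j + r) → ¬ Dom G g → (J : Fin j → Fin n) →
          r * g < count (λ w → all? λ i → Graph._~?_ G (J i) w)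
  block v₀ {j} r {g} ¬domH ¬domG J = ℕ.≰⇒> λ count≤ → impossible (cover W? v₀ count≤)
    where
    W? : Decidable (λ w → ∀ i → G ⊢ J i ~ w)
    W? w = all? λ i → Graph._~?_ G (J i) w
    impossible : ¬ (∃ λ (D : Fin (r * g) → Fin n) → ∀ v → (∀ i → G ⊢ J i ~ v) → ∃ λ i → D i ≡ v)
    impossible (D , covers) = clash (covers v J~v)
      where
      avoid : ∀ i → ∃ λ u → ∀ l → H ⊢ D (combine i l) ~ u
      avoid i = common-neighbour (complementary-sym co) ¬domG (D ∘ combine i)
      u : Fin r → Fin n
      u i = proj₁ (avoid i)
      nbr : ∃ λ v → ∀ i → G ⊢ [ J , u ]′ (splitAt j i) ~ v
      nbr = common-neighbour co ¬domH ([ J , u ]′ ∘ splitAt j)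
      v = proj₁ nbr
      J~v : ∀ i → G ⊢ J i ~ v
      J~v i = subst (λ x → G ⊢ [ J , u ]′ x ~ v) (splitAt-↑ˡ j i r) (proj₂ nbr (i ↑ˡ r))
      u~v : ∀ i → G ⊢ u i ~ v
      u~v i = subst (λ x → G ⊢ [ J , u ]′ x ~ v) (splitAt-↑ʳ j r i) (proj₂ nbr (j ↑ʳ i))
      clash : ¬ ∃ λ i → D i ≡ v
      clash (x , Dx≡v) = disjoint co (u~v i) (~-sym H (subst (λ w → H ⊢ w ~ u i)
          (trans (cong D (combine-remQuot {r} g x)) Dx≡v) (proj₂ (avoid i) l)))
        where
        i = proj₁ (remQuot {r} g x)
        l = proj₂ (remQuot {r} g x)

  deg-lower : Fin n → ∀ r {g} → ¬ Dom H (1 + r) → ¬ Dom G g → ∀ y → r * g < deg G y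
  deg-lower v₀ r ¬domH ¬domG y = ℕ.<-≤-trans (block v₀ {1} r ¬domH ¬domG (const y))
    (count-mono (λ w → all? λ i → Graph._~?_ G (const {B = Fin 1} y i) w) (Graph._~?_ G y) λ _ e → e zero)

  cn-lower : Fin n → ∀ r {g} → ¬ Dom H (2 + r) → ¬ Dom G g → ∀ u v → r * g < cn G u v
  cn-lower v₀ r ¬domH ¬domG u v = ℕ.<-≤-trans
    (block v₀ {2} r ¬domH ¬domG uv)
    (count-mono (λ w → all? λ i → Graph._~?_ G (uv i) w) (common? G u v) λ _ e → e zero , e (suc zero))
    where
    uv : Fin 2 → Fin n
    uv zero    = u
    uv (suc _) = v

-- The case n = γ(G) γ(H): degree bounds and the possible orders

module _ {n r i : ℕ} {G H : Graph n} (co : Complementary G H) (v₀ : Fin n)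
         (¬domG : ¬ Dom G (2 + i)) (¬domH : ¬ Dom H (2 + r)) (n≡ : n ≡ (3 + i) * (3 + r)) where

  -- This is n - 1 minus the lower bound (1 + i)(2 + r) + 1 for the degree in `H`.
  deg-upper : ∀ y → deg G y ≤ 5 + (2 * r + i)
  deg-upper y = ℕ.+-cancelʳ-≤ (2 + (1 + i) * (2 + r)) _ _ (begin
    deg G y + (2 + (1 + i) * (2 + r))              ≡⟨ shuffle (deg G y) ((1 + i) * (2 + r)) ⟩
    deg G y + (suc ((1 + i) * (2 + r)) + 1)        ≤⟨ ℕ.+-monoʳ-≤ (deg G y) (ℕ.+-monoˡ-≤ 1
                                                       (deg-lower (complementary-sym co) v₀ (1 + i) ¬domG ¬domH y)) ⟩
    deg G y + (deg H y + 1)                        ≡⟨ deg-complement co y ⟩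
    n                                              ≡⟨ n≡ ⟩
    (3 + i) * (3 + r)                              ≡⟨ identity i r ⟩
    5 + (2 * r + i) + (2 + (1 + i) * (2 + r))      ∎)
    where
    open ℕ.≤-Reasoning
    shuffle : ∀ d x → d + (2 + x) ≡ d + (suc x + 1)
    shuffle = solve-∀
    identity : ∀ i r → (3 + i) * (3 + r) ≡ 5 + (2 * r + i) + (2 + (1 + i) * (2 + r))
    identity = solve-∀

  -- The degree of `v₀` is left explicit: in the small orders this inequality bounds it from below.
  double-count : n * suc (r * (2 + i)) ≤ deg G v₀ * (4 + (2 * r + i)) + suc (r * (2 + i))
  double-count = ℕ.+-cancelʳ-≤ (deg G v₀) _ _ (begin
    n * m + deg G v₀                                      ≤⟨ cn-lower-sum G v₀ m (λ u _ → cn-lower co v₀ r ¬domH ¬domG u v₀) ⟩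
    ∑[ w < n ] (α G v₀ w * deg G w) + m                   ≤⟨ ℕ.+-monoˡ-≤ m (degree-sum≤ G v₀ _ λ w _ → deg-upper w) ⟩
    deg G v₀ * (5 + (2 * r + i)) + m                      ≡⟨ identity (deg G v₀) (2 * r + i) m ⟩
    deg G v₀ * (4 + (2 * r + i)) + m + deg G v₀           ∎)
    where
    open ℕ.≤-Reasoning
    m = suc (r * (2 + i))
    identity : ∀ d x m → d * (5 + x) + m ≡ d * (4 + x) + m + d
    identity = solve-∀

  double-count′ : n * suc (r * (2 + i)) ≤ (5 + (2 * r + i)) * (4 + (2 * r + i)) + suc (r * (2 + i))
  double-count′ = ℕ.≤-trans double-count (ℕ.+-monoˡ-≤ _ (ℕ.*-monoˡ-≤ (4 + (2 * r + i)) (deg-upper v₀)))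

-- With `r = 3 + k`, or with `i = 1 + a` and `r = 1 + a + b`, the two sides of `double-count′`
-- differ the wrong way by a polynomial with positive coefficients: the argument of `suc`, plus one,
-- in `identity`.
few-orders : ∀ {n r i} {G H : Graph n} → Complementary G H → Fin n → ¬ Dom G (2 + i) → ¬ Dom H (2 + r) →
             n ≡ (3 + i) * (3 + r) → i ≤ r → i ≡ 0 × r < 3
few-orders {r = r} {zero} co v₀ ¬domG ¬domH refl i≤r with r ℕ.<? 3
... | yes r<3 = refl , r<3
... | no  r≮3 = contradiction (double-count′ co v₀ ¬domG ¬domH refl) (ℕ.<⇒≱ (large (ℕ.m+[n∸m]≡n (ℕ.≮⇒≥ r≮3))))
  where
  identity : ∀ k → (5 + (2 * (3 + k) + 0)) * (4 + (2 * (3 + k) + 0)) + suc ((3 + k) * 2) + suc (8 + 13 * k + 2 * (k * k))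
                   ≡ (3 * (3 + (3 + k))) * suc ((3 + k) * 2)
  identity = solve-∀
  large : ∀ {k r} → 3 + k ≡ r → (5 + (2 * r + 0)) * (4 + (2 * r + 0)) + suc (r * 2) < (3 * (3 + r)) * suc (r * 2)
  large {k} refl = ℕ.<-≤-trans (ℕ.m<m+n _ (s≤s z≤n)) (ℕ.≤-reflexive (identity k))
few-orders {r = r} {suc a} co v₀ ¬domG ¬domH refl i≤r =
  contradiction (double-count′ co v₀ ¬domG ¬domH refl) (ℕ.<⇒≱ (large (ℕ.m+[n∸m]≡n i≤r)))
  where
  identity : ∀ a b → (5 + (2 * (1 + a + b) + (1 + a))) * (4 + (2 * (1 + a + b) + (1 + a))) + suc ((1 + a + b) * (3 + a))
      + suc (3 + 47 * a + 31 * b + 42 * (a * a) + 47 * (a * b) + 8 * (b * b) + 12 * (a * a * a) + 19 * (a * a * b)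
             + 7 * (a * b * b) + a * a * a * a + 2 * (a * a * a * b) + a * a * b * b)
      ≡ ((4 + a) * (3 + (1 + a + b))) * suc ((1 + a + b) * (3 + a))
  identity = solve-∀
  large : ∀ {b r} → 1 + a + b ≡ r →
          (5 + (2 * r + (1 + a))) * (4 + (2 * r + (1 + a))) + suc (r * (3 + a)) < ((4 + a) * (3 + r)) * suc (r * (3 + a))
  large {b} refl = ℕ.<-≤-trans (ℕ.m<m+n _ (s≤s z≤n)) (ℕ.≤-reflexive (identity a b))

-- Pairs with γ(G) = 2 and γ(H) = n / 2

-- Intended for the indices of v, p v, q v and p (q v) on a 4-cycle. Each alternative lists its
-- inequalities in the order of the images of the least vertex under p, q and p ∘ q.
least-of-four : ∀ {a b d e : ℕ} → a ≢ b → a ≢ d → a ≢ e → b ≢ d → b ≢ e → d ≢ e →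
  (a < b × a < d × a < e) ⊎ (b < a × b < e × b < d) ⊎ (d < e × d < a × d < b) ⊎ (e < d × e < b × e < a)
least-of-four {a} {b} {d} {e} a≢b a≢d a≢e b≢d b≢e d≢e with ℕ.<-cmp a b | ℕ.<-cmp d e
... | tri≈ _ a≡b _ | _ = contradiction a≡b a≢b
... | _ | tri≈ _ d≡e _ = contradiction d≡e d≢e
... | tri< a<b _ _ | tri< d<e _ _ with ℕ.<-cmp a d
...   | tri< a<d _ _ = inj₁ (a<b , a<d , ℕ.<-trans a<d d<e)
...   | tri≈ _ a≡d _ = contradiction a≡d a≢d
...   | tri> _ _ d<a = inj₂ (inj₂ (inj₁ (d<e , d<a , ℕ.<-trans d<a a<b)))
least-of-four {a} {b} {d} {e} a≢b a≢d a≢e b≢d b≢e d≢e | tri< a<b _ _ | tri> _ _ e<d with ℕ.<-cmp a e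
...   | tri< a<e _ _ = inj₁ (a<b , ℕ.<-trans a<e e<d , a<e)
...   | tri≈ _ a≡e _ = contradiction a≡e a≢e
...   | tri> _ _ e<a = inj₂ (inj₂ (inj₂ (e<d , ℕ.<-trans e<a a<b , e<a)))
least-of-four {a} {b} {d} {e} a≢b a≢d a≢e b≢d b≢e d≢e | tri> _ _ b<a | tri< d<e _ _ with ℕ.<-cmp b d
...   | tri< b<d _ _ = inj₂ (inj₁ (b<a , ℕ.<-trans b<d d<e , b<d))
...   | tri≈ _ b≡d _ = contradiction b≡d b≢d
...   | tri> _ _ d<b = inj₂ (inj₂ (inj₁ (d<e , ℕ.<-trans d<b b<a , d<b)))
least-of-four {a} {b} {d} {e} a≢b a≢d a≢e b≢d b≢e d≢e | tri> _ _ b<a | tri> _ _ e<d with ℕ.<-cmp b e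
...   | tri< b<e _ _ = inj₂ (inj₁ (b<a , b<e , ℕ.<-trans b<e e<d))
...   | tri≈ _ b≡e _ = contradiction b≡e b≢e
...   | tri> _ _ e<b = inj₂ (inj₂ (inj₂ (e<d , e<b , ℕ.<-trans e<b b<a)))

-- The parts of a stable partition of H are pairs v, p v.  If H has no leaf, then
-- it is a disjoint union of 4-cycles v, p v, p (q v), q v.

module HalfOrder {n h : ℕ} {G H : Graph n} (co : Complementary G H) (v₀ : Fin n)
                 (¬domG : ¬ Dom G 1) (¬domH : ¬ Dom H (suc h)) (n≡ : n ≡ suc (suc h) * 2)
                 (f : Fin n → Fin (suc (suc h))) (valid : DominatedParts H f) (stable : Stable H f) where

  part? : ∀ i → Decidable (λ v → f v ≡ i)
  part? i v = f v ≟ i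

  -- By stability each part dominates `G`, hence has at least two elements; there are n / 2 parts,
  -- so none can have more.
  part-size : ∀ i → count (part? i) ≡ 2
  part-size = sum-tight (λ i → ℕ.≰⇒> λ ≤1 → ¬domG (dom-weaken G v₀ ≤1 (stable⇒dom (complementary-sym co) stable i)))
    (ℕ.≤-reflexive (trans (fibre-sum f) (trans n≡ (sym (sum-const (suc (suc h)) 2)))))

  opaque
    other : ∀ v → ∃ λ u → f u ≡ f v × u ≢ v
    other v with <count⇒∃∉ (part? (f v)) (v ∷ []) (subst (1 <_) (sym (part-size (f v))) (s≤s (s≤s z≤n)))
    ... | u , fu , u∉ = u , fu , u∉ ∘ here

  p : Fin n → Fin n
  p v = proj₁ (other v)

  fp : ∀ v → f (p v) ≡ f v
  fp v = proj₁ (proj₂ (other v))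

  p≢ : ∀ v → p v ≢ v
  p≢ v = proj₂ (proj₂ (other v))

  in-part : ∀ {v u} → f u ≡ f v → u ≡ v ⊎ u ≡ p v
  in-part {v} {u} fu with count≤⇒∈ (part? (f v)) (v ∷ p v ∷ []) ((≢-sym (p≢ v) ∷ []) ∷ ([] ∷ []))
                            (refl ∷ fp v ∷ []) (ℕ.≤-reflexive (part-size (f v))) u fu
  ... | here e         = inj₁ e
  ... | there (here e) = inj₂ e

  pp : ∀ v → p (p v) ≡ v
  pp v with in-part {p v} (sym (fp v))
  ... | inj₁ e = contradiction (sym e) (p≢ v)
  ... | inj₂ e = sym e

  -- Stability: some member of the part, so `v` or `p v`, is missed by `x`.
  no-triangle : ∀ {v x} → H ⊢ x ~ v → ¬ H ⊢ x ~ p v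
  no-triangle {v} {x} e e′ with stable (f v) x
  ... | y , fy , x≁y with in-part fy
  ...   | inj₁ refl = x≁y e
  ...   | inj₂ refl = x≁y e′

  -- The vertex dominating this part is not adjacent to both of its members, so it is one of them.
  v~pv : ∀ v → H ⊢ v ~ p v
  v~pv v with valid (f v)
  ... | x , near with near v refl | near (p v) (fp v)
  ...   | inj₁ refl | inj₁ e    = contradiction (sym e) (p≢ v)
  ...   | inj₁ refl | inj₂ e    = e
  ...   | inj₂ e    | inj₁ refl = ~-sym H e
  ...   | inj₂ e    | inj₂ e′   = contradiction e′ (no-triangle e)

  -- Otherwise u and w would dominate the three parts of v, u and w.
  opposite-edge : ∀ {v u w} → H ⊢ v ~ u → u ≢ p v → H ⊢ p v ~ w → w ≢ v → w ≡ p u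
  opposite-edge {v} {u} {w} v~u u≢pv pv~w w≢v = decidable-stable (w ≟ p u) λ w≢pu → ¬domH (dominating-set w≢pu)
    where
    fu≢fv : f u ≢ f v
    fu≢fv e = [ ≢-sym (~⇒≢ H v~u) , u≢pv ]′ (in-part e)
    fw≢fv : f w ≢ f v
    fw≢fv e = [ w≢v , ≢-sym (~⇒≢ H pv~w) ]′ (in-part e)
    module _ (w≢pu : w ≢ p u) where
      fw≢fu : f w ≢ f u
      fw≢fu e with in-part e
      ... | inj₁ refl = no-triangle (~-sym H v~u) (~-sym H pv~w)
      ... | inj₂ w≡pu = w≢pu w≡pu
      choice : ∀ i → ∃ λ x → f x ≡ i × (i ≡ f u → x ≡ u) × (i ≡ f w → x ≡ w)
      choice i with i ≟ f u | i ≟ f w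
      ... | yes refl | _        = u , refl , (λ _ → refl) , λ e → contradiction (sym e) fw≢fu
      ... | no  i≢fu | yes refl = w , refl , (λ e → contradiction e i≢fu) , λ _ → refl
      -- Any member serves for the remaining parts, since it dominates its own part by `v~pv`;
      -- `stable` merely supplies one.
      ... | no  i≢fu | no  i≢fw = proj₁ (stable i v) , proj₁ (proj₂ (stable i v))
                                , (λ e → contradiction e i≢fu) , λ e → contradiction e i≢fw
      D : Fin (suc h) → Fin n
      D j = proj₁ (choice (punchIn (f v) j))
      reaches : ∀ {i} → f v ≢ i → ∀ y → StayOrMove H (proj₁ (choice i)) y → ∃ λ j → StayOrMove H (D j) y
      reaches {i} fv≢i y near = punchOut fv≢i ,
        subst (λ k → StayOrMove H (proj₁ (choice k)) y) (sym (punchIn-punchOut fv≢i)) near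
      dominating-set : Dom H (suc h)
      dominating-set = D , λ y → case f y ≟ f v of λ
        { (no fy≢fv) → reaches (≢-sym fy≢fv) y (own y (in-part (proj₁ (proj₂ (choice (f y))))))
        ; (yes e) → in-v (in-part e) }
        where
        own : ∀ y → proj₁ (choice (f y)) ≡ y ⊎ proj₁ (choice (f y)) ≡ p y → StayOrMove H (proj₁ (choice (f y))) y
        own y (inj₁ e) = inj₁ e
        own y (inj₂ e) = inj₂ (subst (λ x → H ⊢ x ~ y) (sym e) (~-sym H (v~pv y)))
        in-v : ∀ {y} → y ≡ v ⊎ y ≡ p v → ∃ λ j → StayOrMove H (D j) y
        in-v (inj₁ refl) = reaches (≢-sym fu≢fv) v
          (inj₂ (subst (λ x → H ⊢ x ~ v) (sym (proj₁ (proj₂ (proj₂ (choice (f u)))) refl)) (~-sym H v~u)))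
        in-v (inj₂ refl) = reaches (≢-sym fw≢fv) (p v)
          (inj₂ (subst (λ x → H ⊢ x ~ p v) (sym (proj₂ (proj₂ (proj₂ (choice (f w)))) refl)) (~-sym H pv~w)))

  module NoLeaf (second : ∀ v → ∃ λ u → H ⊢ v ~ u × u ≢ p v) where

    q : Fin n → Fin n
    q v = proj₁ (second v)

    v~qv : ∀ v → H ⊢ v ~ q v
    v~qv v = proj₁ (proj₂ (second v))

    q≢p : ∀ v → q v ≢ p v
    q≢p v = proj₂ (proj₂ (second v))

    private
      qp≢ : ∀ v → q (p v) ≢ v
      qp≢ v e = q≢p (p v) (trans e (sym (pp v)))

    qp : ∀ v → q (p v) ≡ p (q v)
    qp v = opposite-edge (v~qv v) (q≢p v) (v~qv (p v)) (qp≢ v)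

    -- By `opposite-edge`, `q (p v)` equals `p u` for every such `u`, and also `p (q v)`; cancelling
    -- `p` gives the claim. So `H` is 2-regular.
    q-unique : ∀ {v u} → H ⊢ v ~ u → u ≢ p v → u ≡ q v
    q-unique {v} {u} e u≢pv = trans (sym (pp u)) (trans (cong p
      (trans (sym (opposite-edge e u≢pv (v~qv (p v)) (qp≢ v))) (qp v))) (pp (q v)))

    qq : ∀ v → q (q v) ≡ v
    qq v = sym (q-unique (~-sym H (v~qv v)) λ e → q≢p v (trans (sym (pp (q v))) (cong p (sym e))))

    -- Selects one representative of each 4-cycle, the vertex of smallest index.
    Least : Pred (Fin n) 0ℓ
    Least v = toℕ v < toℕ (p v) × toℕ v < toℕ (q v) × toℕ v < toℕ (p (q v))

    least? : Decidable Least
    least? v = (toℕ v ℕ.<? toℕ (p v)) ×-dec (toℕ v ℕ.<? toℕ (q v)) ×-dec (toℕ v ℕ.<? toℕ (p (q v)))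

    private
      pq-q : ∀ v → q (p (q v)) ≡ p v
      pq-q v = trans (qp (q v)) (cong p (qq v))

    least-in-orbit : ∀ v → Least v ⊎ Least (p v) ⊎ Least (q v) ⊎ Least (p (q v))
    least-in-orbit v with least-of-four
      (toℕ-≢ (≢-sym (p≢ v))) (toℕ-≢ (~⇒≢ H (v~qv v))) (toℕ-≢ λ e → q≢p v (trans (sym (pp (q v))) (cong p (sym e))))
      (toℕ-≢ (≢-sym (q≢p v))) (toℕ-≢ λ e → ~⇒≢ H (v~qv v) (trans (sym (pp v)) (trans (cong p e) (pp (q v)))))
      (toℕ-≢ (≢-sym (p≢ (q v))))
      where
      toℕ-≢ : ∀ {x y : Fin n} → x ≢ y → toℕ x ≢ toℕ y
      toℕ-≢ x≢y e = x≢y (toℕ-injective e)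
    ... | inj₁ l = inj₁ l
    ... | inj₂ (inj₁ (l₁ , l₂ , l₃)) = inj₂ (inj₁
      ( subst (λ x → toℕ (p v) < toℕ x) (sym (pp v)) l₁
      , subst (λ x → toℕ (p v) < toℕ x) (sym (qp v)) l₂
      , subst (λ x → toℕ (p v) < toℕ x) (sym (trans (cong p (qp v)) (pp (q v)))) l₃ ))
    ... | inj₂ (inj₂ (inj₁ (l₁ , l₂ , l₃))) = inj₂ (inj₂ (inj₁
      ( l₁
      , subst (λ x → toℕ (q v) < toℕ x) (sym (qq v)) l₂
      , subst (λ x → toℕ (q v) < toℕ x) (sym (cong p (qq v))) l₃ )))
    ... | inj₂ (inj₂ (inj₂ (l₁ , l₂ , l₃))) = inj₂ (inj₂ (inj₂
      ( subst (λ x → toℕ (p (q v)) < toℕ x) (sym (pp (q v))) l₁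
      , subst (λ x → toℕ (p (q v)) < toℕ x) (sym (pq-q v)) l₂
      , subst (λ x → toℕ (p (q v)) < toℕ x) (sym (trans (cong p (pq-q v)) (pp v))) l₃ )))

    private
      exclusive : ∀ {A B : Set} (A? : Dec A) (B? : Dec B) {s t : ℕ} → (A → s < t) → (B → t < s) → 𝟙 A? + 𝟙 B? ≤ 1
      exclusive (yes a) (yes b) f g = contradiction (f a) (ℕ.<-asym (g b))
      exclusive (yes a) (no _)  f g = ℕ.≤-refl
      exclusive (no _)  (yes _) f g = ℕ.≤-refl
      exclusive (no _)  (no _)  f g = z≤n
      four : ∀ a b d e → a + b ≤ 1 → a + d ≤ 1 → a + e ≤ 1 → b + d ≤ 1 → b + e ≤ 1 → d + e ≤ 1 → a + (b + (d + e)) ≤ 1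
      four zero zero _ _ ab ad ae bd be de = de
      four zero (suc zero) zero zero ab ad ae bd be de = ℕ.≤-refl
      four zero (suc zero) zero (suc e) ab ad ae bd (s≤s ()) de
      four zero (suc zero) (suc d) _ ab ad ae (s≤s ()) be de
      four zero (suc (suc b)) _ _ (s≤s ()) ad ae bd be de
      four (suc zero) zero zero zero ab ad ae bd be de = ℕ.≤-refl
      four (suc zero) zero zero (suc e) ab ad (s≤s ()) bd be de
      four (suc zero) zero (suc d) _ ab (s≤s ()) ae bd be de
      four (suc zero) (suc b) _ _ (s≤s ()) ad ae bd be de
      four (suc (suc a)) _ _ _ (s≤s ()) ad ae bd be de

    -- `p`, `q` and `p ∘ q` are involutions, so shifting the indicator of `Least` along them
    -- preserves its sum; at each vertex at most one of the four shifts is nonzero.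
    4k≤n : count least? + (count least? + (count least? + count least?)) ≤ n
    4k≤n = begin
      count least? + (count least? + (count least? + count least?))
        ≡⟨ cong (sum L +_) (cong₂ _+_ (permuted p pp) (cong₂ _+_ (permuted q qq) (permuted (p ∘ q) pqpq))) ⟩
      sum L + (sum (L ∘ p) + (sum (L ∘ q) + sum (L ∘ p ∘ q)))
        ≡⟨ cong (sum L +_) (cong (sum (L ∘ p) +_) (∑-distrib-+ (L ∘ q) (L ∘ p ∘ q))) ⟨
      sum L + (sum (L ∘ p) + ∑[ v < n ] (L (q v) + L (p (q v))))
        ≡⟨ cong (sum L +_) (∑-distrib-+ (L ∘ p) _) ⟨
      sum L + ∑[ v < n ] (L (p v) + (L (q v) + L (p (q v))))
        ≡⟨ ∑-distrib-+ L _ ⟨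
      ∑[ v < n ] (L v + (L (p v) + (L (q v) + L (p (q v)))))
        ≤⟨ sum-mono one ⟩
      ∑[ v < n ] 1
        ≡⟨ trans (sum-const n 1) (ℕ.*-identityʳ n) ⟩
      n ∎
      where
      open ℕ.≤-Reasoning
      L : Fin n → ℕ
      L v = 𝟙 (least? v)
      pqpq : ∀ v → p (q (p (q v))) ≡ v
      pqpq v = trans (cong p (pq-q v)) (pp v)
      permuted : ∀ (π : Fin n → Fin n) → (∀ v → π (π v) ≡ v) → sum L ≡ sum (L ∘ π)
      permuted π ππ = ∑-permute L (permutation π π ππ ππ)
      <-at : ∀ {x y z : Fin n} → y ≡ z → toℕ x < toℕ y → toℕ x < toℕ z
      <-at e l = subst (λ y → _ < toℕ y) e l
      one : ∀ v → L v + (L (p v) + (L (q v) + L (p (q v)))) ≤ 1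
      one v = four (L v) (L (p v)) (L (q v)) (L (p (q v)))
        (exclusive (least? v) (least? (p v)) proj₁ (λ l → <-at (pp v) (proj₁ l)))
        (exclusive (least? v) (least? (q v)) (proj₁ ∘ proj₂) (λ l → <-at (qq v) (proj₁ (proj₂ l))))
        (exclusive (least? v) (least? (p (q v))) (proj₂ ∘ proj₂) (λ l → <-at (pqpq v) (proj₂ (proj₂ l))))
        (exclusive (least? (p v)) (least? (q v)) (λ l → <-at (trans (cong p (qp v)) (pp (q v))) (proj₂ (proj₂ l)))
                   (λ l → <-at (cong p (qq v)) (proj₂ (proj₂ l))))
        (exclusive (least? (p v)) (least? (p (q v))) (λ l → <-at (qp v) (proj₁ (proj₂ l)))
                   (λ l → <-at (pq-q v) (proj₁ (proj₂ l))))
        (exclusive (least? (q v)) (least? (p (q v))) proj₁ (λ l → <-at (pp (q v)) (proj₁ l)))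

    1≤k : 1 ≤ count least?
    1≤k = [ some v₀ , [ some (p v₀) , [ some (q v₀) , some (p (q v₀)) ]′ ]′ ]′ (least-in-orbit v₀)
      where
      some : ∀ v → Least v → 1 ≤ count least?
      some v l = unique⇒≤count least? (v ∷ []) ([] ∷ []) (l ∷ [])

    achieves-quarter : Achieves γP H (count least?) 2
    achieves-quarter = B , ∣subsetOf∣ least? , two-steps H B seen
      where
      B : Subset n
      B = subsetOf least?
      seen : ∀ w → Observed H B 1 w ⊎ ∃ λ v → Observed H B 1 v × H ⊢ v ~ w × (∀ u → H ⊢ v ~ u → u ≢ w → Observed H B 1 u)
      seen w with least-in-orbit w
      ... | inj₁ l = inj₁ (inj₁ (∈-subsetOf⁺ least? l))
      ... | inj₂ (inj₁ l) = inj₁ (inj₂ (p w , ∈-subsetOf⁺ least? l , ~-sym H (v~pv w)))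
      ... | inj₂ (inj₂ (inj₁ l)) = inj₁ (inj₂ (q w , ∈-subsetOf⁺ least? l , ~-sym H (v~qv w)))
      -- Here `w` is opposite to the chosen vertex `p (q w)`. Its neighbour `q w` is seen in the
      -- first step and has only `w` left to force.
      ... | inj₂ (inj₂ (inj₂ l)) = inj₂ (q w , inj₂ (p (q w) , ∈-subsetOf⁺ least? l , ~-sym H (v~pv (q w))) , ~-sym H (v~qv w) , rest)
        where
        rest : ∀ u → H ⊢ q w ~ u → u ≢ w → Observed H B 1 u
        rest u e u≢w with u ≟ p (q w)
        ... | yes refl = inj₁ (∈-subsetOf⁺ least? l)
        ... | no u≢pqw = contradiction (trans (q-unique e u≢pqw) (qq w)) u≢w

  dichotomy : Achieves γP G 1 2 ⊎ ∃ λ k → 1 ≤ k × k + (k + (k + k)) ≤ n × Achieves γP H k 2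
  dichotomy with any? (λ v → ¬? (any? λ u → Graph._~?_ H v u ×-dec ¬? (u ≟ p v)))
  ... | yes (v , none) = inj₁ (leaf⇒achieves co ¬domH₁ (v~pv v) λ w e →
          decidable-stable (w ≟ p v) λ w≢pv → none (w , e , w≢pv))
    where
    ¬domH₁ : ¬ Dom H 1
    ¬domH₁ = ¬domH ∘ dom-weaken H v₀ (s≤s z≤n)
  ... | no  all = inj₂ (count least? , 1≤k , 4k≤n , achieves-quarter)
    where
    second : ∀ v → ∃ λ u → H ⊢ v ~ u × u ≢ p v
    second v = decidable-stable (any? λ u → Graph._~?_ H v u ×-dec ¬? (u ≟ p v)) λ none → all (v , none)
    open NoLeaf second

half-order : ∀ {n h} {G H : Graph n} → Complementary G H → Fin n → 2 ≤ h →
             IsMinimum _≤_ (Dom G) 2 → IsMinimum _≤_ (Dom H) h → n ≡ h * 2 →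
             Achieves γP G 1 2 ⊎ ∃ λ k → 1 ≤ k × k + (k + (k + k)) ≤ n × Achieves γP H k 2
half-order {h = suc (suc h)} {G} {H} co v₀ (s≤s (s≤s _)) (_ , minG) (domH , minH) n≡
  with stable-partition H (λ dom → ℕ.1+n≰n (minH (suc h) dom)) domH
... | f , valid , stable = HalfOrder.dichotomy co v₀ (λ dom → ℕ.1+n≰n (minG 1 dom)) (λ dom → ℕ.1+n≰n (minH (suc h) dom)) n≡ f valid stable

-- γ(G) = 3 and γ(H) = 5

-- `G` is 9-regular and `H` is 5-regular. There are 5 · 5 = 25 walks of length two from `y` in `H`,
-- but 15 + 9 + 4 = 28 are forced: one to every vertex, a second to each `G`-neighbour of `y`, and
-- four more back to `y`.
no-order-15 : ∀ {n} → n ≡ 15 → {G H : Graph n} → Complementary G H → Fin n → ¬ Dom G 2 → ¬ Dom H 4 → ⊥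
no-order-15 {n} n≡ {G} {H} co y ¬domG ¬domH = ℕ.<⇒≱ (ℕ.m<m+n 25 {3} (s≤s z≤n)) (begin
  28                                       ≡⟨ cong (_+ 4) (trans (∑-distrib-+ (const 1) (α G y)) (cong₂ _+_ (trans (sum-const n 1) (trans (ℕ.*-identityʳ n) n≡)) (deg-G y))) ⟨
  ∑[ u < n ] (1 + α G y u) + 4            ≤⟨ sum-excess bound y 4 at-y ⟩
  ∑[ u < n ] cn H u y                     ≡⟨ degree-sum≡ H y 5 deg-H ⟩
  25                                       ∎)
  where
  open ℕ.≤-Reasoning
  oc : Complementary H G
  oc = complementary-sym co
  deg-G : ∀ v → deg G v ≡ 9
  -- `double-count` reads 75 ≤ 8 · deg + 5, and a degree of at most 8 would give 75 ≤ 69.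
  deg-G v = ℕ.≤-antisym (deg-upper {r = 2} {0} co v ¬domG ¬domH n≡ v) (ℕ.≮⇒≥ λ d<9 →
    ℕ.<⇒≱ {69} {74} (ℕ.m≤m+n 70 4) (ℕ.≤-trans (ℕ.n≤1+n 74) (ℕ.≤-trans (subst (λ n → n * 5 ≤ deg G v * 8 + 5) n≡ (double-count {r = 2} {0} co v ¬domG ¬domH n≡))
      (ℕ.+-monoˡ-≤ 5 (ℕ.*-monoˡ-≤ 8 (s≤s⁻¹ d<9))))))
  deg-H : ∀ v → deg H v ≡ 5
  deg-H v = ℕ.+-cancelʳ-≡ 1 _ _ (ℕ.+-cancelˡ-≡ 9 _ _ (trans (cong (_+ (deg H v + 1)) (sym (deg-G v))) (trans (deg-complement co v) n≡)))
  bound : ∀ u → 1 + α G y u ≤ cn H u y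
  bound u with Graph._~?_ G y u
  ... | no  _ = cn-lower oc y 0 ¬domG ¬domH u y
  -- `cn G u y` is at least 5; inclusion-exclusion turns this into 5 + 15 - 18 = 2 common
  -- `H`-neighbours.
  ... | yes e = ℕ.+-cancelˡ-≤ 18 _ _ (subst (20 ≤_)
    (trans (cn-adjacent co (~-sym G e)) (cong (_+ cn H u y) (cong₂ _+_ (deg-G u) (deg-G y))))
    (subst (λ n → 20 ≤ cn G u y + n) (sym n≡) (ℕ.+-monoˡ-≤ 15 (cn-lower co y 2 ¬domH ¬domG u y))))
  at-y : 1 + α G y y + 4 ≤ cn H y y
  at-y = ℕ.≤-reflexive (trans (cong (λ x → 1 + x + 4) (𝟙-no (Graph._~?_ G y y) (~-irrefl G refl)))
    (sym (trans (cn-diag H y) (deg-H y))))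

-- γ(G) = 3 and γ(H) = 4

-- The ten pairs of elements of Fin 5, each given by its complement.
outside-pair : Fin 10 → Fin 3 → Fin 5
outside-pair s = lookup (lookup
  ( t 0F 1F 2F ∷ t 0F 1F 3F ∷ t 0F 1F 4F ∷ t 0F 2F 3F ∷ t 0F 2F 4F ∷ t 0F 3F 4F
  ∷ t 1F 2F 3F ∷ t 1F 2F 4F ∷ t 1F 3F 4F ∷ t 2F 3F 4F ∷ []) s)
  where
  t : Fin 5 → Fin 5 → Fin 5 → Vec (Fin 5) 3
  t i j k = i ∷ j ∷ k ∷ []

Inside : Fin 10 → Fin 5 → Set
Inside s k = ∀ i → outside-pair s i ≢ k

inside? : ∀ s k → Dec (Inside s k)
inside? s k = all? λ i → ¬? (outside-pair s i ≟ k)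

opaque
  -- Verified by evaluating the decision procedure over all cases; opaque, so that this large term
  -- is not unfolded again.
  pair-determined : ∀ k l s t → k ≢ l → Inside s k → Inside s l → Inside t k → Inside t l → s ≡ t
  pair-determined = from-yes (all? λ k → all? λ l → all? λ s → all? λ t →
    ¬? (k ≟ l) →-dec (inside? s k →-dec (inside? s l →-dec (inside? t k →-dec (inside? t l →-dec (s ≟ t))))))

module Order12 {n : ℕ} (n≡ : n ≡ 12) {G H : Graph n} (v₀ : Fin n) (co : Complementary G H) (¬domG : ¬ Dom G 2) (¬domH : ¬ Dom H 3) where

  private
    oc : Complementary H G
    oc = complementary-sym co

  opaque
    deg-G≤7 : ∀ v → deg G v ≤ 7
    deg-G≤7 v = deg-upper {r = 1} {0} co v ¬domG ¬domH n≡ v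

  opaque
    deg-G≥6 : ∀ v → 6 ≤ deg G v
    -- `double-count` reads 36 ≤ 6 · deg + 3, and a degree of at most 5 would give 36 ≤ 33.
    deg-G≥6 v = ℕ.≮⇒≥ λ d<6 → ℕ.<⇒≱ {33} {36} (ℕ.m≤m+n 34 2) (ℕ.≤-trans (subst (λ n → n * 3 ≤ deg G v * 6 + 3) n≡ (double-count {r = 1} {0} co v ¬domG ¬domH n≡))
      (ℕ.+-monoˡ-≤ 3 (ℕ.*-monoˡ-≤ 6 (s≤s⁻¹ d<6))))

  Σ1 : ∑[ u < n ] 1 ≡ 12
  Σ1 = trans (sum-const n 1) (trans (ℕ.*-identityʳ n) n≡)

  deg-complement-12 : ∀ v → deg G v + (deg H v + 1) ≡ 12
  deg-complement-12 v = trans (deg-complement co v) n≡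

  opaque
    deg-H≤5 : ∀ v → deg H v ≤ 5
    deg-H≤5 v = ℕ.+-cancelʳ-≤ 1 _ _ (ℕ.+-cancelˡ-≤ 6 _ _ (subst (6 + (deg H v + 1) ≤_) (deg-complement-12 v)
      (ℕ.+-monoˡ-≤ (deg H v + 1) (deg-G≥6 v))))

  opaque
    cn-H≥1 : ∀ u v → 1 ≤ cn H u v
    cn-H≥1 u v = cn-lower oc u 0 ¬domG ¬domH u v

  opaque
    cn-G≥3 : ∀ u v → 3 ≤ cn G u v
    cn-G≥3 u v = cn-lower co u 1 ¬domH ¬domG u v

  opaque
    common-H : ∀ u v → ∃ λ w → H ⊢ u ~ w × H ⊢ v ~ w
    common-H u v = ≥1-witness (common? H u v) (cn-H≥1 u v)

  -- The neighbours of `y` induce in `H` a star with centre `z`.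
  Star : Fin n → Fin n → Set
  Star y z = H ⊢ y ~ z × (∀ {m} → H ⊢ y ~ m → m ≢ z → H ⊢ m ~ z) ×
             (∀ {m m′} → H ⊢ y ~ m → H ⊢ y ~ m′ → m ≢ z → m′ ≢ z → ¬ H ⊢ m ~ m′)

  -- A vertex y of H-degree 5.  For every pair X of H-neighbours of y, the other
  -- three have a common G-neighbour.  This gives ten of the eleven vertices
  -- other than y, whence the H-neighbours of y induce a star in H.
  module Degree5 (y : Fin n) (deg-y : deg H y ≡ 5) where

    opaque
      E : Enumeration (H ⊢ y ~_) 5
      E = subst (Enumeration (H ⊢ y ~_)) deg-y (enumerate (Graph._~?_ H y))

    open Enumeration E

    deg-G-y : deg G y ≡ 6
    deg-G-y = ℕ.+-cancelʳ-≡ 6 _ _ (trans (cong (λ d → deg G y + (d + 1)) (sym deg-y)) (deg-complement-12 y))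

    cn-H≥2 : ∀ {x} → G ⊢ x ~ y → 2 ≤ cn H x y
    cn-H≥2 {x} e = ℕ.+-cancelˡ-≤ 13 _ _ (begin
      15                          ≤⟨ ℕ.+-monoˡ-≤ 12 (cn-G≥3 x y) ⟩
      cn G x y + 12               ≡⟨ cong (cn G x y +_) n≡ ⟨
      cn G x y + n                ≡⟨ cn-adjacent co e ⟩
      deg G x + deg G y + cn H x y ≤⟨ ℕ.+-monoˡ-≤ (cn H x y) (ℕ.+-mono-≤ (deg-G≤7 x) (ℕ.≤-reflexive deg-G-y)) ⟩
      13 + cn H x y               ∎)
      where open ℕ.≤-Reasoning

    opaque
      -- A `G`-neighbour of `y` has two common `H`-neighbours with `y`; an `H`-neighbour misses
      -- itself and one more. So `u` is `G`-adjacent to at most three of the five, and different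
      -- triples have different common neighbours.
      two-missed : ∀ u → u ≢ y → ∃₂ λ k l → k ≢ l × ¬ G ⊢ u ~ at k × ¬ G ⊢ u ~ at l
      two-missed u u≢y with Graph._~?_ G u y
      ... | yes e = case two-witnesses (common? H u y) (cn-H≥2 e) of λ
        { (a , b , a≢b , (ua , ya) , (ub , yb)) → index ya , index yb
        , (λ e → a≢b (trans (sym (at-index ya)) (trans (cong at e) (at-index yb))))
        , (λ e → disjoint co (subst (λ x → G ⊢ u ~ x) (at-index ya) e) ua)
        , (λ e → disjoint co (subst (λ x → G ⊢ u ~ x) (at-index yb) e) ub) }
      ... | no ¬e = case common-H u y of λ
        { (a , ua , ya) → index y~u , index ya
        , (λ e → ~⇒≢ H ua (trans (sym (at-index y~u)) (trans (cong at e) (at-index ya))))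
        , (λ e → ~-irrefl G (sym (at-index y~u)) e)
        , (λ e → disjoint co (subst (λ x → G ⊢ u ~ x) (at-index ya) e) ua) }
        where
        y~u : H ⊢ y ~ u
        y~u = ~-sym H (covering co u≢y ¬e)

    opaque
      chosen : ∀ s → ∃ λ v → ∀ i → G ⊢ at (outside-pair s i) ~ v
      chosen s = common-neighbour co ¬domH (at ∘ outside-pair s)

    w : Fin 10 → Fin n
    w s = proj₁ (chosen s)

    missed⇒inside : ∀ {s u k} → w s ≡ u → ¬ G ⊢ u ~ at k → Inside s k
    missed⇒inside {s} {u} ws≡u ¬e i refl = ¬e (subst (λ x → G ⊢ x ~ at (outside-pair s i)) ws≡u (~-sym G (proj₂ (chosen s) i)))

    w≢y : ∀ s → w s ≢ y
    w≢y s e = disjoint co (proj₂ (chosen s) zero) (subst (λ x → H ⊢ at (outside-pair s zero) ~ x) (sym e) (~-sym H (at-∈ _)))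

    w-inj : ∀ s t → w s ≡ w t → s ≡ t
    w-inj s t e with two-missed (w t) (w≢y t)
    ... | k , l , k≢l , ¬k , ¬l = pair-determined k l s t k≢l
      (missed⇒inside e ¬k) (missed⇒inside e ¬l) (missed⇒inside refl ¬k) (missed⇒inside refl ¬l)

    Used : Fin n → Set
    Used v = ∃ λ s → w s ≡ v

    used? : Decidable Used
    used? v = any? λ s → w s ≟ v

    one-unused : ∀ {u v} → u ≢ y → v ≢ y → ¬ Used u → ¬ Used v → u ≡ v
    one-unused {u} {v} u≢y v≢y ¬u ¬v = decidable-stable (u ≟ v) λ u≢v →
      -- `y`, `u`, `v` and the ten vertices `w s` would be 13 vertices.
      ℕ.<⇒≱ (ℕ.n<1+n 12) (subst (13 ≤_) n≡ (injective⇒≤ {f = f} λ {i} {j} → f-inj u≢v i j))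
      where
      f : Fin 13 → Fin n
      f zero = y
      f (suc zero) = u
      f (suc (suc zero)) = v
      f (suc (suc (suc s))) = w s
      f-inj : u ≢ v → ∀ i j → f i ≡ f j → i ≡ j
      f-inj u≢v zero zero e = refl
      f-inj u≢v zero (suc zero) e = contradiction (sym e) u≢y
      f-inj u≢v zero (suc (suc zero)) e = contradiction (sym e) v≢y
      f-inj u≢v zero (suc (suc (suc s))) e = contradiction (sym e) (w≢y s)
      f-inj u≢v (suc zero) zero e = contradiction e u≢y
      f-inj u≢v (suc zero) (suc zero) e = refl
      f-inj u≢v (suc zero) (suc (suc zero)) e = contradiction e u≢v
      f-inj u≢v (suc zero) (suc (suc (suc s))) e = contradiction (s , sym e) ¬u
      f-inj u≢v (suc (suc zero)) zero e = contradiction e v≢y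
      f-inj u≢v (suc (suc zero)) (suc zero) e = contradiction (sym e) u≢v
      f-inj u≢v (suc (suc zero)) (suc (suc zero)) e = refl
      f-inj u≢v (suc (suc zero)) (suc (suc (suc s))) e = contradiction (s , sym e) ¬v
      f-inj u≢v (suc (suc (suc s))) zero e = contradiction e (w≢y s)
      f-inj u≢v (suc (suc (suc s))) (suc zero) e = contradiction (s , e) ¬u
      f-inj u≢v (suc (suc (suc s))) (suc (suc zero)) e = contradiction (s , e) ¬v
      f-inj u≢v (suc (suc (suc s))) (suc (suc (suc t))) e = cong (λ i → suc (suc (suc i))) (w-inj s t e)

    -- If adjacent in `H`, each of the two misses both `at i` and `at k`, so both would be the
    -- vertex chosen for the same pair.
    used-nonadjacent : ∀ {i k} → Used (at i) → Used (at k) → ¬ H ⊢ at i ~ at k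
    used-nonadjacent {i} {k} (s , ws) (t , wt) e = ~⇒≢ H e (trans (sym ws) (trans (cong w s≡t) wt))
      where
      e′ : H ⊢ at k ~ at i
      e′ = ~-sym H e
      s≡t : s ≡ t
      s≡t = pair-determined i k s t (λ i≡k → ~⇒≢ H e (cong at i≡k))
        (missed⇒inside ws (~-irrefl G refl)) (missed⇒inside ws λ g → disjoint co g e)
        (missed⇒inside wt λ g → disjoint co g e′) (missed⇒inside wt (~-irrefl G refl))

    inner : ∀ i → ∃ λ j → H ⊢ at i ~ at j
    inner i with common-H (at i) y
    ... | a , ia , ya = index ya , subst (λ x → H ⊢ at i ~ x) (sym (at-index ya)) ia

    some-used : ∃ λ i → Used (at i)
    some-used with used? (at zero) | used? (at (suc zero))
    ... | yes u | _     = zero , u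
    ... | no  _ | yes u = suc zero , u
    ... | no ¬u | no ¬v = contradiction (at-inj (one-unused (≢-sym (~⇒≢ H (at-∈ _))) (≢-sym (~⇒≢ H (at-∈ _))) ¬u ¬v)) λ ()

    opaque
      star : ∃ (Star y)
      star with some-used
      ... | i₁ , u₁ = from (inner i₁)
        where
        from : (∃ λ j → H ⊢ at i₁ ~ at j) → ∃ (Star y)
        from (j₀ , e₁) = at j₀ , at-∈ j₀ , spoke , leaves
          where
          ¬u₀ : ¬ Used (at j₀)
          ¬u₀ u₀ = used-nonadjacent u₁ u₀ e₁
          used : ∀ {m} → H ⊢ y ~ m → m ≢ at j₀ → Used m
          used {m} ym m≢ = decidable-stable (used? m) λ ¬u →
            m≢ (one-unused (≢-sym (~⇒≢ H ym)) (≢-sym (~⇒≢ H (at-∈ j₀))) ¬u ¬u₀)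
          used-at : ∀ {m} (ym : H ⊢ y ~ m) → m ≢ at j₀ → Used (at (index ym))
          used-at ym m≢ = subst Used (sym (at-index ym)) (used ym m≢)
          leaves : ∀ {m m′} → H ⊢ y ~ m → H ⊢ y ~ m′ → m ≢ at j₀ → m′ ≢ at j₀ → ¬ H ⊢ m ~ m′
          leaves ym ym′ m≢ m′≢ e = used-nonadjacent (used-at ym m≢) (used-at ym′ m′≢)
            (subst₂ (λ a b → H ⊢ a ~ b) (sym (at-index ym)) (sym (at-index ym′)) e)
          spoke : ∀ {m} → H ⊢ y ~ m → m ≢ at j₀ → H ⊢ m ~ at j₀
          spoke {m} ym m≢ with common-H m y
          ... | a , ma , ya with a ≟ at j₀
          ...   | yes refl = ma
          ...   | no  a≢   = contradiction ma (leaves ym ya m≢ a≢)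

  opaque
    -- The centre `m₀` of the star has no neighbours beyond `y` and the leaves, and counting forces
    -- the leaves to have degree 5 too. So the neighbourhood of a leaf `m₁` is again a star; it
    -- contains the edge from `y` to `m₀` and a further vertex adjacent to neither, which no star
    -- allows.
    no-degree-5 : ∀ y → deg H y ≢ 5
    no-degree-5 y deg-y with Degree5.star y deg-y
    ... | m₀ , y~m₀ , spoke , leaves = final (<count⇒∃∉ (Graph._~?_ H y) (m₀ ∷ []) (subst (1 <_) (sym deg-y) (s≤s (s≤s z≤n))))
      where
      open ℕ.≤-Reasoning

      -- The six vertices of the closed neighbourhood of `y` lie in that of `m₀`; `x` would be a
      -- seventh, but `m₀` has degree at most 5.
      m₀-closed : ∀ x → H ⊢ m₀ ~ x → x ≢ y → H ⊢ y ~ x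
      m₀-closed x m₀x x≢y = decidable-stable (Graph._~?_ H y x) λ ¬yx → ℕ.<⇒≱ (ℕ.n<1+n 6) (begin
        7                                                ≡⟨ cong (λ d → d + 1 + 1) deg-y ⟨
        deg H y + 1 + 1                                  ≡⟨ cong (_+ 1) (sum-+δ (α H y) y 1) ⟨
        sum (λ v → α H y v + 1 * δ y v) + 1              ≤⟨ sum-excess (base ¬yx) x 1 (at-x ¬yx) ⟩
        sum (λ v → α H m₀ v + 1 * δ m₀ v)                ≡⟨ sum-+δ (α H m₀) m₀ 1 ⟩
        deg H m₀ + 1                                     ≤⟨ ℕ.+-monoˡ-≤ 1 (deg-H≤5 m₀) ⟩
        6                                                ∎)
        where
        base : ¬ H ⊢ y ~ x → ∀ v → α H y v + 1 * δ y v ≤ α H m₀ v + 1 * δ m₀ v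
        base ¬yx v with y ≟ v
        ... | yes refl = ℕ.≤-trans (ℕ.≤-reflexive (trans (cong (_+ 1) (𝟙-no (Graph._~?_ H y y) (~-irrefl H refl)))
                (sym (𝟙-yes (Graph._~?_ H m₀ y) (~-sym H y~m₀))))) (ℕ.m≤m+n _ _)
        ... | no _ with Graph._~?_ H y v | m₀ ≟ v
        ...   | no _ | _ = z≤n
        ...   | yes yv | yes refl = ℕ.m≤n+m 1 _
        ...   | yes yv | no m₀≢v = ℕ.≤-trans (ℕ.≤-reflexive (sym (𝟙-yes (Graph._~?_ H m₀ v) (~-sym H (spoke yv (≢-sym m₀≢v)))))) (ℕ.m≤m+n _ _)
        at-x : ¬ H ⊢ y ~ x → α H y x + 1 * δ y x + 1 ≤ α H m₀ x + 1 * δ m₀ x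
        at-x ¬yx = subst₂ (λ a d → a + 1 * d + 1 ≤ α H m₀ x + 1 * δ m₀ x) (sym (𝟙-no (Graph._~?_ H y x) ¬yx)) (sym (δ-≢ (≢-sym x≢y)))
          (ℕ.≤-trans (ℕ.≤-reflexive (sym (𝟙-yes (Graph._~?_ H m₀ x) m₀x))) (ℕ.m≤m+n _ _))

      cn-m₀≥4 : 4 ≤ cn H m₀ y
      cn-m₀≥4 = ℕ.+-cancelʳ-≤ 1 _ _ (begin
        5                                                      ≡⟨ deg-y ⟨
        deg H y                                                ≤⟨ sum-mono pointwise ⟩
        sum (λ v → 𝟙 (common? H m₀ y v) + 1 * δ m₀ v)          ≡⟨ sum-+δ (λ v → 𝟙 (common? H m₀ y v)) m₀ 1 ⟩
        cn H m₀ y + 1                                          ∎)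
        where
        pointwise : ∀ v → α H y v ≤ 𝟙 (common? H m₀ y v) + 1 * δ m₀ v
        pointwise v with Graph._~?_ H y v in eq
        ... | no _ = z≤n
        ... | yes yv with m₀ ≟ v
        ...   | yes _ = ℕ.m≤n+m 1 _
        ...   | no m₀≢v = ℕ.≤-trans (ℕ.≤-reflexive (sym (𝟙-yes (Graph._~?_ H m₀ v ×-dec yes yv) (~-sym H (spoke yv (≢-sym m₀≢v)) , yv)))) (ℕ.m≤m+n _ _)

      -- At least 12 + 6 + 4 + 3 = 25 walks of length two start at `y`, the 3 being the surplus at
      -- `m₀`. So the degrees of its five neighbours must add up to 25, and none exceeds 5.
      leaf-degree : ∀ m → H ⊢ y ~ m → 5 ≤ deg H m
      leaf-degree m ym = ℕ.≮⇒≥ λ d<5 → ℕ.<⇒≱ (ℕ.n<1+n 25) (begin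
        26                                                   ≡⟨ cong (λ d → 12 + d + 4 + 3 + 1) deg-G-y ⟨
        12 + deg G y + 4 + 3 + 1                             ≡⟨ cong (λ s → s + 4 + 3 + 1) (trans (∑-distrib-+ (const 1) (α G y)) (cong (_+ deg G y) Σ1)) ⟨
        sum (λ u → 1 + α G y u) + 4 + 3 + 1                  ≡⟨ cong (λ s → s + 3 + 1) (sum-+δ (λ u → 1 + α G y u) y 4) ⟨
        sum (λ u → 1 + α G y u + 4 * δ y u) + 3 + 1          ≤⟨ ℕ.+-monoˡ-≤ 1 (sum-excess base m₀ 3 at-m₀) ⟩
        sum (λ u → cn H u y) + 1                             ≡⟨ cong (_+ 1) (cn-sum H y) ⟩
        sum (λ v → α H y v * deg H v) + 1                    ≤⟨ sum-excess below m 1 (at-m d<5) ⟩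
        sum (λ v → α H y v * 5)                              ≡⟨ sum-cong-≗ (λ v → ℕ.*-comm (α H y v) 5) ⟩
        sum (λ v → 5 * α H y v)                              ≡⟨ *-distribˡ-sum 5 (α H y) ⟨
        5 * deg H y                                          ≡⟨ cong (5 *_) deg-y ⟩
        25                                                   ∎)
        where
        open Degree5 y deg-y using (deg-G-y; cn-H≥2)
        base : ∀ u → 1 + α G y u + 4 * δ y u ≤ cn H u y
        base u with y ≟ u
        ... | yes refl = ℕ.≤-reflexive (trans (cong (λ a → 1 + a + 4) (𝟙-no (Graph._~?_ G y y) (~-irrefl G refl))) (sym (trans (cn-diag H y) deg-y)))
        ... | no _ with Graph._~?_ G y u
        ...   | yes e = cn-H≥2 (~-sym G e)
        ...   | no  _ = cn-H≥1 u y
        at-m₀ : 1 + α G y m₀ + 4 * δ y m₀ + 3 ≤ cn H m₀ y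
        at-m₀ = subst₂ (λ a d → 1 + a + 4 * d + 3 ≤ cn H m₀ y)
          (sym (𝟙-no (Graph._~?_ G y m₀) λ g → disjoint co g y~m₀)) (sym (δ-≢ (~⇒≢ H y~m₀))) cn-m₀≥4
        below : ∀ v → α H y v * deg H v ≤ α H y v * 5
        below v = ℕ.*-monoʳ-≤ (α H y v) (deg-H≤5 v)
        at-m : deg H m < 5 → α H y m * deg H m + 1 ≤ α H y m * 5
        at-m d<5 = subst (λ a → a * deg H m + 1 ≤ a * 5) (sym (𝟙-yes (Graph._~?_ H y m) ym))
          (subst (_≤ 5) (trans (ℕ.+-comm 1 _) (cong (_+ 1) (sym (ℕ.+-identityʳ _)))) d<5)

      final : ¬ ∃ λ m₁ → H ⊢ y ~ m₁ × m₁ ∉ᵥ (m₀ ∷ [])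
      final (m₁ , ym₁ , m₁∉) = contradict (Degree5.star m₁ (ℕ.≤-antisym (deg-H≤5 m₁) (leaf-degree m₁ ym₁)))
        (<count⇒∃∉ (Graph._~?_ H m₁) (y ∷ m₀ ∷ []) (ℕ.≤-trans (s≤s (s≤s (s≤s z≤n))) (leaf-degree m₁ ym₁)))
        where
        m₁≢m₀ : m₁ ≢ m₀
        m₁≢m₀ = m₁∉ ∘ here
        contradict : ∃ (Star m₁) → ¬ ∃ λ x → H ⊢ m₁ ~ x × x ∉ᵥ (y ∷ m₀ ∷ [])
        contradict (z , _ , spoke′ , leaves′) (x , m₁x , x∉) = clash (y ≟ z) (m₀ ≟ z)
          where
          x≢y : x ≢ y
          x≢y = x∉ ∘ here
          x≢m₀ : x ≢ m₀
          x≢m₀ = x∉ ∘ there ∘ here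
          ¬yx : ¬ H ⊢ y ~ x
          ¬yx yx = leaves ym₁ yx m₁≢m₀ x≢m₀ m₁x
          clash : Dec (y ≡ z) → Dec (m₀ ≡ z) → ⊥
          clash (yes refl) _ = ¬yx (~-sym H (spoke′ m₁x x≢y))
          clash (no _) (yes refl) = ¬yx (m₀-closed x (~-sym H (spoke′ m₁x x≢m₀)) x≢y)
          clash (no y≢z) (no m₀≢z) = leaves′ (~-sym H ym₁) (spoke ym₁ m₁≢m₀) y≢z m₀≢z y~m₀

  opaque
    deg-H≡4 : ∀ v → deg H v ≡ 4
    deg-H≡4 v = ℕ.≤-antisym (s≤s⁻¹ (ℕ.≤∧≢⇒< (deg-H≤5 v) (no-degree-5 v)))
      (ℕ.+-cancelʳ-≤ 1 _ _ (ℕ.+-cancelˡ-≤ 7 _ _ (subst (_≤ 7 + (deg H v + 1)) (deg-complement-12 v) (ℕ.+-monoˡ-≤ (deg H v + 1) (deg-G≤7 v)))))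

  -- H is 4-regular, so all but one of the vertices other than y have exactly
  -- one common neighbour with y, and the exceptional one has two.
  module Regular (y : Fin n) where

    private
      -- The lower bound for `cn H u y`. Its sum is 15, one short of the true total 4 · 4, which
      -- leaves room for exactly one exception.
      g : Fin n → ℕ
      g u = 1 + 3 * δ y u
      Σg : sum g ≡ 15
      Σg = trans (sum-+δ (const 1) y 3) (cong (_+ 3) Σ1)
      Σcn : ∑[ u < n ] cn H u y ≡ 16
      Σcn = degree-sum≡ H y 4 deg-H≡4
      g≤cn : ∀ u → g u ≤ cn H u y
      g≤cn u with y ≟ u
      ... | yes refl = ℕ.≤-reflexive (sym (trans (cn-diag H y) (deg-H≡4 y)))
      ... | no  _    = cn-H≥1 u y
      g-other : ∀ {u} → u ≢ y → g u ≡ 1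
      g-other u≢y = cong (λ d → 1 + 3 * d) (δ-≢ (≢-sym u≢y))

    opaque
      cn≤2 : ∀ {u} → u ≢ y → cn H u y ≤ 2
      cn≤2 {u} u≢y = ℕ.≮⇒≥ λ 2<cn → ℕ.<⇒≱ (ℕ.n<1+n 16)
        (subst₂ _≤_ (cong (_+ 2) Σg) Σcn (sum-excess g≤cn u 2 (subst (λ x → x + 2 ≤ cn H u y) (sym (g-other u≢y)) 2<cn)))

    opaque
      exceptional : ∃ λ x → x ≢ y × 2 ≤ cn H x y
      exceptional with any? (λ x → ¬? (x ≟ y) ×-dec (2 ℕ.≤? cn H x y))
      ... | yes found = found
      ... | no  none  = contradiction (subst₂ _≤_ Σcn Σg (sum-mono cn≤g)) (ℕ.<⇒≱ (ℕ.n<1+n 15))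
        where
        cn≤g : ∀ u → cn H u y ≤ g u
        cn≤g u with y ≟ u
        ... | yes refl = ℕ.≤-reflexive (trans (cn-diag H y) (deg-H≡4 y))
        ... | no  y≢u  = s≤s⁻¹ (ℕ.≰⇒> λ 2≤ → none (u , ≢-sym y≢u , 2≤))

    opaque
      exceptional-unique : ∀ {u v} → u ≢ y → v ≢ y → 2 ≤ cn H u y → 2 ≤ cn H v y → u ≡ v
      exceptional-unique {u} {v} u≢y v≢y 2≤u 2≤v = decidable-stable (u ≟ v) λ u≢v → ℕ.<⇒≱ (ℕ.n<1+n 16)
        (subst₂ _≤_ (cong (_+ 1) (trans (sum-+δ g u 1) (cong (_+ 1) Σg))) Σcn
          (sum-excess base v 1 (subst₂ (λ x d → x + 1 * d + 1 ≤ cn H v y) (sym (g-other v≢y)) (sym (δ-≢ u≢v)) 2≤v)))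
        where
        base : ∀ x → g x + 1 * δ u x ≤ cn H x y
        base x with u ≟ x
        ... | yes refl = subst (λ k → k + 1 ≤ cn H u y) (sym (g-other u≢y)) 2≤u
        ... | no  _    = subst (_≤ cn H x y) (sym (ℕ.+-identityʳ (g x))) (g≤cn x)

    opaque
      -- Otherwise `m` is exceptional for `y`, with common neighbours `a` and `b`. The fourth
      -- neighbour `e` of `y` needs a common neighbour with `y`: `m` would then have three of them,
      -- while `a` or `b` would become a second exceptional vertex.
      edge-cn : ∀ {m} → H ⊢ y ~ m → cn H m y ≤ 1
      edge-cn {m} ym = ℕ.≮⇒≥ λ 2≤ → impossible 2≤ (two-witnesses (common? H m y) 2≤)
        where
        ≢y : ∀ {x} → H ⊢ y ~ x → x ≢ y
        ≢y e = ≢-sym (~⇒≢ H e)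
        impossible : 2 ≤ cn H m y → ¬ (∃₂ λ a b → a ≢ b × (H ⊢ m ~ a × H ⊢ y ~ a) × (H ⊢ m ~ b × H ⊢ y ~ b))
        impossible 2≤ (a , b , a≢b , (ma , ya) , (mb , yb)) =
          fourth (<count⇒∃∉ (Graph._~?_ H y) (m ∷ a ∷ b ∷ []) (ℕ.≤-reflexive (sym (deg-H≡4 y))))
          where
          fourth : ¬ ∃ λ e → H ⊢ y ~ e × e ∉ᵥ (m ∷ a ∷ b ∷ [])
          fourth (e , ye , e∉) = meets (common-H e y)
            where
            around : ∀ x → H ⊢ y ~ x → x ∈ᵥ (e ∷ m ∷ a ∷ b ∷ [])
            around = count≤⇒∈ (Graph._~?_ H y) (e ∷ m ∷ a ∷ b ∷ [])
              ((e∉ ∘ here ∷ e∉ ∘ there ∘ here ∷ e∉ ∘ there ∘ there ∘ here ∷ []) ∷ (~⇒≢ H ma ∷ ~⇒≢ H mb ∷ []) ∷ (a≢b ∷ []) ∷ [] ∷ [])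
              (ye ∷ ym ∷ ya ∷ yb ∷ []) (ℕ.≤-reflexive (deg-H≡4 y))
            clash : ∀ {x} → H ⊢ e ~ x → x ∈ᵥ (e ∷ m ∷ a ∷ b ∷ []) → ⊥
            clash ex (here refl) = ~-irrefl H refl ex
            clash ex (there (here refl)) = ℕ.<⇒≱ (unique⇒≤count (common? H m y) (e ∷ a ∷ b ∷ [])
              ((e∉ ∘ there ∘ here ∷ e∉ ∘ there ∘ there ∘ here ∷ []) ∷ (a≢b ∷ []) ∷ [] ∷ [])
              ((~-sym H ex , ye) ∷ (ma , ya) ∷ (mb , yb) ∷ [])) (cn≤2 (≢y ym))
            clash ex (there (there (here refl))) = ~⇒≢ H ma (exceptional-unique (≢y ym) (≢y ya) 2≤
              (two⇒≤count (common? H a y) (≢-sym (e∉ ∘ here)) (~-sym H ma , ym) (~-sym H ex , ye)))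
            clash ex (there (there (there (here refl)))) = ~⇒≢ H mb (exceptional-unique (≢y ym) (≢y yb) 2≤
              (two⇒≤count (common? H b y) (≢-sym (e∉ ∘ here)) (~-sym H mb , ym) (~-sym H ex , ye)))
            meets : ¬ ∃ λ x → H ⊢ e ~ x × H ⊢ y ~ x
            meets (x , ex , yx) = clash ex (around x yx)

  opaque
    -- Together with `common-H`, every edge of `H` lies in exactly one triangle.
    triangle-unique : ∀ {u v a b} → H ⊢ u ~ v → H ⊢ u ~ a → H ⊢ v ~ a → H ⊢ u ~ b → H ⊢ v ~ b → a ≡ b
    triangle-unique {u} {v} uv ua va ub vb =
      count≤1⇒≡ (common? H v u) (Regular.edge-cn u uv) (va , ua) (vb , ub)

  open Regular using (exceptional; exceptional-unique)

  -- The exceptional `x` and `y` share `m₁` and `m₃`; the triangles on the four edges between them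
  -- add `m₂`, `m₄`, `a` and `d`. The remaining neighbours `e` and `e′` of `m₄` form a triangle with
  -- it, and both turn out to be adjacent to `a`, which puts the edge between them into a second
  -- triangle.
  impossible : ⊥
  impossible with exceptional v₀
  ... | x , x≢y , 2≤x with two-witnesses (common? H x v₀) 2≤x
  ...   | m₁ , m₃ , m₁≢m₃ , (xm₁ , ym₁) , (xm₃ , ym₃)
    with common-H v₀ m₁ | common-H v₀ m₃ | common-H m₁ x | common-H m₃ x
  ...     | m₂ , ym₂ , m₁m₂ | m₄ , ym₄ , m₃m₄ | a , m₁a , xa | d , m₃d , xd = clash
    where
    y : Fin n
    y = v₀
    s : ∀ {u v} → H ⊢ u ~ v → H ⊢ v ~ u
    s = ~-sym H
    y≁x : ¬ H ⊢ y ~ x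
    y≁x yx = m₁≢m₃ (triangle-unique yx ym₁ xm₁ ym₃ xm₃)
    m₁≁m₃ : ¬ H ⊢ m₁ ~ m₃
    m₁≁m₃ e = x≢y (triangle-unique e (s xm₁) (s xm₃) (s ym₁) (s ym₃))
    m₄≁m₁ : ¬ H ⊢ m₄ ~ m₁
    m₄≁m₁ e = m₁≢m₃ (triangle-unique ym₄ ym₁ e ym₃ (s m₃m₄))
    m₂≢m₄ : m₂ ≢ m₄
    m₂≢m₄ refl = m₁≢m₃ (triangle-unique ym₂ ym₁ (s m₁m₂) ym₃ (s m₃m₄))
    m₁≢m₄ : m₁ ≢ m₄
    m₁≢m₄ refl = m₁≁m₃ (s m₃m₄)
    a≢y : a ≢ y
    a≢y refl = y≁x (s xa)
    around-m₁ : ∀ z → H ⊢ m₁ ~ z → z ∈ᵥ (y ∷ m₂ ∷ x ∷ a ∷ [])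
    around-m₁ = count≤⇒∈ (Graph._~?_ H m₁) _
      ( (~⇒≢ H ym₂ ∷ ≢-sym x≢y ∷ ≢-sym a≢y ∷ [])
      ∷ ((λ { refl → y≁x ym₂ }) ∷ (λ { refl → x≢y (triangle-unique m₁a (s xm₁) (s xa) (s ym₁) (s ym₂)) }) ∷ [])
      ∷ (~⇒≢ H xa ∷ []) ∷ [] ∷ [])
      (s ym₁ ∷ m₁m₂ ∷ s xm₁ ∷ m₁a ∷ []) (ℕ.≤-reflexive (deg-H≡4 m₁))
    around-x : ∀ z → H ⊢ x ~ z → z ∈ᵥ (m₁ ∷ m₃ ∷ a ∷ d ∷ [])
    around-x = count≤⇒∈ (Graph._~?_ H x) _
      ( (m₁≢m₃ ∷ ~⇒≢ H m₁a ∷ (λ { refl → m₁≁m₃ (s m₃d) }) ∷ [])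
      ∷ ((λ { refl → m₁≁m₃ m₁a }) ∷ ~⇒≢ H m₃d ∷ [])
      ∷ ((λ { refl → m₁≢m₃ (triangle-unique xa xm₁ (s m₁a) xm₃ (s m₃d)) }) ∷ []) ∷ [] ∷ [])
      (xm₁ ∷ xm₃ ∷ xa ∷ xd ∷ []) (ℕ.≤-reflexive (deg-H≡4 x))
    -- A common neighbour of `e` and `m₁` is `y`, `m₂`, `x` or `a`. The first three contradict
    -- uniqueness of triangles, uniqueness of the exceptional vertex or the choice of `e`.
    a~ : ∀ e → H ⊢ m₄ ~ e → e ≢ y → e ≢ m₃ → H ⊢ a ~ e
    a~ e m₄e e≢y e≢m₃ with common-H m₁ e
    ... | z , m₁z , ez with around-m₁ z m₁z
    ...   | here refl = contradiction (triangle-unique ym₄ (s ez) m₄e ym₃ (s m₃m₄)) e≢m₃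
    ...   | there (here refl) with exceptional-unique y e≢y x≢y (two⇒≤count (common? H e y) m₂≢m₄ (ez , ym₂) (s m₄e , ym₄)) 2≤x
    ...     | refl = contradiction (triangle-unique m₃m₄ (s xm₃) m₄e (s ym₃) (s ym₄)) x≢y
    a~ e m₄e e≢y e≢m₃ | z , m₁z , ez | there (there (here refl)) with around-x e (s ez)
    ...     | here refl = contradiction m₄e m₄≁m₁
    ...     | there (here refl) = contradiction refl e≢m₃
    ...     | there (there (here refl)) = contradiction (sym (exceptional-unique y e≢y x≢y
                (two⇒≤count (common? H a y) m₁≢m₄ (s m₁a , ym₁) (s m₄e , ym₄)) 2≤x)) (~⇒≢ H xa)
    ...     | there (there (there (here refl))) = contradiction (triangle-unique m₃m₄ m₃d m₄e (s ym₃) (s ym₄)) e≢y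
    a~ e m₄e e≢y e≢m₃ | z , m₁z , ez | there (there (there (here refl))) = s ez
    clash : ⊥
    clash with <count⇒∃∉ (Graph._~?_ H m₄) (y ∷ m₃ ∷ []) (subst (2 <_) (sym (deg-H≡4 m₄)) (s≤s (s≤s (s≤s z≤n))))
    ... | e , m₄e , e∉ with common-H m₄ e
    ...   | e′ , m₄e′ , ee′ = m₄≁m₁ (subst (λ v → H ⊢ v ~ m₁) (triangle-unique ee′ (s ae) (s ae′) (s m₄e) (s m₄e′)) (s m₁a))
      where
      e≢y : e ≢ y
      e≢y = e∉ ∘ here
      e≢m₃ : e ≢ m₃
      e≢m₃ = e∉ ∘ there ∘ here
      ae : H ⊢ a ~ e
      ae = a~ e m₄e e≢y e≢m₃
      ae′ : H ⊢ a ~ e′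
      ae′ = a~ e′ m₄e′ (λ { refl → e≢m₃ (triangle-unique ym₄ (s ee′) m₄e ym₃ (s m₃m₄)) })
                        (λ { refl → e≢y (triangle-unique m₃m₄ (s ee′) m₄e (s ym₃) (s ym₄)) })

-- γ(G) = γ(H) = 3

module Order9 {n : ℕ} (n≡ : n ≡ 9) {G H : Graph n} (co : Complementary G H) (v₀ : Fin n)
              (¬domG : ¬ Dom G 2) (¬domH : ¬ Dom H 2) where

  private
    s : ∀ {u v} → G ⊢ u ~ v → G ⊢ v ~ u
    s = ~-sym G
    oc : Complementary H G
    oc = complementary-sym co
    irr : ∀ {u} → ¬ G ⊢ u ~ u
    irr = ~-irrefl G refl
    irrH : ∀ {u} → ¬ H ⊢ u ~ u
    irrH = ~-irrefl H refl

  opaque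
    deg-G≤5 : ∀ v → deg G v ≤ 5
    deg-G≤5 v = deg-upper {r = 0} {0} co v ¬domG ¬domH n≡ v

    deg-G≥3 : ∀ v → 3 ≤ deg G v
    deg-G≥3 v = deg-lower co v 1 ¬domH ¬domG v

    common-G : ∀ u v → ∃ λ w → G ⊢ u ~ w × G ⊢ v ~ w
    common-G u v = ≥1-witness (common? G u v) (cn-lower co u 0 ¬domH ¬domG u v)

    common-H : ∀ u v → ∃ λ w → H ⊢ u ~ w × H ⊢ v ~ w
    common-H u v = ≥1-witness (common? H u v) (cn-lower oc u 0 ¬domG ¬domH u v)

    order : count {n} {const Unit} (λ _ → yes tt) ≡ 9
    order = trans (sum-const n 1) (trans (ℕ.*-identityʳ n) n≡)

  -- A vertex y of degree 3 with neighbours a, b, d, where b is adjacent to a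
  -- and d.  Each of a, b, d has a private neighbour (q, p and r), and each of
  -- these shares a further neighbour (q₂, p₂ and r₂) with a, b and d.
  module Claw {y a b d : Fin n} (ya : G ⊢ y ~ a) (yb : G ⊢ y ~ b) (yd : G ⊢ y ~ d) (a≢d : a ≢ d)
              (ab : G ⊢ a ~ b) (bd : G ⊢ b ~ d) (only : ∀ x → G ⊢ y ~ x → x ∈ᵥ (a ∷ b ∷ d ∷ [])) where

    far : ∀ {x} → x ≢ a → x ≢ b → x ≢ d → ¬ G ⊢ y ~ x
    far x≢a x≢b x≢d yx with only _ yx
    ... | here e = x≢a e
    ... | there (here e) = x≢b e
    ... | there (there (here e)) = x≢d e

    -- The common neighbour of `y` and `x` is one of `a`, `b`, `d`, and the hypotheses exclude two
    -- of them.
    via-a : ∀ {x} → H ⊢ b ~ x → H ⊢ d ~ x → G ⊢ a ~ x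
    via-a {x} bx dx with common-G y x
    ... | z , yz , xz with only z yz
    ...   | here refl = s xz
    ...   | there (here refl) = contradiction bx (disjoint co (s xz))
    ...   | there (there (here refl)) = contradiction dx (disjoint co (s xz))

    via-b : ∀ {x} → H ⊢ a ~ x → H ⊢ d ~ x → G ⊢ b ~ x
    via-b {x} ax dx with common-G y x
    ... | z , yz , xz with only z yz
    ...   | here refl = contradiction ax (disjoint co (s xz))
    ...   | there (here refl) = s xz
    ...   | there (there (here refl)) = contradiction dx (disjoint co (s xz))

    via-d : ∀ {x} → H ⊢ a ~ x → H ⊢ b ~ x → G ⊢ d ~ x
    via-d {x} ax bx with common-G y x
    ... | z , yz , xz with only z yz
    ...   | here refl = contradiction ax (disjoint co (s xz))
    ...   | there (here refl) = contradiction bx (disjoint co (s xz))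
    ...   | there (there (here refl)) = s xz

    clash : ∀ {u v} → G ⊢ u ~ v → H ⊢ u ~ v → ⊥
    clash = disjoint co

    module _ {p q r p₂ q₂ r₂ : Fin n}
             (ap : H ⊢ a ~ p) (dp : H ⊢ d ~ p) (bp : G ⊢ b ~ p)
             (bq : H ⊢ b ~ q) (dq : H ⊢ d ~ q) (aq : G ⊢ a ~ q)
             (ar : H ⊢ a ~ r) (br : H ⊢ b ~ r) (dr : G ⊢ d ~ r)
             (bp₂ : G ⊢ b ~ p₂) (pp₂ : G ⊢ p ~ p₂)
             (aq₂ : G ⊢ a ~ q₂) (qq₂ : G ⊢ q ~ q₂)
             (dr₂ : G ⊢ d ~ r₂) (rr₂ : G ⊢ r ~ r₂) where

      private
        ¬yp : ¬ G ⊢ y ~ p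
        ¬yp = far (λ { refl → irrH ap }) (λ { refl → irr bp }) (λ { refl → irrH dp })
        ¬yq : ¬ G ⊢ y ~ q
        ¬yq = far (λ { refl → irr aq }) (λ { refl → irrH bq }) (λ { refl → irrH dq })
        ¬yr : ¬ G ⊢ y ~ r
        ¬yr = far (λ { refl → irrH ar }) (λ { refl → irrH br }) (λ { refl → irr dr })

        eight : Unique (y ∷ a ∷ b ∷ d ∷ p ∷ p₂ ∷ q ∷ r ∷ [])
        eight = (~⇒≢ G ya ∷ ~⇒≢ G yb ∷ ~⇒≢ G yd ∷ (λ { refl → clash (s ya) ap }) ∷ (λ { refl → ¬yp (s pp₂) })
                  ∷ (λ { refl → clash (s yb) bq }) ∷ (λ { refl → clash (s yb) br }) ∷ [])
              ∷ (~⇒≢ G ab ∷ a≢d ∷ ~⇒≢ H ap ∷ (λ { refl → clash (s pp₂) ap }) ∷ ~⇒≢ G aq ∷ ~⇒≢ H ar ∷ [])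
              ∷ (~⇒≢ G bd ∷ ~⇒≢ G bp ∷ ~⇒≢ G bp₂ ∷ ~⇒≢ H bq ∷ ~⇒≢ H br ∷ [])
              ∷ (~⇒≢ H dp ∷ (λ { refl → clash (s pp₂) dp }) ∷ ~⇒≢ H dq ∷ ~⇒≢ G dr ∷ [])
              ∷ (~⇒≢ G pp₂ ∷ (λ { refl → clash bp bq }) ∷ (λ { refl → clash bp br }) ∷ [])
              ∷ ((λ { refl → clash bp₂ bq }) ∷ (λ { refl → clash bp₂ br }) ∷ [])
              ∷ ((λ { refl → clash aq ar }) ∷ [])
              ∷ [] ∷ []

        fresh⇒unique : ∀ {t} → t ∉ᵥ (y ∷ a ∷ b ∷ d ∷ p ∷ p₂ ∷ q ∷ r ∷ []) → Unique (t ∷ y ∷ a ∷ b ∷ d ∷ p ∷ p₂ ∷ q ∷ r ∷ [])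
        fresh⇒unique t∉ = fresh _ t∉ ∷ eight

      module _ {t : Fin n} (all : ∀ v → v ∈ᵥ (t ∷ y ∷ a ∷ b ∷ d ∷ p ∷ p₂ ∷ q ∷ r ∷ [])) where

        q₂-place : q₂ ≡ t ⊎ q₂ ≡ p₂
        -- The nine vertices in turn: only `t` and `p₂` can be adjacent to both `a` and `q`.
        q₂-place = All.lookup {P = λ v → G ⊢ a ~ v → G ⊢ q ~ v → v ≡ t ⊎ v ≡ p₂}
          ( (λ _ _ → inj₁ refl)
          ∷ (λ _ qy → contradiction (s qy) ¬yq)
          ∷ (λ aa _ → contradiction aa irr)
          ∷ (λ _ qb → contradiction bq (clash (s qb)))
          ∷ (λ _ qd → contradiction dq (clash (s qd)))
          ∷ (λ ap′ _ → contradiction ap (clash ap′))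
          ∷ (λ _ _ → inj₂ refl)
          ∷ (λ _ qq → contradiction qq irr)
          ∷ (λ ar′ _ → contradiction ar (clash ar′))
          ∷ []) (all q₂) aq₂ qq₂

        r₂-place : r₂ ≡ t ⊎ r₂ ≡ p₂
        r₂-place = All.lookup {P = λ v → G ⊢ d ~ v → G ⊢ r ~ v → v ≡ t ⊎ v ≡ p₂}
          ( (λ _ _ → inj₁ refl)
          ∷ (λ _ ry → contradiction (s ry) ¬yr)
          ∷ (λ _ ra → contradiction ar (clash (s ra)))
          ∷ (λ _ rb → contradiction br (clash (s rb)))
          ∷ (λ dd _ → contradiction dd irr)
          ∷ (λ dp′ _ → contradiction dp (clash dp′))
          ∷ (λ _ _ → inj₂ refl)
          ∷ (λ dq′ _ → contradiction dq (clash dq′))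
          ∷ (λ _ rr → contradiction rr irr)
          ∷ []) (all r₂) dr₂ rr₂

        -- A pair without a common `H`-neighbour would dominate `G`; the list gives one refutation
        -- for each of the nine vertices.
        no-dominating-pair : ∀ u v → ¬ All (λ w → H ⊢ u ~ w → H ⊢ v ~ w → ⊥) (t ∷ y ∷ a ∷ b ∷ d ∷ p ∷ p₂ ∷ q ∷ r ∷ [])
        no-dominating-pair u v none with common-H u v
        ... | w , uw , vw = All.lookup none (all w) uw vw

        ¬qr-t : G ⊢ q ~ t → G ⊢ r ~ t → ⊥
        ¬qr-t qt rt = no-dominating-pair b t
          ( (λ _ → irrH) ∷ (λ h _ → clash (s yb) h) ∷ (λ h _ → clash (s ab) h) ∷ (λ h _ → irrH h) ∷ (λ h _ → clash bd h)
          ∷ (λ h _ → clash bp h) ∷ (λ h _ → clash bp₂ h) ∷ (λ _ → clash (s qt)) ∷ (λ _ → clash (s rt)) ∷ [])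

        ¬aq-p₂ : G ⊢ a ~ p₂ → G ⊢ q ~ p₂ → G ⊢ d ~ t → ⊥
        ¬aq-p₂ ap₂ qp₂ dt = no-dominating-pair d p₂
          ( (λ h _ → clash dt h) ∷ (λ h _ → clash (s yd) h) ∷ (λ _ → clash (s ap₂)) ∷ (λ h _ → clash (s bd) h) ∷ (λ h _ → irrH h)
          ∷ (λ _ → clash (s pp₂)) ∷ (λ _ → irrH) ∷ (λ _ → clash (s qp₂)) ∷ (λ h _ → clash dr h) ∷ [])

        ¬dr-p₂ : G ⊢ d ~ p₂ → G ⊢ r ~ p₂ → G ⊢ a ~ t → ⊥
        ¬dr-p₂ dp₂ rp₂ at = no-dominating-pair a p₂
          ( (λ h _ → clash at h) ∷ (λ h _ → clash (s ya) h) ∷ (λ h _ → irrH h) ∷ (λ h _ → clash ab h) ∷ (λ _ → clash (s dp₂))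
          ∷ (λ _ → clash (s pp₂)) ∷ (λ _ → irrH) ∷ (λ h _ → clash aq h) ∷ (λ _ → clash (s rp₂)) ∷ [])

        degree-6 : G ⊢ a ~ p₂ → G ⊢ q ~ p₂ → G ⊢ d ~ p₂ → G ⊢ r ~ p₂ → 6 ≤ deg G p₂
        degree-6 ap₂ qp₂ dp₂ rp₂ = unique⇒≤count (Graph._~?_ G p₂) (a ∷ b ∷ d ∷ p ∷ q ∷ r ∷ [])
          ( (~⇒≢ G ab ∷ a≢d ∷ ~⇒≢ H ap ∷ ~⇒≢ G aq ∷ ~⇒≢ H ar ∷ [])
          ∷ (~⇒≢ G bd ∷ ~⇒≢ G bp ∷ ~⇒≢ H bq ∷ ~⇒≢ H br ∷ [])
          ∷ (~⇒≢ H dp ∷ ~⇒≢ H dq ∷ ~⇒≢ G dr ∷ [])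
          ∷ ((λ { refl → clash bp bq }) ∷ (λ { refl → clash bp br }) ∷ [])
          ∷ ((λ { refl → clash aq ar }) ∷ [])
          ∷ [] ∷ [])
          (s ap₂ ∷ s bp₂ ∷ s dp₂ ∷ s pp₂ ∷ s qp₂ ∷ s rp₂ ∷ [])

        -- In the first three cases `b` and `t`, `d` and `p₂`, or `a` and `p₂` would dominate `G`.
        -- In the last, `p₂` has the six neighbours `a`, `b`, `d`, `p`, `q`, `r`, one more than the
        -- degree bound permits.
        settle : q₂ ≡ t ⊎ q₂ ≡ p₂ → r₂ ≡ t ⊎ r₂ ≡ p₂ → ⊥
        settle (inj₁ refl) (inj₁ refl) = ¬qr-t qq₂ rr₂
        settle (inj₂ refl) (inj₁ refl) = ¬aq-p₂ aq₂ qq₂ dr₂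
        settle (inj₁ refl) (inj₂ refl) = ¬dr-p₂ dr₂ rr₂ aq₂
        settle (inj₂ refl) (inj₂ refl) = ℕ.<⇒≱ (degree-6 aq₂ qq₂ dr₂ rr₂) (deg-G≤5 p₂)

        impossible : ⊥
        impossible = settle q₂-place r₂-place

      no-ninth : ¬ ∃ λ t → Unit × t ∉ᵥ (y ∷ a ∷ b ∷ d ∷ p ∷ p₂ ∷ q ∷ r ∷ [])
      no-ninth (t , _ , t∉) = impossible λ v → count≤⇒∈ (λ _ → yes tt) _ (fresh⇒unique t∉)
        (tt ∷ tt ∷ tt ∷ tt ∷ tt ∷ tt ∷ tt ∷ tt ∷ tt ∷ []) (ℕ.≤-reflexive order) v tt

      absurd : ⊥
      absurd = no-ninth (<count⇒∃∉ (λ _ → yes tt) _ (ℕ.≤-reflexive (sym order)))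

    absurd′ : ⊥
    absurd′ with common-H a d | common-H b d | common-H a b
    ... | p , ap , dp | q , bq , dq | r , ar , br with common-G b p | common-G a q | common-G d r
    ...   | p₂ , bp₂ , pp₂ | q₂ , aq₂ , qq₂ | r₂ , dr₂ , rr₂ =
      absurd ap dp (via-b ap dp) bq dq (via-a bq dq) ar br (via-d ar br) bp₂ pp₂ aq₂ qq₂ dr₂ rr₂

  opaque
    -- By `common-G` each of the three neighbours of `y` is adjacent to another one, so they contain
    -- a path; its centre takes the role of `b` in `Claw`.
    no-degree-3 : ∀ y → deg G y ≢ 3
    no-degree-3 y deg-y with two-witnesses (Graph._~?_ G y) (subst (2 ≤_) (sym deg-y) (s≤s (s≤s z≤n)))
    ... | a , b , a≢b , ya , yb = third (<count⇒∃∉ (Graph._~?_ G y) (a ∷ b ∷ []) (ℕ.≤-reflexive (sym deg-y)))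
      where
      third : ¬ ∃ λ d → G ⊢ y ~ d × d ∉ᵥ (a ∷ b ∷ [])
      third (d , yd , d∉) = from-a (common-G y a)
        where
        a≢d : a ≢ d
        a≢d e = d∉ (here (sym e))
        b≢d : b ≢ d
        b≢d e = d∉ (there (here (sym e)))
        only : ∀ {u v w} → G ⊢ y ~ u → G ⊢ y ~ v → G ⊢ y ~ w → u ≢ v → u ≢ w → v ≢ w → ∀ x → G ⊢ y ~ x → x ∈ᵥ (u ∷ v ∷ w ∷ [])
        only yu yv yw u≢v u≢w v≢w = count≤⇒∈ (Graph._~?_ G y) _ ((u≢v ∷ u≢w ∷ []) ∷ (v≢w ∷ []) ∷ [] ∷ []) (yu ∷ yv ∷ yw ∷ []) (ℕ.≤-reflexive deg-y)
        centre-a : G ⊢ a ~ b → G ⊢ a ~ d → ⊥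
        centre-a ab ad = Claw.absurd′ yb ya yd b≢d (s ab) ad (only yb ya yd (≢-sym a≢b) b≢d a≢d)
        centre-b : G ⊢ a ~ b → G ⊢ b ~ d → ⊥
        centre-b ab bd = Claw.absurd′ ya yb yd a≢d ab bd (only ya yb yd a≢b a≢d b≢d)
        centre-d : G ⊢ a ~ d → G ⊢ d ~ b → ⊥
        centre-d ad db = Claw.absurd′ ya yd yb a≢b ad db (only ya yd yb a≢d a≢b (≢-sym b≢d))
        from-b : G ⊢ a ~ d → ¬ ∃ λ z → G ⊢ y ~ z × G ⊢ b ~ z
        from-b ad (z , yz , bz) with only ya yb yd a≢b a≢d b≢d z yz
        ... | here refl = centre-a (s bz) ad
        ... | there (here refl) = irr bz
        ... | there (there (here refl)) = centre-d ad (s bz)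
        from-d : G ⊢ a ~ b → ¬ ∃ λ z → G ⊢ y ~ z × G ⊢ d ~ z
        from-d ab (z , yz , dz) with only ya yb yd a≢b a≢d b≢d z yz
        ... | here refl = centre-a ab (s dz)
        ... | there (here refl) = centre-b ab (s dz)
        ... | there (there (here refl)) = irr dz
        from-a : ¬ ∃ λ z → G ⊢ y ~ z × G ⊢ a ~ z
        from-a (z , yz , az) with only ya yb yd a≢b a≢d b≢d z yz
        ... | here refl = irr az
        ... | there (here refl) = from-d az (common-G y d)
        ... | there (there (here refl)) = from-b az (common-G y b)

    deg-G≥4 : ∀ v → 4 ≤ deg G v
    deg-G≥4 v = ℕ.≤∧≢⇒< (deg-G≥3 v) (no-degree-3 v ∘ sym)

-- Recognition of K₃ □ K₃ from its strong regularity

module Grid {n : ℕ} (n≡ : n ≡ 9) {G H : Graph n} (co : Complementary G H) (v₀ : Fin n)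
            (¬domG : ¬ Dom G 2) (¬domH : ¬ Dom H 2) where

  private
    oc : Complementary H G
    oc = complementary-sym co
    s : ∀ {u v} → G ⊢ u ~ v → G ⊢ v ~ u
    s = ~-sym G
    module G₉ = Order9 n≡ co v₀ ¬domG ¬domH
    module H₉ = Order9 n≡ oc v₀ ¬domH ¬domG
    open G₉ using (common-G)

  opaque
    deg-G : ∀ v → deg G v ≡ 4
    deg-G v = ℕ.≤-antisym
      (ℕ.+-cancelʳ-≤ 5 _ _ (subst (deg G v + 5 ≤_) (trans (deg-complement co v) n≡) (ℕ.+-monoʳ-≤ (deg G v) (ℕ.+-monoˡ-≤ 1 (H₉.deg-G≥4 v)))))
      (G₉.deg-G≥4 v)

    deg-H : ∀ v → deg H v ≡ 4
    deg-H v = ℕ.+-cancelʳ-≡ 1 _ _ (ℕ.+-cancelˡ-≡ 4 _ _ (trans (cong (_+ (deg H v + 1)) (sym (deg-G v))) (trans (deg-complement co v) n≡)))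

    cn-H≥1 : ∀ u v → 1 ≤ cn H u v
    cn-H≥1 u v = cn-lower oc u 0 ¬domG ¬domH u v

    cn-nonadjacent≥2 : ∀ {u v} → H ⊢ u ~ v → 2 ≤ cn G u v
    cn-nonadjacent≥2 {u} {v} e = ℕ.+-cancelʳ-≤ 9 _ _ (begin
      11                                    ≤⟨ ℕ.+-monoʳ-≤ 8 (ℕ.+-monoˡ-≤ 2 (cn-H≥1 u v)) ⟩
      8 + (cn H u v + 2)                    ≡⟨ cong₂ (λ x y → x + y + (cn H u v + 2)) (deg-G u) (deg-G v) ⟨
      deg G u + deg G v + (cn H u v + 2)    ≡⟨ cn-nonadjacent co e ⟨
      cn G u v + n                          ≡⟨ cong (cn G u v +_) n≡ ⟩
      cn G u v + 9                          ∎)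
      where open ℕ.≤-Reasoning

    -- The lower bounds 1 for neighbours of `y`, 2 for non-neighbours and 4 for `y` add up to 9 + 4
    -- + 3 = 16 = 4 · 4, the number of walks of length two from `y`. So all are attained.
    cn-value : ∀ y u → cn G u y ≡ 1 + α H y u + 3 * δ y u
    cn-value y = sum-tight lower (ℕ.≤-reflexive (trans (degree-sum≡ G y 4 deg-G) (sym total)))
      where
      lower : ∀ u → 1 + α H y u + 3 * δ y u ≤ cn G u y
      lower u with y ≟ u
      ... | yes refl = ℕ.≤-reflexive (trans (cong (λ a → 1 + a + 3) (𝟙-no (Graph._~?_ H y y) (~-irrefl H refl))) (sym (trans (cn-diag G y) (deg-G y))))
      ... | no _ with Graph._~?_ H y u
      ...   | yes e = cn-nonadjacent≥2 (~-sym H e)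
      ...   | no  _ = cn-lower co u 0 ¬domH ¬domG u y
      total : sum (λ u → 1 + α H y u + 3 * δ y u) ≡ 16
      total = trans (sum-+δ (λ u → 1 + α H y u) y 3) (cong (_+ 3) (trans (∑-distrib-+ (const 1) (α H y))
        (cong₂ _+_ (trans (sum-const n 1) (trans (ℕ.*-identityʳ n) n≡)) (deg-H y))))

    cn-adjacent≡1 : ∀ {u v} → G ⊢ u ~ v → cn G u v ≡ 1
    cn-adjacent≡1 {u} {v} e = trans (cn-value v u) (cong₂ (λ a d → 1 + a + 3 * d)
      (𝟙-no (Graph._~?_ H v u) (disjoint co (s e))) (δ-≢ (≢-sym (~⇒≢ G e))))

    triangle-unique : ∀ {u v a b} → G ⊢ u ~ v → G ⊢ u ~ a → G ⊢ v ~ a → G ⊢ u ~ b → G ⊢ v ~ b → a ≡ b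
    triangle-unique {u} {v} uv ua va ub vb =
      count≤1⇒≡ (common? G u v) (ℕ.≤-reflexive (cn-adjacent≡1 uv)) (ua , va) (ub , vb)

    corner : ∀ y u v → u ≢ v → ¬ G ⊢ u ~ v → ∃ λ m → G ⊢ u ~ m × G ⊢ v ~ m × y ≢ m
    corner y u v u≢v u≁v with <count⇒∃∉ (common? G u v) (y ∷ []) (cn-nonadjacent≥2 (covering co u≢v u≁v))
    ... | m , (um , vm) , m∉ = m , um , vm , λ e → m∉ (here (sym e))

  -- r is joined to the fourth corners m and m′ of y, r, e and y, r, e′.
  corners-adjacent : ∀ {y r r′ e e′ m m′} → G ⊢ y ~ r → G ⊢ y ~ r′ → G ⊢ r ~ r′ → G ⊢ y ~ e → G ⊢ y ~ e′ → G ⊢ e ~ e′ →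
    ¬ G ⊢ r ~ e → ¬ G ⊢ r ~ e′ → ¬ G ⊢ r′ ~ e → ¬ G ⊢ r′ ~ e′ →
    G ⊢ r ~ m → G ⊢ e ~ m → y ≢ m → G ⊢ r ~ m′ → G ⊢ e′ ~ m′ → y ≢ m′ → G ⊢ m ~ m′
  corners-adjacent {y} {r} {r′} {e} {e′} {m} {m′} yr yr′ rr′ ye ye′ ee′ r≁e r≁e′ r′≁e r′≁e′ rm em y≢m rm′ e′m′ y≢m′
    with common-G r m
  -- `z` completes the triangle on the edge from `r` to `m`. Of the four neighbours of `r`,
  -- uniqueness of triangles excludes `y` and `r′`, and `m` is not its own neighbour, so `m′`
  -- remains.
  ... | z , rz , mz = meet (around z rz)
    where
    around : ∀ v → G ⊢ r ~ v → v ∈ᵥ (y ∷ r′ ∷ m ∷ m′ ∷ [])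
    around = count≤⇒∈ (Graph._~?_ G r) (y ∷ r′ ∷ m ∷ m′ ∷ [])
      ( (~⇒≢ G yr′ ∷ y≢m ∷ y≢m′ ∷ [])
      ∷ ((λ { refl → r′≁e (s em) }) ∷ (λ { refl → r′≁e′ (s e′m′) }) ∷ [])
      ∷ ((λ { refl → y≢m (triangle-unique ee′ (s ye) (s ye′) em e′m′) }) ∷ [])
      ∷ [] ∷ [])
      (s yr ∷ rr′ ∷ rm ∷ rm′ ∷ []) (ℕ.≤-reflexive (deg-G r))
    meet : z ∈ᵥ (y ∷ r′ ∷ m ∷ m′ ∷ []) → G ⊢ m ~ m′
    meet (here refl) = contradiction (subst (λ x → G ⊢ x ~ e) (triangle-unique yr (s mz) rm yr′ rr′) (s em)) r′≁e
    meet (there (here refl)) = contradiction (triangle-unique rr′ (s yr) (s yr′) rm (s mz)) y≢m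
    meet (there (there (here refl))) = contradiction mz (~-irrefl G refl)
    meet (there (there (there (here refl)))) = mz

  -- The two triangles through `y` become the first row and the first column of the grid; the
  -- remaining four cells are the fourth corners over them.
  module Coordinates {y a a′ b b′ : Fin n} (ya : G ⊢ y ~ a) (ya′ : G ⊢ y ~ a′) (aa′ : G ⊢ a ~ a′)
                     (yb : G ⊢ y ~ b) (yb′ : G ⊢ y ~ b′) (bb′ : G ⊢ b ~ b′) (b≢a : b ≢ a) (b≢a′ : b ≢ a′) where

    a≁b : ¬ G ⊢ a ~ b
    a≁b e = b≢a′ (triangle-unique ya yb e ya′ aa′)
    a′≁b : ¬ G ⊢ a′ ~ b
    a′≁b e = b≢a (triangle-unique ya′ yb e ya (s aa′))
    a≢b′ : a ≢ b′
    a≢b′ refl = a≁b (s bb′)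
    a′≢b′ : a′ ≢ b′
    a′≢b′ refl = a′≁b (s bb′)
    a≁b′ : ¬ G ⊢ a ~ b′
    a≁b′ e = a′≢b′ (triangle-unique ya ya′ aa′ yb′ e)
    a′≁b′ : ¬ G ⊢ a′ ~ b′
    a′≁b′ e = a≢b′ (triangle-unique ya′ ya (s aa′) yb′ e)

    module _ {m₁₁ m₁₂ m₂₁ m₂₂ : Fin n}
             (a-m₁₁ : G ⊢ a ~ m₁₁) (b-m₁₁ : G ⊢ b ~ m₁₁) (y≢m₁₁ : y ≢ m₁₁)
             (a′-m₁₂ : G ⊢ a′ ~ m₁₂) (b-m₁₂ : G ⊢ b ~ m₁₂) (y≢m₁₂ : y ≢ m₁₂)
             (a-m₂₁ : G ⊢ a ~ m₂₁) (b′-m₂₁ : G ⊢ b′ ~ m₂₁) (y≢m₂₁ : y ≢ m₂₁)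
             (a′-m₂₂ : G ⊢ a′ ~ m₂₂) (b′-m₂₂ : G ⊢ b′ ~ m₂₂) (y≢m₂₂ : y ≢ m₂₂) where

      ψ : Fin 3 → Fin 3 → Fin n
      ψ 0F 0F = y
      ψ 0F 1F = a
      ψ 0F 2F = a′
      ψ 1F 0F = b
      ψ 1F 1F = m₁₁
      ψ 1F 2F = m₁₂
      ψ 2F 0F = b′
      ψ 2F 1F = m₂₁
      ψ 2F 2F = m₂₂

      triangle : ∀ (x : Fin 3 → Fin n) → G ⊢ x 0F ~ x 1F → G ⊢ x 0F ~ x 2F → G ⊢ x 1F ~ x 2F → ∀ j j′ → j ≢ j′ → G ⊢ x j ~ x j′
      triangle x e f g 0F 0F ≢ = contradiction refl ≢
      triangle x e f g 0F 1F ≢ = e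
      triangle x e f g 0F 2F ≢ = f
      triangle x e f g 1F 0F ≢ = s e
      triangle x e f g 1F 1F ≢ = contradiction refl ≢
      triangle x e f g 1F 2F ≢ = g
      triangle x e f g 2F 0F ≢ = s f
      triangle x e f g 2F 1F ≢ = s g
      triangle x e f g 2F 2F ≢ = contradiction refl ≢

      row : ∀ i j j′ → j ≢ j′ → G ⊢ ψ i j ~ ψ i j′
      row 0F = triangle (ψ 0F) ya ya′ aa′
      row 1F = triangle (ψ 1F) b-m₁₁ b-m₁₂ (corners-adjacent yb yb′ bb′ ya ya′ aa′ (a≁b ∘ s) (a′≁b ∘ s) (a≁b′ ∘ s) (a′≁b′ ∘ s)
        b-m₁₁ a-m₁₁ y≢m₁₁ b-m₁₂ a′-m₁₂ y≢m₁₂)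
      row 2F = triangle (ψ 2F) b′-m₂₁ b′-m₂₂ (corners-adjacent yb′ yb (s bb′) ya ya′ aa′ (a≁b′ ∘ s) (a′≁b′ ∘ s) (a≁b ∘ s) (a′≁b ∘ s)
        b′-m₂₁ a-m₂₁ y≢m₂₁ b′-m₂₂ a′-m₂₂ y≢m₂₂)

      column : ∀ j i i′ → i ≢ i′ → G ⊢ ψ i j ~ ψ i′ j
      column 0F = triangle (λ i → ψ i 0F) yb yb′ bb′
      column 1F = triangle (λ i → ψ i 1F) a-m₁₁ a-m₂₁ (corners-adjacent ya ya′ aa′ yb yb′ bb′ a≁b a≁b′ a′≁b a′≁b′
        a-m₁₁ b-m₁₁ y≢m₁₁ a-m₂₁ b′-m₂₁ y≢m₂₁)
      column 2F = triangle (λ i → ψ i 2F) a′-m₁₂ a′-m₂₂ (corners-adjacent ya′ ya (s aa′) yb yb′ bb′ a′≁b a′≁b′ a≁b a≁b′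
        a′-m₁₂ b-m₁₂ y≢m₁₂ a′-m₂₂ b′-m₂₂ y≢m₂₂)

      rows₀₁ : ∀ j j′ → j ≢ j′ → ψ 0F j ≢ ψ 1F j′
      rows₀₁ 0F 1F _ = y≢m₁₁
      rows₀₁ 0F 2F _ = y≢m₁₂
      rows₀₁ 1F 0F _ = ≢-sym b≢a
      rows₀₁ 1F 2F _ refl = a≁b (s b-m₁₂)
      rows₀₁ 2F 0F _ = ≢-sym b≢a′
      rows₀₁ 2F 1F _ refl = a′≁b (s b-m₁₁)
      rows₀₁ 0F 0F j≢ = contradiction refl j≢
      rows₀₁ 1F 1F j≢ = contradiction refl j≢
      rows₀₁ 2F 2F j≢ = contradiction refl j≢

      rows₀₂ : ∀ j j′ → j ≢ j′ → ψ 0F j ≢ ψ 2F j′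
      rows₀₂ 0F 1F _ = y≢m₂₁
      rows₀₂ 0F 2F _ = y≢m₂₂
      rows₀₂ 1F 0F _ = a≢b′
      rows₀₂ 1F 2F _ refl = a≁b′ (s b′-m₂₂)
      rows₀₂ 2F 0F _ = a′≢b′
      rows₀₂ 2F 1F _ refl = a′≁b′ (s b′-m₂₁)
      rows₀₂ 0F 0F j≢ = contradiction refl j≢
      rows₀₂ 1F 1F j≢ = contradiction refl j≢
      rows₀₂ 2F 2F j≢ = contradiction refl j≢

      rows₁₂ : ∀ j j′ → j ≢ j′ → ψ 1F j ≢ ψ 2F j′
      rows₁₂ 0F 1F _ refl = a≁b a-m₂₁
      rows₁₂ 0F 2F _ refl = a′≁b a′-m₂₂
      rows₁₂ 1F 0F _ refl = a≁b′ a-m₁₁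
      rows₁₂ 1F 2F _ refl = y≢m₁₁ (triangle-unique aa′ (s ya) (s ya′) a-m₁₁ a′-m₂₂)
      rows₁₂ 2F 0F _ refl = a′≁b′ a′-m₁₂
      rows₁₂ 2F 1F _ refl = y≢m₁₂ (triangle-unique aa′ (s ya) (s ya′) a-m₂₁ a′-m₁₂)
      rows₁₂ 0F 0F j≢ = contradiction refl j≢
      rows₁₂ 1F 1F j≢ = contradiction refl j≢
      rows₁₂ 2F 2F j≢ = contradiction refl j≢

      diagonal : ∀ i j i′ j′ → i ≢ i′ → j ≢ j′ → ψ i j ≢ ψ i′ j′
      diagonal 0F j 1F j′ _ j≢ = rows₀₁ j j′ j≢
      diagonal 0F j 2F j′ _ j≢ = rows₀₂ j j′ j≢
      diagonal 1F j 2F j′ _ j≢ = rows₁₂ j j′ j≢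
      diagonal 1F j 0F j′ _ j≢ = ≢-sym (rows₀₁ j′ j (≢-sym j≢))
      diagonal 2F j 0F j′ _ j≢ = ≢-sym (rows₀₂ j′ j (≢-sym j≢))
      diagonal 2F j 1F j′ _ j≢ = ≢-sym (rows₁₂ j′ j (≢-sym j≢))
      diagonal 0F j 0F j′ i≢ _ = contradiction refl i≢
      diagonal 1F j 1F j′ i≢ _ = contradiction refl i≢
      diagonal 2F j 2F j′ i≢ _ = contradiction refl i≢

      ψ-inj : ∀ {i j i′ j′} → ψ i j ≡ ψ i′ j′ → i ≡ i′ × j ≡ j′
      ψ-inj {i} {j} {i′} {j′} e with i ≟ i′ | j ≟ j′
      ... | yes refl | yes refl = refl , refl
      ... | yes refl | no j≢j′ = contradiction e (~⇒≢ G (row i j j′ j≢j′))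
      ... | no i≢i′ | yes refl = contradiction e (~⇒≢ G (column j i i′ i≢i′))
      ... | no i≢i′ | no j≢j′ = contradiction e (diagonal i j i′ j′ i≢i′ j≢j′)

      private
        π₁ π₂ : Fin (3 * 3) → Fin 3
        π₁ x = proj₁ (remQuot {3} 3 x)
        π₂ x = proj₂ (remQuot {3} 3 x)

      φ : Fin (3 * 3) → Fin n
      φ x = ψ (π₁ x) (π₂ x)

      φ-inj : ∀ {x x′} → φ x ≡ φ x′ → x ≡ x′
      φ-inj {x} {x′} e with ψ-inj {π₁ x} {π₂ x} {π₁ x′} {π₂ x′} e
      ... | e₁ , e₂ = trans (sym (combine-remQuot {3} 3 x)) (trans (cong₂ combine e₁ e₂) (combine-remQuot {3} 3 x′))

      φ-hom : ∀ {x x′} → (K 3 □ K 3) ⊢ x ~ x′ → G ⊢ φ x ~ φ x′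
      φ-hom {x} {x′} (inj₁ (e , ≢)) = subst (λ i → G ⊢ φ x ~ ψ i (π₂ x′)) e (row (π₁ x) (π₂ x) (π₂ x′) ≢)
      φ-hom {x} {x′} (inj₂ (≢ , e)) = subst (λ j → G ⊢ φ x ~ ψ (π₁ x′) j) e (column (π₂ x) (π₁ x) (π₁ x′) ≢)

      -- The neighbours in the row and in the column already exhaust the degree 4. Hence `φ`
      -- reflects adjacency.
      around : ∀ i j v → G ⊢ ψ i j ~ v → v ∈ᵥ (ψ i (punchIn j 0F) ∷ ψ i (punchIn j 1F) ∷ ψ (punchIn i 0F) j ∷ ψ (punchIn i 1F) j ∷ [])
      around i j = count≤⇒∈ (Graph._~?_ G (ψ i j)) _
        ( ((λ e → 0≢1 (punchIn-injective j _ _ (proj₂ (ψ-inj e)))) ∷ off ∷ off ∷ [])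
        ∷ (off ∷ off ∷ [])
        ∷ ((λ e → 0≢1 (punchIn-injective i _ _ (proj₁ (ψ-inj e)))) ∷ []) ∷ [] ∷ [])
        ( row i j _ (≢-sym (punchInᵢ≢i j 0F)) ∷ row i j _ (≢-sym (punchInᵢ≢i j 1F))
        ∷ column j i _ (≢-sym (punchInᵢ≢i i 0F)) ∷ column j i _ (≢-sym (punchInᵢ≢i i 1F)) ∷ [])
        (ℕ.≤-reflexive (deg-G (ψ i j)))
        where
        0≢1 : _≢_ {A = Fin 2} 0F 1F
        0≢1 ()
        off : ∀ {k l : Fin 2} → ψ i (punchIn j k) ≢ ψ (punchIn i l) j
        off {k} {l} e = punchInᵢ≢i i l (sym (proj₁ (ψ-inj e)))

      φ-reflects : ∀ {x x′} → G ⊢ φ x ~ φ x′ → (K 3 □ K 3) ⊢ x ~ x′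
      φ-reflects {x} {x′} e = neighbour (around (π₁ x) (π₂ x) (φ x′) e)
        where
        in-row : ∀ k → φ x′ ≡ ψ (π₁ x) (punchIn (π₂ x) k) → (K 3 □ K 3) ⊢ x ~ x′
        in-row k eq with ψ-inj {π₁ x′} {π₂ x′} eq
        ... | e₁ , e₂ = inj₁ (sym e₁ , λ e → punchInᵢ≢i (π₂ x) k (trans (sym e₂) (sym e)))
        in-column : ∀ k → φ x′ ≡ ψ (punchIn (π₁ x) k) (π₂ x) → (K 3 □ K 3) ⊢ x ~ x′
        in-column k eq with ψ-inj {π₁ x′} {π₂ x′} eq
        ... | e₁ , e₂ = inj₂ ((λ e → punchInᵢ≢i (π₁ x) k (trans (sym e₁) (sym e))) , sym e₂)
        neighbour : φ x′ ∈ᵥ (ψ (π₁ x) (punchIn (π₂ x) 0F) ∷ ψ (π₁ x) (punchIn (π₂ x) 1F)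
                             ∷ ψ (punchIn (π₁ x) 0F) (π₂ x) ∷ ψ (punchIn (π₁ x) 1F) (π₂ x) ∷ []) → (K 3 □ K 3) ⊢ x ~ x′
        neighbour (here eq)                         = in-row 0F eq
        neighbour (there (here eq))                 = in-row 1F eq
        neighbour (there (there (here eq)))         = in-column 0F eq
        neighbour (there (there (there (here eq)))) = in-column 1F eq

      φ-surj : ∀ v → ∃ λ x → φ x ≡ v
      φ-surj v = decidable-stable (any? λ x → φ x ≟ v) λ missed →
        ℕ.<⇒≱ (ℕ.n<1+n 9) (subst (10 ≤_) n≡ (injective⇒≤ {f = f} λ {x} {x′} → f-inj missed x x′))
        where
        f : Fin 10 → Fin n
        f zero = v
        f (suc x) = φ x
        f-inj : ¬ (∃ λ x → φ x ≡ v) → ∀ x x′ → f x ≡ f x′ → x ≡ x′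
        f-inj missed zero zero e = refl
        f-inj missed zero (suc x′) e = contradiction (x′ , sym e) missed
        f-inj missed (suc x) zero e = contradiction (x , e) missed
        f-inj missed (suc x) (suc x′) e = cong suc (φ-inj e)

      grid : G ≅ K 3 □ K 3
      grid = mk↔ₛ′ (proj₁ ∘ φ-surj) φ (λ x → φ-inj (proj₂ (φ-surj (φ x)))) (proj₂ ∘ φ-surj) , λ u v → mk⇔
        (λ e → φ-reflects {proj₁ (φ-surj u)} {proj₁ (φ-surj v)} (subst₂ (λ x x′ → G ⊢ x ~ x′) (sym (proj₂ (φ-surj u))) (sym (proj₂ (φ-surj v))) e))
        (λ e → subst₂ (λ x x′ → G ⊢ x ~ x′) (proj₂ (φ-surj u)) (proj₂ (φ-surj v)) (φ-hom {proj₁ (φ-surj u)} {proj₁ (φ-surj v)} e))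

  isomorphic : G ≅ K 3 □ K 3
  -- The repeated argument merely yields some neighbour of `v₀`; the next call completes it to a
  -- triangle.
  isomorphic with common-G v₀ v₀
  ... | a , ya , _ with common-G v₀ a
  ...   | a′ , ya′ , aa′ with <count⇒∃∉ (Graph._~?_ G v₀) (a ∷ a′ ∷ []) (subst (2 <_) (sym (deg-G v₀)) (s≤s (s≤s (s≤s z≤n))))
  ...     | b , yb , b∉ with common-G v₀ b
  ...       | b′ , yb′ , bb′ = grid′
    where
    open Coordinates ya ya′ aa′ yb yb′ bb′ (b∉ ∘ here) (b∉ ∘ there ∘ here)
    grid′ : G ≅ K 3 □ K 3
    grid′ with corner v₀ a b (≢-sym (b∉ ∘ here)) a≁b | corner v₀ a′ b (≢-sym (b∉ ∘ there ∘ here)) a′≁b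
             | corner v₀ a b′ a≢b′ a≁b′ | corner v₀ a′ b′ a′≢b′ a′≁b′
    ... | _ , am , bm , ym | _ , am′ , bm′ , ym′ | _ , am″ , bm″ , ym″ | _ , am‴ , bm‴ , ym‴ =
      grid am bm ym am′ bm′ ym′ am″ bm″ ym″ am‴ bm‴ ym‴

-- The grid K₃ □ K₃

-- Two conditions decidable by evaluation that exclude weights `k * (1 + t)` below 6 once n ≥ 6: no
-- two vertices dominate, and no vertex forces anything outside the closed neighbourhood of a single
-- starting vertex.
Unobservable : ∀ {n} → Graph n → Set
Unobservable G =
    (∀ u v → ∃ λ w → ¬ StayOrMove G u w × ¬ StayOrMove G v w)
  × (∀ v x w → G ⊢ v ~ x → G ⊢ x ~ w → ¬ StayOrMove G v w →
      ∃ λ w′ → w′ ≢ w × G ⊢ x ~ w′ × ¬ StayOrMove G v w′)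

unobservable? : ∀ {n} (G : Graph n) → Dec (Unobservable G)
unobservable? G =
  (all? λ u → all? λ v → any? λ w → ¬? (stayOrMove? G u w) ×-dec ¬? (stayOrMove? G v w))
  ×-dec (all? λ v → all? λ x → all? λ w → Graph._~?_ G v x →-dec (Graph._~?_ G x w →-dec
    (¬? (stayOrMove? G v w) →-dec any? λ w′ → ¬? (w′ ≟ w) ×-dec Graph._~?_ G x w′ ×-dec ¬? (stayOrMove? G v w′))))

opaque
  K₃□K₃-unobservable : Unobservable (K 3 □ K 3)
  K₃□K₃-unobservable = from-yes (unobservable? (K 3 □ K 3))

  ∁K₃□K₃-unobservable : Unobservable (∁ (K 3 □ K 3))
  ∁K₃□K₃-unobservable = from-yes (unobservable? (∁ (K 3 □ K 3)))

∁-≅ : ∀ {m n} {G : Graph m} {H : Graph n} → G ≅ H → ∁ G ≅ ∁ H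
∁-≅ {G = G} {H} (f , iso) = f , λ u v → mk⇔
  (λ (u≢v , u≁v) → (λ e → u≢v (Injection.injective (↔⇒↣ f) e)) , λ e → u≁v (Equivalence.from (iso u v) e))
  (λ (u≢v , u≁v) → (λ e → u≢v (cong (Inverse.to f) e)) , λ e → u≁v (Equivalence.to (iso u v) e))

unobservable-≅ : ∀ {m n} {G : Graph m} {H : Graph n} → G ≅ H → Unobservable H → Unobservable G
unobservable-≅ {m} {n} {G} {H} (f , iso) (undominated , stuck) = undominated′ , stuck′
  where
  open Inverse f using (to; from; strictlyInverseˡ)
  to~ : ∀ {u v} → G ⊢ u ~ v → H ⊢ to u ~ to v
  to~ {u} {v} = Equivalence.to (iso u v)
  from~ : ∀ {u v} → H ⊢ to u ~ v → G ⊢ u ~ from v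
  from~ {u} {v} e = Equivalence.from (iso u (from v)) (subst (λ x → H ⊢ to u ~ x) (sym (strictlyInverseˡ v)) e)
  near : ∀ {u v} → StayOrMove G u (from v) → StayOrMove H (to u) v
  near {u} {v} (inj₁ refl) = inj₁ (strictlyInverseˡ v)
  near {u} {v} (inj₂ e)    = inj₂ (subst (λ x → H ⊢ to u ~ x) (strictlyInverseˡ v) (to~ e))
  far : ∀ {u v} → ¬ StayOrMove G u v → ¬ StayOrMove H (to u) (to v)
  far u≁v (inj₁ e) = u≁v (inj₁ (Injection.injective (↔⇒↣ f) e))
  far u≁v (inj₂ e) = u≁v (inj₂ (Equivalence.from (iso _ _) e))
  undominated′ : ∀ u v → ∃ λ w → ¬ StayOrMove G u w × ¬ StayOrMove G v w
  undominated′ u v with undominated (to u) (to v)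
  ... | w , ¬u , ¬v = from w , ¬u ∘ near , ¬v ∘ near
  stuck′ : ∀ v x w → G ⊢ v ~ x → G ⊢ x ~ w → ¬ StayOrMove G v w →
           ∃ λ w′ → w′ ≢ w × G ⊢ x ~ w′ × ¬ StayOrMove G v w′
  stuck′ v x w vx xw v≁w with stuck (to v) (to x) (to w) (to~ vx) (to~ xw) (far v≁w)
  ... | w′ , w′≢w , xw′ , v≁w′ = from w′ , (λ { refl → w′≢w (sym (strictlyInverseˡ w′)) }) , from~ xw′ , v≁w′ ∘ near

module _ {n : ℕ} {G : Graph n} (unobservable : Unobservable G) where

  private
    undominated = proj₁ unobservable
    stuck = proj₂ unobservable

  unobservable⇒¬dom₂ : ¬ Dom G 2
  unobservable⇒¬dom₂ (D , dom) with undominated (D zero) (D (suc zero))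
  ... | w , ¬0 , ¬1 with dom w
  ...   | zero     , near = ¬0 near
  ...   | suc zero , near = ¬1 near

  -- If `w` were outside the closed neighbourhood of `v`, the forcing vertex `x` would be a
  -- neighbour of `v`, and `stuck` gives it a second unobserved neighbour.
  forced⊆ : ∀ {S : Pred (Fin n) 0ℓ} {v} → (∀ w → S w → StayOrMove G v w) → ∀ w → Force G S w → StayOrMove G v w
  forced⊆ S⊆ w (inj₁ o) = S⊆ w o
  forced⊆ {v = v} S⊆ w (inj₂ (_ , x , ox , xw , forces)) =
    decidable-stable (stayOrMove? G v w) λ v≁w → conclude v≁w (S⊆ x ox)
    where
    conclude : ¬ StayOrMove G v w → ¬ StayOrMove G v x
    conclude v≁w (inj₁ refl) = v≁w (inj₂ xw)
    conclude v≁w (inj₂ vx) with stuck v x w vx xw v≁w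
    ... | w′ , w′≢w , xw′ , v≁w′ = w′≢w (forces w′ xw′ (v≁w′ ∘ S⊆ w′))

  observed⊆ : ∀ {B : Subset n} {v} → (∀ x → x ∈ B → x ≡ v) → ∀ t w → Observed G B t w → StayOrMove G v w
  observed⊆ only 0 w w∈B = inj₁ (sym (only w w∈B))
  observed⊆ only 1 w (inj₁ w∈B) = inj₁ (sym (only w w∈B))
  observed⊆ only 1 w (inj₂ (x , x∈B , e)) = inj₂ (subst (λ y → G ⊢ y ~ w) (only x x∈B) e)
  observed⊆ only (suc (suc t)) w o = forced⊆ (observed⊆ only (suc t)) w o

  ¬achieves-1 : ∀ {t} → ¬ Achieves γP G 1 t
  ¬achieves-1 {t} (B , ∣B∣≡1 , obs) = escape (undominated v v)
    where
    open Enumeration (subst (Enumeration (_∈ B)) ∣B∣≡1 (members B))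
    v : Fin n
    v = at zero
    only : ∀ x → x ∈ B → x ≡ v
    only x x∈B with index x∈B in eq
    ... | zero = trans (sym (at-index x∈B)) (cong at eq)
    escape : ¬ ∃ λ w → ¬ StayOrMove G v w × ¬ StayOrMove G v w
    escape (w , v≁w , _) = v≁w (observed⊆ only t w (obs w))

  unobservable-lower : 6 ≤ n → ∀ {k t} → 1 ≤ k → Achieves γP G k t → 6 ≤ k * (1 + t)
  unobservable-lower 6≤n {k} {zero} 1≤k ach = ℕ.≤-trans 6≤n (ℕ.≤-trans (achieves₀ γP G ach) (ℕ.m≤m*n k 1))
  unobservable-lower 6≤n {1} {suc t} 1≤k ach = contradiction ach (¬achieves-1 {suc t})
  unobservable-lower 6≤n {2} {1} 1≤k ach = contradiction (achieves₁ γP G ach) unobservable⇒¬dom₂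
  unobservable-lower 6≤n {2} {suc (suc t)} 1≤k ach = ℕ.*-monoʳ-≤ 2 (ℕ.m≤m+n 3 t)
  unobservable-lower 6≤n {suc (suc (suc k))} {suc t} 1≤k ach = ℕ.*-mono-≤ (ℕ.m≤m+n 3 k) (ℕ.m≤m+n 2 t)

-- The multiplicative bounds for power domination

-- Since (g - 2)(h - 2) ≥ 1.
2[g+h]≤n+3 : ∀ {g h n} → 3 ≤ g → 3 ≤ h → g * h ≤ n → g * 2 + h * 2 ≤ n + 3
2[g+h]≤n+3 {suc (suc (suc i))} {suc (suc (suc j))} {n} (s≤s (s≤s (s≤s _))) (s≤s (s≤s (s≤s _))) gh≤n = begin
  (3 + i) * 2 + (3 + j) * 2                     ≤⟨ ℕ.m≤m+n _ (i * j + i + j) ⟩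
  (3 + i) * 2 + (3 + j) * 2 + (i * j + i + j)   ≡⟨ identity i j ⟩
  (3 + i) * (3 + j) + 3                         ≤⟨ ℕ.+-monoˡ-≤ 3 gh≤n ⟩
  n + 3                                         ∎
  where
  open ℕ.≤-Reasoning
  identity : ∀ i j → (3 + i) * 2 + (3 + j) * 2 + (i * j + i + j) ≡ (3 + i) * (3 + j) + 3
  identity = solve-∀

module _ {n : ℕ} (5≤n : 5 ≤ n) where

  -- The bound n + 4 could be reached only for n = 2 h. There one value drops: either `a` to 3, or
  -- `b` to at most 3 k, which is less than 4 k ≤ n.
  half-case : ∀ {G H : Graph n} → Complementary G H → Fin n → ∀ {h a b} →
    IsMinimum _≤_ (Dom G) 2 → IsMinimum _≤_ (Dom H) h → 2 * h ≤ n → 2 ≤ h →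
    Lower multiplicative γP G a → Lower multiplicative γP H b → a ≤ 4 → b ≤ h * 2 → a + b ≤ n + 3
  half-case co v₀ {h} {a} {b} γG γH 2h≤n 2≤h lowA lowB a≤4 b≤2h with n ℕ.≟ h * 2
  ... | no n≢2h = subst (a + b ≤_) (ℕ.+-comm 3 n) (ℕ.≤-trans (ℕ.+-mono-≤ a≤4 b≤2h) (ℕ.+-monoʳ-≤ 3
          (ℕ.≤∧≢⇒< (subst (_≤ n) (ℕ.*-comm 2 h) 2h≤n) (≢-sym n≢2h))))
  ... | yes n≡2h with half-order co v₀ 2≤h γG γH n≡2h
  ...   | inj₁ ach = subst₂ (λ x y → a + b ≤ x) (trans (cong (3 +_) (sym n≡2h)) (ℕ.+-comm 3 n)) (refl {x = a})
          (ℕ.+-mono-≤ (lowA 1 2 ℕ.≤-refl (ℕ.≤-trans (s≤s z≤n) 5≤n) ach) b≤2h)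
  ...   | inj₂ (k , 1≤k , 4k≤n , ach) = subst (a + b ≤_) (ℕ.+-comm 3 n) (ℕ.≤-trans (ℕ.+-monoˡ-≤ b a≤4) (ℕ.+-monoʳ-≤ 3 (begin-strict
          b                      ≤⟨ lowB k 2 1≤k (ℕ.≤-trans (ℕ.m≤m+n k _) 4k≤n) ach ⟩
          k * 3                  ≡⟨ identity k ⟩
          k + (k + k)            <⟨ ℕ.m<n+m _ 1≤k ⟩
          k + (k + (k + k))      ≤⟨ 4k≤n ⟩
          n                      ∎)))
    where
    open ℕ.≤-Reasoning
    identity : ∀ k → k * 3 ≡ k + (k + k)
    identity = solve-∀

  power-sum : ∀ {G H : Graph n} → Complementary G H → Fin n → ∀ {g h a b} →
    IsMinimum _≤_ (Dom G) g → IsMinimum _≤_ (Dom H) h →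
    Lower multiplicative γP G a → Lower multiplicative γP H b →
    a ≤ g * 2 → b ≤ h * 2 → a ≤ n → b ≤ n → a + b ≤ n + 3
  power-sum {G} {H} co v₀ {g} {h} {a} {b} γG γH lowA lowB a≤ b≤ a≤n b≤n
    with split 5≤n (jaeger-payan co γG γH) (dominationNumber≥1 G v₀ γG) (dominationNumber≥1 H v₀ γH)
  ... | left refl  = subst (a + b ≤_) (ℕ.+-comm 3 n) (ℕ.+-mono-≤ (ℕ.≤-trans a≤ (ℕ.n≤1+n 2)) b≤n)
  ... | right refl = ℕ.+-mono-≤ a≤n (ℕ.≤-trans b≤ (ℕ.n≤1+n 2))
  ... | both 2≤g 2≤h with g ℕ.≟ 2 | h ℕ.≟ 2
  ...   | yes refl | _ = half-case co v₀ γG γH (jaeger-payan co γG γH) 2≤h lowA lowB a≤ b≤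
  ...   | no _ | yes refl = subst (_≤ n + 3) (ℕ.+-comm b a) (half-case (complementary-sym co) v₀ γH γG
            (jaeger-payan (complementary-sym co) γH γG) 2≤g lowB lowA b≤ a≤)
  ...   | no g≢2 | no h≢2 = ℕ.≤-trans (ℕ.+-mono-≤ a≤ b≤)
            (2[g+h]≤n+3 (ℕ.≤∧≢⇒< 2≤g (≢-sym g≢2)) (ℕ.≤∧≢⇒< 2≤h (≢-sym h≢2)) (jaeger-payan co γG γH))

*-factors : ∀ {a b A B} → a ≤ A → b ≤ B → 1 ≤ B → A * B ≤ a * b → a ≡ A
*-factors {a} {b} {A} {suc B} a≤A b≤B _ AB≤ab with a ℕ.≟ A
... | yes e = e
... | no a≢A = contradiction (ℕ.≤-trans AB≤ab (ℕ.*-monoʳ-≤ a b≤B)) (ℕ.<⇒≱ (ℕ.*-monoˡ-< (suc B) (ℕ.≤∧≢⇒< a≤A a≢A)))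

balanced⇒grid : ∀ {n} {G H : Graph n} → Complementary G H → Fin n → ∀ i r → n ≡ (3 + i) * (3 + r) →
                ¬ Dom G (2 + i) → ¬ Dom H (2 + r) → G ≅ K 3 □ K 3
balanced⇒grid {n} {G} {H} co v₀ i r n≡ ¬domG ¬domH = decide (ℕ.≤-total i r)
  where
  oc : Complementary H G
  oc = complementary-sym co
  cases : ∀ i r → n ≡ (3 + i) * (3 + r) → ¬ Dom G (2 + i) → ¬ Dom H (2 + r) →
          (i ≡ 0 × r < 3) ⊎ (r ≡ 0 × i < 3) → G ≅ K 3 □ K 3
  cases 0 0 n≡ ¬G ¬H _ = Grid.isomorphic n≡ co v₀ ¬G ¬H
  cases 0 1 n≡ ¬G ¬H _ = contradiction (Order12.impossible n≡ v₀ co ¬G ¬H) λ ()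
  cases 0 2 n≡ ¬G ¬H _ = contradiction (no-order-15 n≡ co v₀ ¬G ¬H) λ ()
  cases 1 0 n≡ ¬G ¬H _ = contradiction (Order12.impossible n≡ v₀ oc ¬H ¬G) λ ()
  cases 2 0 n≡ ¬G ¬H _ = contradiction (no-order-15 n≡ oc v₀ ¬H ¬G) λ ()
  cases 0 (suc (suc (suc r))) _ _ _ (inj₁ (_ , s≤s (s≤s (s≤s ()))))
  cases (suc (suc (suc i))) 0 _ _ _ (inj₂ (_ , s≤s (s≤s (s≤s ()))))
  cases 0 (suc (suc (suc r))) _ _ _ (inj₂ (() , _))
  cases (suc i) (suc r) _ _ _ (inj₁ (() , _))
  cases (suc i) (suc r) _ _ _ (inj₂ (() , _))
  cases (suc (suc (suc i))) 0 _ _ _ (inj₁ (() , _))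
  decide : i ≤ r ⊎ r ≤ i → G ≅ K 3 □ K 3
  decide (inj₁ i≤r) = cases i r n≡ ¬domG ¬domH (inj₁ (few-orders co v₀ ¬domG ¬domH n≡ i≤r))
  decide (inj₂ r≤i) = cases i r n≡ ¬domG ¬domH (inj₂ (few-orders oc v₀ ¬domH ¬domG (trans n≡ (ℕ.*-comm (3 + i) (3 + r))) r≤i))

module _ {n : ℕ} (5≤n : 5 ≤ n) {G H : Graph n} (co : Complementary G H) (v₀ : Fin n)
         {g h : ℕ} (γG : IsMinimum _≤_ (Dom G) g) (γH : IsMinimum _≤_ (Dom H) h) where

  private
    oc : Complementary H G
    oc = complementary-sym co
    gh≤n : g * h ≤ n
    gh≤n = jaeger-payan co γG γH
    1≤g : 1 ≤ g
    1≤g = dominationNumber≥1 G v₀ γG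
    1≤h : 1 ≤ h
    1≤h = dominationNumber≥1 H v₀ γH

  power-bounds : Both (Th× γP) G H (λ a b → (6 ≤ a + b × a + b ≤ n + 3) × (8 ≤ a * b × a * b ≤ 4 * n))
  power-bounds with multiplicative-value γP G v₀ γG | multiplicative-value γP H v₀ γH
  ... | value {a} isA lowA kA _ achA refl (uA , nA) | value {b} isB lowB kB _ achB refl (uB , nB) =
    a , b , isA , isB , (proj₁ lo , power-sum 5≤n co v₀ γG γH lowA lowB uA uB nA nB) , (proj₂ lo , proj₂ up)
    where
    lo = bounds-6-8 (multiplicative-lower γP co 5≤n kA achA) (multiplicative-lower γP oc 5≤n kB achB)
      (λ d → multiplicative-lower′ γP oc 5≤n d kB achB) (λ d → multiplicative-lower′ γP co 5≤n d kA achA)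
    up = multiplicative-upper 5≤n gh≤n 1≤g 1≤h uA uB nA nB

  -- Equality holds throughout a b ≤ 2 g · 2 h ≤ 4 n, so a = 2 g and b = 2 h. A domination number 1
  -- would make one of the values 2 n, and a domination number 2 would give a + b = n + 4; both are
  -- excluded, which leaves factors of at least 3.
  extremal⇒grid : ∀ {a b} → Lower multiplicative γP G a → Lower multiplicative γP H b →
                  a ≤ g * 2 → b ≤ h * 2 → a ≤ n → b ≤ n → a * b ≡ 4 * n → G ≅ K 3 □ K 3
  extremal⇒grid {a} {b} lowA lowB a≤ b≤ a≤n b≤n ab≡4n = conclude g h gh≡n a≡ b≡ γG γH
    where
    open ℕ.≤-Reasoning
    regroup : ∀ g h → g * 2 * (h * 2) ≡ 4 * (g * h)
    regroup = solve-∀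
    n≤gh : n ≤ g * h
    n≤gh = ℕ.*-cancelˡ-≤ 4 (begin
      4 * n              ≡⟨ ab≡4n ⟨
      a * b              ≤⟨ ℕ.*-mono-≤ a≤ b≤ ⟩
      g * 2 * (h * 2)    ≡⟨ regroup g h ⟩
      4 * (g * h)        ∎)
    gh≡n : g * h ≡ n
    gh≡n = ℕ.≤-antisym gh≤n n≤gh
    full : g * 2 * (h * 2) ≤ a * b
    full = ℕ.≤-reflexive (trans (regroup g h) (trans (cong (4 *_) gh≡n) (sym ab≡4n)))
    a≡ : a ≡ g * 2
    a≡ = *-factors a≤ b≤ (ℕ.*-mono-≤ 1≤h (s≤s (z≤n {1}))) full
    b≡ : b ≡ h * 2
    b≡ = *-factors b≤ a≤ (ℕ.*-mono-≤ 1≤g (s≤s (z≤n {1}))) (subst₂ _≤_ (ℕ.*-comm (g * 2) (h * 2)) (ℕ.*-comm a b) full)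
    a+b≤n+3 : a + b ≤ n + 3
    a+b≤n+3 = power-sum 5≤n co v₀ γG γH lowA lowB a≤ b≤ a≤n b≤n
    2n≰n : ∀ {k} → k * 1 ≡ n ⊎ 1 * k ≡ n → k * 2 ≤ n → ⊥
    2n≰n {k} e 2k≤n = ℕ.<⇒≱ (subst (n <_) (trans (cong₂ _+_ (k≡ e) (k≡ e)) (double k)) (ℕ.m<m+n n (ℕ.≤-trans (s≤s z≤n) 5≤n))) 2k≤n
      where
      k≡ : ∀ {k} → k * 1 ≡ n ⊎ 1 * k ≡ n → n ≡ k
      k≡ {k} (inj₁ e) = trans (sym e) (ℕ.*-identityʳ k)
      k≡ {k} (inj₂ e) = trans (sym e) (ℕ.*-identityˡ k)
      double : ∀ k → k + k ≡ k * 2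
      double = solve-∀
    n+4≰n+3 : ∀ {x} → x ≡ n + 4 → x ≤ n + 3 → ⊥
    n+4≰n+3 refl le = ℕ.<⇒≱ (ℕ.+-monoʳ-< n (ℕ.n<1+n 3)) le
    conclude : ∀ g h → g * h ≡ n → a ≡ g * 2 → b ≡ h * 2 → IsMinimum _≤_ (Dom G) g → IsMinimum _≤_ (Dom H) h → G ≅ K 3 □ K 3
    conclude zero _ refl _ _ _ _ = contradiction 5≤n λ ()
    conclude (suc g) zero e _ _ _ _ = contradiction (subst (5 ≤_) (trans (sym e) (ℕ.*-zeroʳ (suc g))) 5≤n) λ ()
    conclude 1 h@(suc _) e _ refl _ _ = contradiction (2n≰n {h} (inj₂ e) b≤n) λ ()
    conclude g@(suc _) 1 e refl _ _ _ = contradiction (2n≰n {g} (inj₁ e) a≤n) λ ()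
    conclude 2 h@(suc (suc _)) e refl refl _ _ = contradiction (n+4≰n+3 (trans (ℕ.+-comm 4 (h * 2)) (cong (_+ 4) (trans (ℕ.*-comm h 2) e))) a+b≤n+3) λ ()
    conclude g@(suc (suc _)) 2 e refl refl _ _ = contradiction (n+4≰n+3 (cong (_+ 4) e) a+b≤n+3) λ ()
    conclude (suc (suc (suc i))) (suc (suc (suc r))) e _ _ (_ , minG) (_ , minH) = balanced⇒grid co v₀ i r (sym e)
      (λ dom → ℕ.1+n≰n (minG _ dom)) (λ dom → ℕ.1+n≰n (minH _ dom))

  -- For the converse the order is 9 and both values are at least 6, while 6 · 6 = 4 · 9.
  -- Unobservability is a hypothesis because `H` is here an arbitrary complementary graph.
  power-extremal : (G ≅ K 3 □ K 3 → Unobservable G × Unobservable H) →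
                   Both (Th× γP) G H (λ a b → a * b ≡ 4 * n ⇔ G ≅ K 3 □ K 3)
  power-extremal unobservable with multiplicative-value γP G v₀ γG | multiplicative-value γP H v₀ γH
  ... | value {a} isA lowA kA _ achA refl (uA , nA) | value {b} isB lowB kB _ achB refl (uB , nB) =
    a , b , isA , isB , mk⇔ (extremal⇒grid lowA lowB uA uB nA nB) extremal
    where
    extremal : G ≅ K 3 □ K 3 → a * b ≡ 4 * n
    extremal iso with ↔⇒≡ (proj₁ iso)
    ... | refl = ℕ.≤-antisym (proj₂ (multiplicative-upper 5≤n gh≤n 1≤g 1≤h uA uB nA nB))
      (ℕ.*-mono-≤ (unobservable-lower (proj₁ (unobservable iso)) (ℕ.m≤m+n 6 3) kA achA)
                  (unobservable-lower (proj₂ (unobservable iso)) (ℕ.m≤m+n 6 3) kB achB))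

-- Specialisation to `G` and `∁ G`

module Instance {n : ℕ} (5≤n : 5 ≤ n) (G : Graph n) where

  v₀ : Fin n
  v₀ = fromℕ< (ℕ.≤-trans (s≤s z≤n) 5≤n)
  co : Complementary G (∁ G)
  co = ∁-complementary G
  γG : IsMinimum _≤_ (Dom G) (proj₁ (dominationNumber G))
  γG = proj₂ (dominationNumber G)
  γ∁G : IsMinimum _≤_ (Dom (∁ G)) (proj₁ (dominationNumber (∁ G)))
  γ∁G = proj₂ (dominationNumber (∁ G))

theorem4p10 :
  -- the bounds
  (∀ n → 5 ≤ n → (G : Graph n) →
      WithComplement (Th γP) G (λ a b → (5 ≤ a + b × a + b ≤ n + 2) × (6 ≤ a * b × a * b ≤ 2 * n))
    × (HasEdge G → HasEdge (∁ G) →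
      WithComplement (Th* γP) G (λ a b → (3 ≤ a + b × a + b ≤ n) × (2 ≤ a * b × a * b ≤ n)))
    × WithComplement (Th× γP) G (λ a b → (6 ≤ a + b × a + b ≤ n + 3) × (8 ≤ a * b × a * b ≤ 4 * n))
    × WithComplement (Th c) G (λ a b → (5 ≤ a + b × a + b ≤ n + 2) × (6 ≤ a * b × a * b ≤ 2 * n))
    × (HasEdge G → HasEdge (∁ G) →
      WithComplement (Th* c) G (λ a b → (3 ≤ a + b × a + b ≤ n) × (2 ≤ a * b × a * b ≤ n)))
    × WithComplement (Th× c) G (λ a b → (6 ≤ a + b × a + b ≤ n + 4) × (8 ≤ a * b × a * b ≤ 4 * n)))
  -- each bound is attained by infinitely many graphs, save one
  × (InfinitelyOften NoCondition (Th γP) (λ n a b → a + b ≡ 5)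
    × InfinitelyOften NoCondition (Th γP) (λ n a b → a + b ≡ n + 2)
    × InfinitelyOften NoCondition (Th γP) (λ n a b → a * b ≡ 6)
    × InfinitelyOften NoCondition (Th γP) (λ n a b → a * b ≡ 2 * n))
  × (InfinitelyOften BothHaveEdges (Th* γP) (λ n a b → a + b ≡ 3)
    × InfinitelyOften BothHaveEdges (Th* γP) (λ n a b → a + b ≡ n)
    × InfinitelyOften BothHaveEdges (Th* γP) (λ n a b → a * b ≡ 2)
    × InfinitelyOften BothHaveEdges (Th* γP) (λ n a b → a * b ≡ n))
  × (InfinitelyOften NoCondition (Th× γP) (λ n a b → a + b ≡ 6)
    × InfinitelyOften NoCondition (Th× γP) (λ n a b → a + b ≡ n + 3)
    × InfinitelyOften NoCondition (Th× γP) (λ n a b → a * b ≡ 8))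
  × (InfinitelyOften NoCondition (Th c) (λ n a b → a + b ≡ 5)
    × InfinitelyOften NoCondition (Th c) (λ n a b → a + b ≡ n + 2)
    × InfinitelyOften NoCondition (Th c) (λ n a b → a * b ≡ 6)
    × InfinitelyOften NoCondition (Th c) (λ n a b → a * b ≡ 2 * n))
  × (InfinitelyOften BothHaveEdges (Th* c) (λ n a b → a + b ≡ 3)
    × InfinitelyOften BothHaveEdges (Th* c) (λ n a b → a + b ≡ n)
    × InfinitelyOften BothHaveEdges (Th* c) (λ n a b → a * b ≡ 2)
    × InfinitelyOften BothHaveEdges (Th* c) (λ n a b → a * b ≡ n))
  × (InfinitelyOften NoCondition (Th× c) (λ n a b → a + b ≡ 6)
    × InfinitelyOften NoCondition (Th× c) (λ n a b → a + b ≡ n + 4)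
    × InfinitelyOften NoCondition (Th× c) (λ n a b → a * b ≡ 8)
    × InfinitelyOften NoCondition (Th× c) (λ n a b → a * b ≡ 4 * n))
  -- the exceptional bound
  × (∀ n → 5 ≤ n → (G : Graph n) →
    WithComplement (Th× γP) G (λ a b → a * b ≡ 4 * n ⇔ G ≅ K 3 □ K 3))
  -- no isolated vertices
  × (∀ Y n → 5 ≤ n → (G : Graph n) → ¬ HasIsolatedVertex G → ¬ HasIsolatedVertex (∁ G) →
    WithComplement (Th Y) G (λ a b → a + b ≤ ⌊ n /2⌋ + 4 × a * b ≤ n + ⌊ n /2⌋ + 3))
theorem4p10 =
    (λ n 5≤n G → let open Instance 5≤n G in
        additive-bounds γP co 5≤n v₀ γG γ∁G , initial-bounds γP co 5≤n v₀ γG γ∁G , power-bounds 5≤n co v₀ γG γ∁G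
      , additive-bounds c co 5≤n v₀ γG γ∁G , initial-bounds c co 5≤n v₀ γG γ∁G , multiplicative-bounds c co 5≤n v₀ γG γ∁G)
  , th-sharp γP
  , th*-sharp γP
  , (let six , eight = th×-sharp-lower γP in six , th×-power-sharp , eight)
  , th-sharp c
  , th*-sharp c
  , (let six , eight = th×-sharp-lower c
         sum , product = th×-cops-sharp in six , sum , eight , product)
  , (λ n 5≤n G → let open Instance 5≤n G in power-extremal 5≤n co v₀ γG γ∁G λ iso →
        unobservable-≅ {G = G} {K 3 □ K 3} iso K₃□K₃-unobservable
      , unobservable-≅ {G = ∁ G} {∁ (K 3 □ K 3)} (∁-≅ {G = G} {K 3 □ K 3} iso) ∁K₃□K₃-unobservable)
  , λ Y n 5≤n G → let open Instance 5≤n G in additive-bounds-half Y co 5≤n v₀ γG γ∁G
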